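{- Let $F$ be a fullerene graph that is not isomorphic to $F_{24}$, the (unique) fullerene graph on $24$ vertices. Then $f(F)\geq 3$.
   Context: A fullerene graph is a cubic $3$-connected plane graph all of whose faces are pentagons or hexagons. For a graph $G$ with a perfect matching $M$, a set $S\subseteq M$ is a forcing set of $M$ if $S$ is contained in no perfect matching of $G$ other than $M$; the forcing number $f(G,M)$ is the minimum size of a forcing set of $M$, and the minimum forcing number $f(G)$ is the minimum of $f(G,M)$ over all perfect matchings $M$ of $G$. There is exactly one fullerene graph with $24$ vertices, denoted $F_{24}$. -}

module Defs where

open import Data.Nat using (ℕ; zero; suc; _+_; _*_; _≤_; _<_; _≤ᵇ_)
open import Data.Fin using (Fin; toℕ) renaming (zero to fz; suc to fs)
open import Data.Fin.Subset using (Subset; _∈_)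
open import Data.Bool using (Bool; true; false; if_then_else_; _∧_)
open import Data.List using (List; _∷_; []; allFin; map; concatMap)
open import Data.Nat.ListAction using (sum)
open import Data.Product using (Σ; ∃; ∃-syntax; _×_; _,_; proj₁; proj₂)
open import Data.Sum using (_⊎_)
open import Relation.Binary.PropositionalEquality using (_≡_; _≢_)
open import Function.Bundles using (_↔_; Inverse; _⇔_)

-- Cubic plane graphs as rotation systems.
-- Vertices are Fin n.  nb v i (i : Fin 3) is the i-th neighbour of v;
-- the cyclic order 0 → 1 → 2 → 0 of Fin 3 is the rotation (local
-- clockwise order of the edges) at v, i.e. the combinatorial embedding.
-- rev v i is the index of v among the neighbours of nb v i.

next3 : Fin 3 → Fin 3
next3 fz = fs fz
next3 (fs fz) = fs (fs fz)
next3 (fs (fs fz)) = fz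

record CubicMap (n : ℕ) : Set where
  field
    nb       : Fin n → Fin 3 → Fin n
    rev      : Fin n → Fin 3 → Fin 3
    nb-rev   : ∀ v i → nb (nb v i) (rev v i) ≡ v
    loopless : ∀ v i → nb v i ≢ v
    simple   : ∀ v i j → nb v i ≡ nb v j → i ≡ j

  Adj : Fin n → Fin n → Set
  Adj u v = ∃[ i ] nb u i ≡ v

  -- darts (= oriented edges) and the face-tracing permutation
  Dart : Set
  Dart = Fin n × Fin 3

  φ : Dart → Dart
  φ (v , i) = (nb v i , next3 (rev v i))

  φ^ : ℕ → Dart → Dart
  φ^ zero d = d
  φ^ (suc k) d = φ (φ^ k d)

  FaceSize : Dart → ℕ → Set
  FaceSize d k = (0 < k) × (φ^ k d ≡ d) × (∀ m → 0 < m → m < k → φ^ m d ≢ d)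

  dartIdx : Dart → ℕ
  dartIdx (v , i) = 3 * toℕ v + toℕ i

  -- d is the least dart of its face (faces have at most 6 darts below)
  isFaceRep : Dart → Bool
  isFaceRep d = go 5
    where
    go : ℕ → Bool
    go zero = true
    go (suc k) = (dartIdx d ≤ᵇ dartIdx (φ^ (suc k) d)) ∧ go k

  allDarts : List Dart
  allDarts = concatMap (λ v → map (λ i → (v , i)) (allFin 3)) (allFin n)

  -- number of faces, counted via representatives
  -- (correct when every face has at most 6 sides)
  numFaces : ℕ
  numFaces = sum (map (λ d → if isFaceRep d then 1 else 0) allDarts)

  data Reach (P : Fin n → Set) : Fin n → Fin n → Set where
    here : ∀ {u} → Reach P u u
    step : ∀ {u w v} → Adj u w → P w → Reach P w v → Reach P u v

  -- 3-connected: more than 3 vertices, and deleting any ≤ 2 vertices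
  -- (a, b, possibly equal) leaves the graph connected.
  ThreeConnected : Set
  ThreeConnected = (3 < n) × (∀ a b u v → u ≢ a → u ≢ b → v ≢ a → v ≢ b →
                     Reach (λ w → (w ≢ a) × (w ≢ b)) u v)

  -- Euler: V - E + F = 2 with E = 3V/2, i.e. 2V + 2F = 4 + 3V;
  -- for a connected map this says the rotation system is of genus 0.
  Spherical : Set
  Spherical = 2 * n + 2 * numFaces ≡ 4 + 3 * n

record Fullerene (n : ℕ) : Set where
  field
    cmap      : CubicMap n
  open CubicMap cmap public
  field
    threeConn : ThreeConnected
    planar    : Spherical
    faces56   : ∀ d → FaceSize d 5 ⊎ FaceSize d 6

Isomorphic : ∀ {n m} → Fullerene n → Fullerene m → Set
Isomorphic {n} {m} F G =
  Σ (Fin n ↔ Fin m) λ f →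
    ∀ u v → Fullerene.Adj F u v ⇔ Fullerene.Adj G (Inverse.to f u) (Inverse.to f v)

record PerfectMatching {n : ℕ} (F : Fullerene n) : Set where
  field
    partner   : Fin n → Fin n
    adj       : ∀ v → Fullerene.Adj F v (partner v)
    involutive : ∀ v → partner (partner v) ≡ v
open PerfectMatching public

-- A subset S of the edges of M, represented by the set of vertices it
-- covers (a vertex set closed under the partner map); it has ∣S∣/2 edges.
EdgeSubsetOf : ∀ {n} {F : Fullerene n} → PerfectMatching F → Subset n → Set
EdgeSubsetOf M S = ∀ u → u ∈ S → partner M u ∈ S

SameMatching : ∀ {n} {F : Fullerene n} → PerfectMatching F → PerfectMatching F → Set
SameMatching M M' = ∀ v → partner M v ≡ partner M' v

IsForcingSet : ∀ {n} {F : Fullerene n} → PerfectMatching F → Subset n → Set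
IsForcingSet {F = F} M S =
  EdgeSubsetOf M S ×
  (∀ (M' : PerfectMatching F) → (∀ u → u ∈ S → partner M' u ≡ partner M u) →
     SameMatching M M')

-- Two matching edges forcing M leave a set U with a unique perfect matching and at most 8 edges to its complement W.
-- By Kotzig's theorem such a set has a bridge in the matching, which cuts U into two odd pieces; the cut of U grows by 2
-- in total, and every cut has at least 3 edges. As a fullerene has no triangles or squares and its pentagons are faces,
-- the pieces with small cuts can be listed, and either U has a leaf, or U consists of two pentagons joined by a bridge.
-- Moving a leaf and its mate from U to W keeps the cut at 8 or lowers it to 6. Read as a patch, W is described by the
-- cyclic word of the numbers of its vertices on the faces between consecutive edges of the cut. Since the first homology
-- of the sphere vanishes modulo 2, a face cannot cross the cut in two different places, so a leaf always closes the face
-- between two consecutive edges, and its length must be 5 or 6. Starting from the only patch with 6 vertices that can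
-- occur, a tree, only finitely many words are reachable, and they end either in a contradiction or in the two pentagons
-- around a patch with 14 vertices, which gives 24 vertices.

module Submission where

open import Defs
import Algebra.Solver.CommutativeMonoid as CMSolver
open import Data.Bool using (Bool; true; false; if_then_else_; not; _∧_; _∨_; _xor_; T)
open import Data.Bool.ListAction using () renaming (all to allᵇ)
import Data.Bool.Properties as Boolₚ
open import Data.Empty using (⊥; ⊥-elim)
open import Data.Fin as Fin using (Fin; toℕ) renaming (zero to fz; suc to fs)
import Data.Fin.Properties as Finₚ
open import Data.Fin.Subset using (Subset; ∣_∣) renaming (_∈_ to _∈ₛ_; _-_ to _-ₛ_)
import Data.Fin.Subset.Properties as Subsetₚ
open import Data.List as List using (List; []; _∷_; _++_; [_]; length; map; filter; allFin; concatMap)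
import Data.List.Properties as Listₚ
open import Data.List.Membership.Propositional using (_∈_; _∉_; find; lose)
import Data.List.Membership.Propositional.Properties as ∈ₚ
open import Data.List.Relation.Binary.Permutation.Propositional
  using (_↭_; ↭-refl; ↭-sym; ↭-trans; ↭-reflexive; prep; swap)
import Data.List.Relation.Binary.Permutation.Propositional.Properties as ↭ₚ
open import Data.List.Relation.Unary.All as All using (All; []; _∷_)
import Data.List.Relation.Unary.All.Properties as Allₚ
open import Data.List.Relation.Unary.AllPairs using ([]; _∷_)
open import Data.List.Relation.Unary.Any as Any using (Any; here; there)
import Data.List.Relation.Unary.Any.Properties as Anyₚ
open import Data.List.Relation.Unary.Unique.Propositional using (Unique)
import Data.List.Relation.Unary.Unique.Propositional.Properties as Uniqueₚ
open import Data.Nat using (ℕ; zero; suc; _+_; _*_; _∸_; _^_; _≤_; _<_; _≤ᵇ_; _≡ᵇ_; z≤n; s≤s; _≤?_; _<?_)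
import Data.Nat.Properties as ℕₚ
import Data.Nat.ListAction.Properties as Sumₚ
open import Data.Nat.ListAction using (sum)
open import Data.Nat.Tactic.RingSolver using (solve-∀)
open import Data.Product using (Σ; ∃-syntax; ∃₂; _×_; _,_; proj₁; proj₂; uncurry)
import Data.Product.Properties as ×ₚ
open import Data.Sum using (_⊎_; inj₁; inj₂; [_,_]′)
open import Data.Unit using (⊤; tt)
open import Data.Vec as Vec using (Vec; []; _∷_)
import Data.Vec.Properties as Vecₚ
open import Function using (_∘_; id; case_of_)
open import Function.Construct.Identity using (↔-id)
open import Function.Bundles using (mk⇔)
open import Function.Definitions using (Injective)
open import Relation.Binary.Definitions using (DecidableEquality; tri<; tri≈; tri>)
open import Relation.Binary.PropositionalEquality
  using (_≡_; _≢_; refl; sym; trans; cong; cong₂; subst; subst₂; ≢-sym; module ≡-Reasoning)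
open import Relation.Nullary using (¬_; Dec; yes; no; contradiction; ⌊_⌋)
open import Relation.Nullary.Decidable using (decidable-stable; _×-dec_; ¬?)

-- A `Fullerene` is a rotation system with Euler's formula, so no curve or plane region is
-- available. The Jordan curve theorem is replaced by `exactness`: the edges of a cycle modulo 2 are
-- those where some 2-colouring of the faces changes. It rests on counting: pairs of a face
-- colouring and a vertex weight map injectively to edge sets with two extra bits, Euler's formula
-- makes both sides equally large, so every edge set is hit. Besides the faces around W, this also
-- serves short cycles: a chordless cycle of length at most 5 with vertices on both sides would send
-- 3 edges to each. The bound 8 comes from the 12 edge ends at two matching edges, 4 of which these
-- edges use themselves. Two edges far apart form no connected patch; a word can be read only after
-- the first leaf and its mate have joined them. Every case in which U is small contradicts the
-- bound of 20 on the number of vertices. The search over words is the Boolean function `safe`,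
-- evaluated by the type checker; `play` is its soundness. The hypothesis on `F24` enters as
-- `n ≢ 24`, since a fullerene on 24 vertices could be taken as `F24` itself.

-- Finite counting, sums modulo 2, and lists up to permutation.

injective⇒surjective : ∀ {k} {f : Fin k → Fin k} → Injective _≡_ _≡_ f → ∀ y → ∃[ x ] f x ≡ y
injective⇒surjective {zero}  {f} inj ()
injective⇒surjective {suc k} {f} inj y with Finₚ.any? (λ x → f x Finₚ.≟ y)
... | yes hit = hit
... | no miss = contradiction (Finₚ.injective⇒≤ {f = g} g-inj) ℕₚ.1+n≰n
  where
  y≢f : ∀ x → y ≢ f x
  y≢f x eq = miss (x , sym eq)
  g : Fin (suc k) → Fin k
  g x = Fin.punchOut (y≢f x)
  g-inj : Injective _≡_ _≡_ g
  g-inj {a} {b} eq = inj (Finₚ.punchOut-injective (y≢f a) (y≢f b) eq)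

bit : Bool → Fin 2
bit false = fz
bit true  = fs fz

unbit : Fin 2 → Bool
unbit fz     = false
unbit (fs _) = true

unbit-bit : ∀ b → unbit (bit b) ≡ b
unbit-bit false = refl
unbit-bit true  = refl

bit-unbit : ∀ i → bit (unbit i) ≡ i
bit-unbit fz      = refl
bit-unbit (fs fz) = refl

code : ∀ {m} → Vec Bool m → Fin (2 ^ m)
code []      = fz
code (b ∷ v) = Fin.combine (bit b) (code v)

decode : ∀ m → Fin (2 ^ m) → Vec Bool m
decode zero    _ = []
decode (suc m) i = unbit (proj₁ (Fin.remQuot {2} (2 ^ m) i)) ∷ decode m (proj₂ (Fin.remQuot {2} (2 ^ m) i))

decode-code : ∀ {m} (v : Vec Bool m) → decode m (code v) ≡ v
decode-code []      = refl
decode-code {suc m} (b ∷ v) =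
  cong₂ _∷_ (trans (cong (unbit ∘ proj₁) eq) (unbit-bit b)) (trans (cong (decode m ∘ proj₂) eq) (decode-code v))
  where
  eq : Fin.remQuot {2} (2 ^ m) (Fin.combine (bit b) (code v)) ≡ (bit b , code v)
  eq = Finₚ.remQuot-combine (bit b) (code v)

code-decode : ∀ m i → code (decode m i) ≡ i
code-decode zero    fz = refl
code-decode (suc m) i =
  trans (cong₂ Fin.combine (bit-unbit (proj₁ qr)) (code-decode m (proj₂ qr))) (Finₚ.combine-remQuot {2} (2 ^ m) i)
  where
  qr : Fin 2 × Fin (2 ^ m)
  qr = Fin.remQuot {2} (2 ^ m) i

-- The dimension count of linear algebra over the field with two elements, in the form of a
-- cardinality argument: both sides have equally many vectors.
boolVec-surjective : ∀ {m m′} → m ≡ m′ → (f : Vec Bool m → Vec Bool m′) → Injective _≡_ _≡_ f →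
                     ∀ y → ∃[ x ] f x ≡ y
boolVec-surjective {m} refl f inj y
  with injective⇒surjective {f = λ i → code (f (decode m i))}
         (λ {a} {b} eq → trans (sym (code-decode m a)) (trans (cong code (inj (code-inj eq))) (code-decode m b)))
         (code y)
  where
  code-inj : ∀ {v w : Vec Bool m} → code v ≡ code w → v ≡ w
  code-inj eq = trans (sym (decode-code _)) (trans (cong (decode m) eq) (decode-code _))
... | i , eq = decode m i , trans (sym (decode-code _)) (trans (cong (decode m) eq) (decode-code y))

xor-cancel : ∀ a b → (a xor b) xor b ≡ a
xor-cancel a b = trans (Boolₚ.xor-assoc a b b) (trans (cong (a xor_) (Boolₚ.xor-same b)) (Boolₚ.xor-identityʳ a))

xor-interchange : ∀ a b c d → (a xor b) xor (c xor d) ≡ (a xor c) xor (b xor d)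
xor-interchange false b c d = trans (sym (Boolₚ.xor-assoc b c d)) (trans (cong (_xor d) (Boolₚ.xor-comm b c)) (Boolₚ.xor-assoc c b d))
xor-interchange true  false false d = refl
xor-interchange true  false true  d = Boolₚ.not-involutive d
xor-interchange true  true  false d = sym (Boolₚ.not-involutive d)
xor-interchange true  true  true  d = refl

xor-0⇒≡ : ∀ {a b} → a xor b ≡ false → a ≡ b
xor-0⇒≡ {false} {false} _ = refl
xor-0⇒≡ {true}  {true}  _ = refl

⌊yes⌋ : ∀ {a} {A : Set a} (d : Dec A) → A → ⌊ d ⌋ ≡ true
⌊yes⌋ (yes _) _ = refl
⌊yes⌋ (no ¬a) a = contradiction a ¬a

⌊no⌋ : ∀ {a} {A : Set a} (d : Dec A) → ¬ A → ⌊ d ⌋ ≡ false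
⌊no⌋ (yes a) ¬a = contradiction a ¬a
⌊no⌋ (no _) _ = refl

⌊⌋-cong : ∀ {a b} {A : Set a} {B : Set b} (d : Dec A) (e : Dec B) → (A → B) → (B → A) → ⌊ d ⌋ ≡ ⌊ e ⌋
⌊⌋-cong (yes a) e f g = sym (⌊yes⌋ e (f a))
⌊⌋-cong (no ¬a) e f g = sym (⌊no⌋ e (¬a ∘ g))

next3³ : ∀ i → next3 (next3 (next3 i)) ≡ i
next3³ fz           = refl
next3³ (fs fz)      = refl
next3³ (fs (fs fz)) = refl

next3-≢ : ∀ i → next3 i ≢ i
next3-≢ fz ()
next3-≢ (fs fz) ()
next3-≢ (fs (fs fz)) ()

next3²-≢ : ∀ i → next3 (next3 i) ≢ i
next3²-≢ fz ()
next3²-≢ (fs fz) ()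
next3²-≢ (fs (fs fz)) ()

⨁ : ∀ {m} → (Fin m → Bool) → Bool
⨁ {zero}  f = false
⨁ {suc m} f = f fz xor ⨁ (f ∘ fs)

⨁-cong : ∀ {m} {f g : Fin m → Bool} → (∀ i → f i ≡ g i) → ⨁ f ≡ ⨁ g
⨁-cong {zero}  eq = refl
⨁-cong {suc m} eq = cong₂ _xor_ (eq fz) (⨁-cong (eq ∘ fs))

⨁-zero : ∀ {m} {f : Fin m → Bool} → (∀ i → f i ≡ false) → ⨁ f ≡ false
⨁-zero {zero}  eq = refl
⨁-zero {suc m} eq = cong₂ _xor_ (eq fz) (⨁-zero (eq ∘ fs))

⨁-xor : ∀ {m} (f g : Fin m → Bool) → ⨁ (λ i → f i xor g i) ≡ ⨁ f xor ⨁ g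
⨁-xor {zero}  f g = refl
⨁-xor {suc m} f g = trans (cong ((f fz xor g fz) xor_) (⨁-xor (f ∘ fs) (g ∘ fs))) (xor-interchange (f fz) _ _ _)

⨁-pick : ∀ {m} (w : Fin m → Bool) x → ⨁ (λ u → w u ∧ ⌊ u Finₚ.≟ x ⌋) ≡ w x
⨁-pick {suc m} w fz =
  trans (cong₂ _xor_ (Boolₚ.∧-identityʳ (w fz)) (⨁-zero (λ i → Boolₚ.∧-zeroʳ (w (fs i))))) (Boolₚ.xor-identityʳ (w fz))
⨁-pick {suc m} w (fs x) =
  trans (cong₂ _xor_ (Boolₚ.∧-zeroʳ (w fz))
                     (⨁-cong (λ u → cong (w (fs u) ∧_) (⌊⌋-cong (fs u Finₚ.≟ fs x) (u Finₚ.≟ x) Finₚ.suc-injective (cong fs)))))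
        (⨁-pick (w ∘ fs) x)

fresh : ∀ {n} (L : List (Fin n)) → length L < n → ∃[ x ] x ∉ L
fresh {n} L short with Finₚ.any? (λ x → ¬? (Any.any? (x Finₚ.≟_) L))
... | yes found = found
... | no none = contradiction (Finₚ.injective⇒≤ {f = pos} pos-inj) (ℕₚ.<⇒≱ short)
  where
  mem : ∀ x → x ∈ L
  mem x = decidable-stable (Any.any? (x Finₚ.≟_) L) (λ x∉L → none (x , x∉L))
  pos : Fin n → Fin (length L)
  pos x = Any.index (mem x)
  pos-inj : Injective _≡_ _≡_ pos
  pos-inj {x} {y} eq =
    trans (Anyₚ.lookup-index (mem x)) (trans (cong (List.lookup L) eq) (sym (Anyₚ.lookup-index (mem y))))

lookup-unique : ∀ {a} {A : Set a} {xs : List A} → Unique xs → ∀ {i j} →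
                List.lookup xs i ≡ List.lookup xs j → i ≡ j
lookup-unique (_ ∷ _)    {fz}   {fz}   _  = refl
lookup-unique (px ∷ _)   {fz}   {fs j} eq = contradiction eq (All.lookup px (∈ₚ.∈-lookup j))
lookup-unique (px ∷ _)   {fs i} {fz}   eq = contradiction (sym eq) (All.lookup px (∈ₚ.∈-lookup i))
lookup-unique (_ ∷ uniq) {fs i} {fs j} eq = cong fs (lookup-unique uniq eq)

module _ {a} {A : Set a} where

  unique-resp-↭ : ∀ {xs ys : List A} → xs ↭ ys → Unique xs → Unique ys
  unique-resp-↭ _↭_.refl uniq = uniq
  unique-resp-↭ (prep x p) (x∉ ∷ uniq) = ↭ₚ.All-resp-↭ p x∉ ∷ unique-resp-↭ p uniq
  unique-resp-↭ (swap x y p) ((x≢y ∷ x∉) ∷ y∉ ∷ uniq) =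
    (≢-sym x≢y ∷ ↭ₚ.All-resp-↭ p y∉) ∷ ↭ₚ.All-resp-↭ p x∉ ∷ unique-resp-↭ p uniq
  unique-resp-↭ (_↭_.trans p q) uniq = unique-resp-↭ q (unique-resp-↭ p uniq)

  unique-disjoint : ∀ {xs ys : List A} → Unique (xs ++ ys) → ∀ {x} → x ∈ xs → x ∉ ys
  unique-disjoint {x ∷ xs} (x∉ ∷ _) (here refl) x∈ys = All.lookup x∉ (∈ₚ.∈-++⁺ʳ xs x∈ys) refl
  unique-disjoint {x ∷ xs} (_ ∷ uniq) (there p) x∈ys = unique-disjoint uniq p x∈ys

  unique-++ˡ : ∀ {xs ys : List A} → Unique (xs ++ ys) → Unique xs
  unique-++ˡ {[]}     _           = []
  unique-++ˡ {x ∷ xs} (x∉ ∷ uniq) = Allₚ.++⁻ˡ xs x∉ ∷ unique-++ˡ uniq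

  unique-++ʳ : ∀ xs {ys : List A} → Unique (xs ++ ys) → Unique ys
  unique-++ʳ []       uniq       = uniq
  unique-++ʳ (x ∷ xs) (_ ∷ uniq) = unique-++ʳ xs uniq

  unique-head : ∀ {x y} {xs : List A} → Unique (x ∷ xs) → y ∈ xs → x ≢ y
  unique-head (x∉ ∷ _) = All.lookup x∉

  unique-tail : ∀ {x} {xs : List A} → Unique (x ∷ xs) → Unique xs
  unique-tail (_ ∷ uniq) = uniq

  pull-out : ∀ {x} {xs : List A} → x ∈ xs → ∃[ ys ] xs ↭ x ∷ ys
  pull-out {x} x∈xs with ∈ₚ.∈-∃++ x∈xs
  ... | ys , zs , refl = ys ++ zs , ↭ₚ.shift x ys zs

  extract : ∀ {A′ : List A} L → Unique L → All (_∈ A′) L → ∃[ R ] A′ ↭ L ++ R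
  extract []      _           _            = _ , ↭-refl
  extract (x ∷ L) (x∉ ∷ uniq) (x∈ ∷ all∈) with pull-out x∈
  ... | R₀ , p with extract L uniq (All.zipWith (λ { (x≢y , y∈) → other (≢-sym x≢y) (↭ₚ.∈-resp-↭ p y∈) }) (x∉ , all∈))
    where
    other : ∀ {y} → y ≢ x → y ∈ x ∷ R₀ → y ∈ R₀
    other ne (here eq) = contradiction eq ne
    other ne (there q) = q
  ... | R , q = R , ↭-trans p (prep x q)

sum-map-+ : ∀ {a} {A : Set a} (f g : A → ℕ) xs → sum (map (λ x → f x + g x) xs) ≡ sum (map f xs) + sum (map g xs)
sum-map-+ f g [] = refl
sum-map-+ f g (x ∷ xs) = trans (cong ((f x + g x) +_) (sum-map-+ f g xs)) (mix (f x) (g x) (sum (map f xs)) (sum (map g xs)))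
  where
  mix : ∀ a b c d → (a + b) + (c + d) ≡ (a + c) + (b + d)
  mix = solve-∀

sum-map-const : ∀ {a} {A : Set a} (f : A → ℕ) k xs → (∀ {x} → x ∈ xs → f x ≡ k) → sum (map f xs) ≡ length xs * k
sum-map-const f k [] eq = refl
sum-map-const f k (x ∷ xs) eq = cong₂ _+_ (eq (here refl)) (sum-map-const f k xs (eq ∘ there))

sum-map-0 : ∀ {a} {A : Set a} (f : A → ℕ) xs → sum (map f xs) ≡ 0 → ∀ {x} → x ∈ xs → f x ≡ 0
sum-map-0 f (x ∷ xs) eq (here refl) = ℕₚ.m+n≡0⇒m≡0 (f x) eq
sum-map-0 f (x ∷ xs) eq (there p) = sum-map-0 f xs (ℕₚ.m+n≡0⇒n≡0 (f x) eq) p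

sum-map-≤1 : ∀ {a} {A : Set a} (f : A → ℕ) {z} xs → z ∈ xs → sum (map f xs) ≤ 1 →
             ∃[ p ] p ∈ xs × (∀ {x} → x ∈ xs → x ≢ p → f x ≡ 0)
sum-map-≤1 f (x ∷ xs) z∈ le with f x in eq
... | suc k = x , here refl , λ { (here refl) ne → contradiction refl ne
                                ; (there p) ne → sum-map-0 f xs (ℕₚ.n≤0⇒n≡0 (ℕₚ.m+n≤o⇒n≤o k (ℕₚ.≤-pred le))) p }
sum-map-≤1 f (x ∷ []) z∈ le | zero = x , here refl , λ { (here refl) ne → eq }
sum-map-≤1 f (x ∷ y ∷ ys) z∈ le | zero with sum-map-≤1 f (y ∷ ys) (here refl) le
... | p , p∈ , rest = p , there p∈ , λ { (here refl) ne → eq ; (there q) ne → rest q ne }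

-- In `cut-bound` the terms count the cut edges at a vertex, so `p` and `q` meet every edge of a cut
-- with at most two edges. They may coincide; `z` ensures that there is an element to return at all.
sum-map-≤2 : ∀ {a} {A : Set a} (f : A → ℕ) {z} xs → z ∈ xs → sum (map f xs) ≤ 2 →
             ∃₂ λ p q → p ∈ xs × q ∈ xs × (∀ {x} → x ∈ xs → x ≢ p → x ≢ q → f x ≡ 0)
sum-map-≤2 f (x ∷ []) z∈ le = x , x , here refl , here refl , λ { (here refl) ne _ → contradiction refl ne }
sum-map-≤2 f (x ∷ xs@(y ∷ _)) z∈ le = skip (f x ℕₚ.≟ 0) (sum-map-≤2 f xs (here refl) (ℕₚ.m+n≤o⇒n≤o (f x) le))
  where
  skip : Dec (f x ≡ 0) → _ → _
  skip (yes eq) (p , q , p∈ , q∈ , rest) = p , q , there p∈ , there q∈ , λ { (here refl) _ _ → eq ; (there r) np nq → rest r np nq }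
  skip (no ≢0) _ with sum-map-≤1 f xs (here refl) (ℕₚ.≤-pred (ℕₚ.≤-trans (ℕₚ.+-monoˡ-≤ (sum (map f xs)) (ℕₚ.n≢0⇒n>0 ≢0)) le))
  ... | q , q∈ , rest = x , q , here refl , there q∈ , λ { (here refl) ne _ → contradiction refl ne ; (there r) _ nq → rest r nq }

module ↭Solver {a} {A : Set a} = CMSolver (↭ₚ.++-commutativeMonoid {A = A})

filter-bool-↭ : ∀ {a} {A : Set a} (p : A → Bool) xs →
  xs ↭ filter (λ x → p x Boolₚ.≟ true) xs ++ filter (λ x → p x Boolₚ.≟ false) xs
filter-bool-↭ p [] = ↭-refl
filter-bool-↭ p (x ∷ xs) with p x
... | true  = prep x (filter-bool-↭ p xs)
... | false = ↭-trans (prep x (filter-bool-↭ p xs)) (↭-sym (↭ₚ.shift x (filter (λ x → p x Boolₚ.≟ true) xs) _))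

sum-map-≤ : ∀ {a} {A : Set a} (f g : A → ℕ) xs → (∀ {x} → x ∈ xs → f x ≤ g x) → sum (map f xs) ≤ sum (map g xs)
sum-map-≤ f g [] le = z≤n
sum-map-≤ f g (x ∷ xs) le = ℕₚ.+-mono-≤ (le (here refl)) (sum-map-≤ f g xs (le ∘ there))

-- Cyclic gap words and the finite search on them.

-- The last gap of a word is cyclically the one before the first leg, so a vertex attached along the
-- first leg counts on that face too.
bump : List ℕ → List ℕ
bump []          = []
bump (k ∷ [])    = suc k ∷ []
bump (k ∷ l ∷ r) = k ∷ bump (l ∷ r)

data Rotation : List ℕ → List ℕ → Set where
  fixed : ∀ {w} → Rotation w w
  rot   : ∀ {g gs w} → Rotation (gs ++ [ g ]) w → Rotation (g ∷ gs) w

rotation-trans : ∀ {u v w} → Rotation u v → Rotation v w → Rotation u w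
rotation-trans fixed   r = r
rotation-trans (rot q) r = rot (rotation-trans q r)

-- The cyclic word of gaps continues, read from its head, with gaps that complement hs to faces of size 5 or 6.
Follows : List ℕ → List ℕ → Set
Follows []       w        = ⊤
Follows (h ∷ hs) []       = ⊥
Follows (h ∷ hs) (g ∷ gs) = (g + h ≡ 5 ⊎ g + h ≡ 6) × Follows hs (gs ++ [ g ])

rotate₁ : List ℕ → List ℕ
rotate₁ []       = []
rotate₁ (g ∷ gs) = gs ++ [ g ]

iterate : ℕ → List ℕ → List ℕ
iterate zero    w = w
iterate (suc k) w = iterate k (rotate₁ w)

rotations : List ℕ → List (List ℕ)
rotations w = List.applyUpTo (λ k → iterate k w) (suc (length w))

iterate-++ : ∀ us vs → iterate (length us) (us ++ vs) ≡ vs ++ us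
iterate-++ [] vs = sym (Listₚ.++-identityʳ vs)
iterate-++ (u ∷ us) vs = trans (cong (iterate (length us)) (Listₚ.++-assoc us vs [ u ]))
  (trans (iterate-++ us (vs ++ [ u ])) (Listₚ.++-assoc vs [ u ] us))

iterate-suc : ∀ k w → iterate (suc k) w ≡ rotate₁ (iterate k w)
iterate-suc zero    w = refl
iterate-suc (suc k) w = iterate-suc k (rotate₁ w)

-- Rotating by the full length is the identity, so larger exponents fold back. This makes the finite
-- list `rotations` exhaustive.
iterate-reduce : ∀ w k → ∃[ j ] j ≤ length w × iterate k w ≡ iterate j w
iterate-reduce w zero = 0 , z≤n , refl
iterate-reduce w (suc k) with iterate-reduce w k
... | j , j≤ , eq with ℕₚ.m≤n⇒m<n∨m≡n j≤
...   | inj₁ j< = suc j , j< , trans (iterate-suc k w) (trans (cong rotate₁ eq) (sym (iterate-suc j w)))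
...   | inj₂ refl = one (length w) refl
  where
  full : iterate (length w) w ≡ w
  full = trans (cong (iterate (length w)) (sym (Listₚ.++-identityʳ w))) (iterate-++ w [])
  step′ : iterate (suc k) w ≡ rotate₁ w
  step′ = trans (iterate-suc k w) (cong rotate₁ (trans eq full))
  one : ∀ l → length w ≡ l → ∃[ j ] j ≤ length w × iterate (suc k) w ≡ iterate j w
  one zero e = 0 , z≤n , trans step′ (empty w e)
    where
    empty : ∀ w → length w ≡ 0 → rotate₁ w ≡ w
    empty [] _ = refl
  one (suc l) e = 1 , subst (1 ≤_) (sym e) (s≤s z≤n) , step′

rotation-iterate : ∀ {w w′} → Rotation w w′ → ∃[ k ] w′ ≡ iterate k w
rotation-iterate fixed = 0 , refl
rotation-iterate (rot r) = let k , eq = rotation-iterate r in suc k , eq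

rotation-∈ : ∀ {w w′} → Rotation w w′ → w′ ∈ rotations w
rotation-∈ {w} r = let k , eq = rotation-iterate r
                       j , j≤ , eq′ = iterate-reduce w k
                   in subst (_∈ rotations w) (sym (trans eq eq′)) (∈ₚ.∈-applyUpTo⁺ (λ k → iterate k w) (s≤s j≤))

∧-true : ∀ {a b} → a ∧ b ≡ true → a ≡ true × b ≡ true
∧-true {true} {true} _ = refl , refl

⇒-true : ∀ {a b} → not a ∨ b ≡ true → a ≡ true → b ≡ true
⇒-true h refl = h

all-∈ : ∀ {a} {A : Set a} (p : A → Bool) {xs x} → allᵇ p xs ≡ true → x ∈ xs → p x ≡ true
all-∈ p h (here refl) = proj₁ (∧-true h)
all-∈ p {x ∷ _} h (there x∈) = all-∈ p (proj₂ (∧-true {p x} h)) x∈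

isSmall : List ℕ → Bool
isSmall = allᵇ (_≤ᵇ 5)

small-word : ∀ {w} → All (_≤ 5) w → isSmall w ≡ true
small-word [] = refl
small-word (g≤ ∷ gs≤) = cong₂ _∧_ (T⇒≡ (ℕₚ.≤⇒≤ᵇ g≤)) (small-word gs≤)
  where
  T⇒≡ : ∀ {b} → T b → b ≡ true
  T⇒≡ {true} _ = refl

-- A vertex joining two consecutive legs closes a face consisting of the gap between them and the
-- vertex itself; gaps 4 and 5 are those that give size 5 or 6.
closable : List ℕ → Bool
closable (4 ∷ _ ∷ _) = true
closable (5 ∷ _ ∷ _) = true
closable _           = false

-- Effect of attaching a vertex. By two consecutive legs: the gap between them becomes a closed face
-- and drops out, and the vertex counts on both neighbouring faces. By one leg: the same two faces
-- grow, and the vertex is alone between its two new legs, hence the 1.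
closeWord extendWord : List ℕ → List ℕ
closeWord (_ ∷ g ∷ gs) = bump (suc g ∷ gs)
closeWord _            = []
extendWord (g ∷ gs) = 1 ∷ bump (suc g ∷ gs)
extendWord []       = []

closable-true : ∀ {g g′ gs} → g ≡ 4 ⊎ g ≡ 5 → closable (g ∷ g′ ∷ gs) ≡ true
closable-true (inj₁ refl) = refl
closable-true (inj₂ refl) = refl

-- Vertices of two pentagons joined by a bridge on the eight faces around them: two on a face along
-- a pentagon edge away from the bridge, four on the two faces along the bridge.
pentagonal : List ℕ
pentagonal = 2 ∷ 2 ∷ 2 ∷ 4 ∷ 2 ∷ 2 ∷ 2 ∷ 4 ∷ []

followsᵇ : List ℕ → List ℕ → Bool
followsᵇ []       w        = true
followsᵇ (h ∷ hs) []       = false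
followsᵇ (h ∷ hs) (g ∷ gs) = ((g + h ≡ᵇ 5) ∨ (g + h ≡ᵇ 6)) ∧ followsᵇ hs (gs ++ [ g ])


follows-true : ∀ hs w → Follows hs w → followsᵇ hs w ≡ true
follows-true [] w _ = refl
follows-true (h ∷ hs) (g ∷ gs) (inj₁ e , f) = cong₂ _∧_ (cong (λ k → (k ≡ᵇ 5) ∨ (k ≡ᵇ 6)) e) (follows-true hs (gs ++ [ g ]) f)

follows-true (h ∷ hs) (g ∷ gs) (inj₂ e , f) = cong₂ _∧_ (cong (λ k → (k ≡ᵇ 5) ∨ (k ≡ᵇ 6)) e) (follows-true hs (gs ++ [ g ]) f)


-- Meant for cuts with 6 edges. There a leaf always exists and makes some rotation closable, so a
-- patch with such a word is impossible. A word with an entry above 5 belongs to no patch.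
stuck : List ℕ → Bool
stuck w = not (isSmall w) ∨ allᵇ (not ∘ closable) (rotations w)

-- Treats a mate that closes a face right after its leaf did; the cut then has 6 edges.
settled : List ℕ → Bool
settled t = not (closable t) ∨ stuck (closeWord t)

-- safe k s w: from a patch with s vertices and gap word w, the removal of leaves ends within k rounds, and only a patch
-- with 14 vertices can be bounded by two pentagons.
safe moves : ℕ → ℕ → List ℕ → Bool
safe zero    s w = false
safe (suc k) s w = not (isSmall w) ∨ allᵇ (λ v → (not (followsᵇ pentagonal v) ∨ (s ≡ᵇ 14)) ∧ (not (closable v) ∨ moves k s v)) (rotations w)

-- The leaf closes a face. Its mate then hangs on the leaf alone, and the game goes on with two more
-- vertices, or closes a face as well.
moves k s v = safe k (2 + s) (extendWord (closeWord v)) ∧ allᵇ settled (rotations (closeWord v))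

subset-count : ∀ {n} (L : List (Fin n)) (S : Subset n) → Unique L → (∀ {x} → x ∈ L → x ∈ₛ S) → length L ≤ ∣ S ∣
subset-count []      S _           _  = z≤n
subset-count (x ∷ L) S (x∉ ∷ uniq) ∈S = ℕₚ.≤-trans (s≤s (subset-count L (S -ₛ x) uniq
    (λ y∈ → Subsetₚ.x∈p∧x≢y⇒x∈p-y (∈S (there y∈)) (≢-sym (All.lookup x∉ y∈))))) (Subsetₚ.x∈p⇒∣p-x∣<∣p∣ (∈S (here refl)))

-- Darts, and sets of edges as chains modulo 2.

module Darts {n : ℕ} (C : CubicMap n) where
  open CubicMap C

  V : Set
  V = Fin n

  _≟ᵥ_ : DecidableEquality V
  _≟ᵥ_ = Finₚ._≟_

  _≟ₐ_ : DecidableEquality Dart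
  _≟ₐ_ = ×ₚ.≡-dec Finₚ._≟_ Finₚ._≟_

  src tgt : Dart → V
  src = proj₁
  tgt (v , i) = nb v i

  -- Reversal of a dart and rotation about its source. Since `φ` is `ν ∘ α` by computation, facts
  -- about faces reduce to these two.
  α ν : Dart → Dart
  α (v , i) = (nb v i , rev v i)
  ν (v , i) = (v , next3 i)

  tgt-α : ∀ d → tgt (α d) ≡ src d
  tgt-α (v , i) = nb-rev v i

  dart-≡ : ∀ {d e : Dart} → src d ≡ src e → tgt d ≡ tgt e → d ≡ e
  dart-≡ {v , i} {.v , j} refl eq = cong (v ,_) (simple v i j eq)

  α-involutive : ∀ d → α (α d) ≡ d
  α-involutive d = dart-≡ (tgt-α d) (tgt-α (α d))

  α-injective : ∀ {d e} → α d ≡ α e → d ≡ e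
  α-injective {d} {e} eq = trans (sym (α-involutive d)) (trans (cong α eq) (α-involutive e))

  ν³ : ∀ d → ν (ν (ν d)) ≡ d
  ν³ (v , i) = cong (v ,_) (next3³ i)

  ν-≢ : ∀ d → ν d ≢ d
  ν-≢ (v , i) eq = next3-≢ i (cong proj₂ eq)

  ν²-≢ : ∀ d → ν (ν d) ≢ d
  ν²-≢ (v , i) eq = next3²-≢ i (cong proj₂ eq)

  ν-injective : ∀ {d e} → ν d ≡ ν e → d ≡ e
  ν-injective {d} {e} eq = trans (sym (ν³ d)) (trans (cong (ν ∘ ν) eq) (ν³ e))

  φ-injective : ∀ {d e} → φ d ≡ φ e → d ≡ e
  φ-injective = α-injective ∘ ν-injective

  φ^-+ : ∀ k l d → φ^ (k + l) d ≡ φ^ k (φ^ l d)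
  φ^-+ zero    l d = refl
  φ^-+ (suc k) l d = cong φ (φ^-+ k l d)

  φ^-injective : ∀ k {d e} → φ^ k d ≡ φ^ k e → d ≡ e
  φ^-injective zero    eq = eq
  φ^-injective (suc k) eq = φ^-injective k (φ-injective eq)

  adj-sym : ∀ {u v} → Adj u v → Adj v u
  adj-sym {u} (i , refl) = rev u i , nb-rev u i

  adj-irrefl : ∀ {u v} → Adj u v → u ≢ v
  adj-irrefl {u} (i , refl) eq = loopless u i (sym eq)

  adj? : ∀ u v → Dec (Adj u v)
  adj? u v = Finₚ.any? (λ i → nb u i ≟ᵥ v)

  adj-tgt : ∀ d → Adj (src d) (tgt d)
  adj-tgt (v , i) = i , refl

  three-darts : ∀ d e → src e ≡ src d → (e ≡ d) ⊎ (e ≡ ν d) ⊎ (e ≡ ν (ν d))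
  three-darts (v , fz) (.v , fz) refl = inj₁ refl
  three-darts (v , fz) (.v , fs fz) refl = inj₂ (inj₁ refl)
  three-darts (v , fz) (.v , fs (fs fz)) refl = inj₂ (inj₂ refl)
  three-darts (v , fs fz) (.v , fz) refl = inj₂ (inj₂ refl)
  three-darts (v , fs fz) (.v , fs fz) refl = inj₁ refl
  three-darts (v , fs fz) (.v , fs (fs fz)) refl = inj₂ (inj₁ refl)
  three-darts (v , fs (fs fz)) (.v , fz) refl = inj₂ (inj₁ refl)
  three-darts (v , fs (fs fz)) (.v , fs fz) refl = inj₂ (inj₂ refl)
  three-darts (v , fs (fs fz)) (.v , fs (fs fz)) refl = inj₁ refl

  -- A set of darts with symmetric difference as addition; the `Symmetric` ones are sets of edges,
  -- and `∂` is the degree modulo 2 at a vertex.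
  Chain : Set
  Chain = Dart → Bool

  Symmetric : Chain → Set
  Symmetric c = ∀ d → c (α d) ≡ c d

  ∂ : Chain → V → Bool
  ∂ c v = c (v , fz) xor (c (v , fs fz) xor c (v , fs (fs fz)))

  _⊞_ : Chain → Chain → Chain
  (c ⊞ c′) d = c d xor c′ d

  ∂-⊞ : ∀ c c′ v → ∂ (c ⊞ c′) v ≡ ∂ c v xor ∂ c′ v
  ∂-⊞ c c′ v =
    trans (cong ((c (v , fz) xor c′ (v , fz)) xor_) (xor-interchange (c (v , fs fz)) _ _ _))
          (xor-interchange (c (v , fz)) _ _ _)

  ∂-cong : ∀ {c c′} → (∀ d → c d ≡ c′ d) → ∀ v → ∂ c v ≡ ∂ c′ v
  ∂-cong eq v = cong₂ _xor_ (eq _) (cong₂ _xor_ (eq _) (eq _))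

  δ : Dart → Chain
  δ x d = ⌊ x ≟ₐ d ⌋

  ∂-δ : ∀ x v → ∂ (δ x) v ≡ ⌊ src x ≟ᵥ v ⌋
  ∂-δ (u , i) v = go (u ≟ᵥ v)
    where
    one : ∀ i → ⌊ i Finₚ.≟ fz ⌋ xor (⌊ i Finₚ.≟ fs fz ⌋ xor ⌊ i Finₚ.≟ fs (fs fz) ⌋) ≡ true
    one fz = refl
    one (fs fz) = refl
    one (fs (fs fz)) = refl
    go : (u≟v : Dec (u ≡ v)) → ∂ (δ (u , i)) v ≡ ⌊ u≟v ⌋
    go (no u≢v) = cong₂ _xor_ (off fz) (cong₂ _xor_ (off (fs fz)) (off (fs (fs fz))))
      where
      off : ∀ j → δ (u , i) (v , j) ≡ false
      off j = ⌊no⌋ ((u , i) ≟ₐ (v , j)) (u≢v ∘ cong proj₁)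
    go (yes refl) = trans (cong₂ _xor_ (on fz) (cong₂ _xor_ (on (fs fz)) (on (fs (fs fz))))) (one i)
      where
      on : ∀ j → δ (u , i) (u , j) ≡ ⌊ i Finₚ.≟ j ⌋
      on j = ⌊⌋-cong ((u , i) ≟ₐ (u , j)) (i Finₚ.≟ j) (cong proj₂) (cong (u ,_))

  edge : Dart → Chain
  edge x = δ x ⊞ δ (α x)

  ∂-edge : ∀ x v → ∂ (edge x) v ≡ ⌊ src x ≟ᵥ v ⌋ xor ⌊ tgt x ≟ᵥ v ⌋
  ∂-edge x v = trans (∂-⊞ (δ x) (δ (α x)) v) (cong₂ _xor_ (∂-δ x v) (∂-δ (α x) v))

  edge-sym : ∀ x → Symmetric (edge x)
  edge-sym x d =
    trans (cong₂ _xor_ (⌊⌋-cong (x ≟ₐ α d) (α x ≟ₐ d) (λ e → trans (cong α e) (α-involutive d))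
                                                      (λ e → trans (sym (α-involutive x)) (cong α e)))
                       (⌊⌋-cong (α x ≟ₐ α d) (x ≟ₐ d) α-injective (cong α)))
          (Boolₚ.xor-comm (δ (α x) d) (δ x d))

  edge-self : ∀ x → edge x x ≡ true
  edge-self x = cong₂ _xor_ (⌊yes⌋ (x ≟ₐ x) refl)
                            (⌊no⌋ (α x ≟ₐ x) (λ e → loopless (src x) (proj₂ x) (cong proj₁ e)))

  edge-off : ∀ x d → x ≢ d → α x ≢ d → edge x d ≡ false
  edge-off x d p q = cong₂ _xor_ (⌊no⌋ (x ≟ₐ d) p) (⌊no⌋ (α x ≟ₐ d) q)

  edge-on : ∀ x d → edge x d ≡ true → x ≡ d ⊎ α x ≡ d
  edge-on x d h with x ≟ₐ d | α x ≟ₐ d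
  ... | yes p | _     = inj₁ p
  ... | no _  | yes q = inj₂ q

  sym-⊞ : ∀ {c c′} → Symmetric c → Symmetric c′ → Symmetric (c ⊞ c′)
  sym-⊞ p q d = cong₂ _xor_ (p d) (q d)

  chain : ∀ {P u v} → Reach P u v → Chain
  chain here d = false
  chain (step {u} (i , _) _ r) = edge (u , i) ⊞ chain r

  chain-sym : ∀ {P u v} (r : Reach P u v) → Symmetric (chain r)
  chain-sym here d = refl
  chain-sym (step {u} (i , _) _ r) = sym-⊞ (edge-sym (u , i)) (chain-sym r)

  ∂-chain : ∀ {P u v} (r : Reach P u v) w → ∂ (chain r) w ≡ ⌊ u ≟ᵥ w ⌋ xor ⌊ v ≟ᵥ w ⌋
  ∂-chain {u = u} here w = sym (Boolₚ.xor-same ⌊ u ≟ᵥ w ⌋)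
  ∂-chain {v = v} (step {u} (i , refl) _ r) w = begin
    ∂ (edge (u , i) ⊞ chain r) w          ≡⟨ ∂-⊞ (edge (u , i)) (chain r) w ⟩
    ∂ (edge (u , i)) w xor ∂ (chain r) w  ≡⟨ cong₂ _xor_ (∂-edge (u , i) w) (∂-chain r w) ⟩
    (a xor b) xor (b xor c)               ≡⟨ Boolₚ.xor-assoc a b (b xor c) ⟩
    a xor (b xor (b xor c))               ≡⟨ cong (a xor_) (trans (sym (Boolₚ.xor-assoc b b c)) (cong (_xor c) (Boolₚ.xor-same b))) ⟩
    a xor c                               ∎
    where
    open ≡-Reasoning
    a b c : Bool
    a = ⌊ u ≟ᵥ w ⌋
    b = ⌊ nb u i ≟ᵥ w ⌋
    c = ⌊ v ≟ᵥ w ⌋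

  chain-support : ∀ {P : V → Set} {u v} (r : Reach P u v) → P u → ∀ d → chain r d ≡ true → P (src d) × P (tgt d)
  chain-support (step {u} (i , refl) Pw r) Pu d on with edge (u , i) d in eq
  ... | false = chain-support r Pw d on
  ... | true with edge-on (u , i) d eq
  ...   | inj₁ refl = Pu , Pw
  chain-support {P} (step {u} (i , refl) Pw r) Pu d on | true | inj₂ refl = Pw , subst P (sym (nb-rev u i)) Pu

  reach-trans : ∀ {P u v w} → Reach P u v → Reach P v w → Reach P u w
  reach-trans here         s = s
  reach-trans (step a p r) s = step a p (reach-trans r s)

  reach-map : ∀ {P Q : V → Set} → (∀ {x} → P x → Q x) → ∀ {u v} → Reach P u v → Reach Q u v
  reach-map f here         = here
  reach-map f (step a p r) = step a (f p) (reach-map f r)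

  reach-sym : ∀ {P : V → Set} {u v} → P u → Reach P u v → Reach P v u
  reach-sym Pu here         = here
  reach-sym Pu (step a p r) = reach-trans (reach-sym p r) (step (adj-sym a) Pu here)

module Maps {n : ℕ} (F : Fullerene n) where
  open Fullerene F
  open Darts cmap

  -- Faces, their representatives, and the bound of 20 vertices.

  module Faces where

    face-length : ∀ d → ∃[ f ] 5 ≤ f × f ≤ 6 × φ^ f d ≡ d × (∀ m → 0 < m → m < f → φ^ m d ≢ d)
    face-length d with faces56 d
    ... | inj₁ (_ , closed , least) = 5 , ℕₚ.≤-refl , ℕₚ.n≤1+n 5 , closed , least
    ... | inj₂ (_ , closed , least) = 6 , ℕₚ.n≤1+n 5 , ℕₚ.≤-refl , closed , least

    -- Faces have at most 6 darts, so exponents up to 5 exhaust an orbit. Hence the five iterates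
    -- examined by `isFaceRep` decide minimality on the whole face.
    orbit-reduce : ∀ d k → ∃[ k′ ] k′ ≤ 5 × φ^ k d ≡ φ^ k′ d
    orbit-reduce d zero = 0 , z≤n , refl
    orbit-reduce d (suc k) with orbit-reduce d k | face-length d
    ... | k′ , k′≤5 , eq | f , 5≤f , f≤6 , closed , _ with suc k′ ℕₚ.≟ f
    ...   | yes refl = 0 , z≤n , trans (cong φ eq) closed
    ...   | no k′≢f with suc k′ ≤? 5
    ...     | yes k′<5 = suc k′ , k′<5 , cong φ eq
    ...     | no k′≮5 = f′ , f′≤5 , trans (cong φ eq) (trans (cong (λ j → φ^ j d) split) (trans (φ^-+ f′ f d) (cong (φ^ f′) closed)))
      where
      f≤1+k′ : f ≤ suc k′
      f≤1+k′ = ℕₚ.≤-trans f≤6 (ℕₚ.≰⇒> k′≮5)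
      f′ : ℕ
      f′ = suc k′ ∸ f
      split : suc k′ ≡ f′ + f
      split = sym (ℕₚ.m∸n+n≡m f≤1+k′)
      f′≤5 : f′ ≤ 5
      f′≤5 = ℕₚ.≤-trans (ℕₚ.∸-monoʳ-≤ (suc k′) 5≤f) (ℕₚ.≤-trans (ℕₚ.∸-monoˡ-≤ 5 (s≤s k′≤5)) (s≤s z≤n))

    dartIdx-injective : ∀ {d e} → dartIdx d ≡ dartIdx e → d ≡ e
    dartIdx-injective {v , i} {w , j} eq
      with Finₚ.combine-injective v i w j (Finₚ.toℕ-injective (trans (Finₚ.toℕ-combine v i) (trans eq (sym (Finₚ.toℕ-combine w j)))))
    ... | refl , refl = refl

    Least : Dart → Dart → Set
    Least d r = ∀ k → dartIdx r ≤ dartIdx (φ^ k d)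

    opaque
      least-upto : ∀ d N → ∃[ j ] (∀ k → k ≤ N → dartIdx (φ^ j d) ≤ dartIdx (φ^ k d))
      least-upto d zero = 0 , λ { zero z≤n → ℕₚ.≤-refl }
      least-upto d (suc N) with least-upto d N
      ... | j , min with ℕₚ.≤-total (dartIdx (φ^ j d)) (dartIdx (φ^ (suc N) d))
      ...   | inj₁ le = j , λ k k≤ → [ (λ lt → min k (ℕₚ.≤-pred lt)) , (λ { refl → le }) ]′ (ℕₚ.m≤n⇒m<n∨m≡n k≤)
      ...   | inj₂ ge = suc N , λ k k≤ → [ (λ lt → ℕₚ.≤-trans ge (min k (ℕₚ.≤-pred lt))) , (λ { refl → ℕₚ.≤-refl }) ]′ (ℕₚ.m≤n⇒m<n∨m≡n k≤)

      least-orbit : ∀ d → ∃[ j ] Least d (φ^ j d)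
      least-orbit d = all-steps (least-upto d 5)
        where
        all-steps : ∃[ j ] (∀ k → k ≤ 5 → dartIdx (φ^ j d) ≤ dartIdx (φ^ k d)) → ∃[ j ] Least d (φ^ j d)
        all-steps (j , min) = j , λ k → case orbit-reduce d k of λ
          { (k′ , k′≤5 , eq) → subst (λ x → dartIdx (φ^ j d) ≤ dartIdx x) (sym eq) (min k′ k′≤5) }

    rep-steps : Dart → ℕ
    rep-steps d = proj₁ (least-orbit d)

    rep : Dart → Dart
    rep d = φ^ (rep-steps d) d

    rep-least : ∀ d → Least d (rep d)
    rep-least d = proj₂ (least-orbit d)

    rep-unique : ∀ {d e} k l → φ^ k d ≡ e → φ^ l e ≡ d → rep d ≡ rep e
    rep-unique {d} {e} k l refl back = dartIdx-injective (ℕₚ.≤-antisym (le d e k refl) (le e d l back))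
      where
      le : ∀ x y k → φ^ k x ≡ y → dartIdx (rep x) ≤ dartIdx (rep y)
      le x y k refl = subst (λ z → dartIdx (rep x) ≤ dartIdx z) (φ^-+ (rep-steps y) k x) (rep-least x (rep-steps y + k))

    φ⁻¹ : ∀ d → ∃[ l ] φ^ l (φ d) ≡ d
    φ⁻¹ d with face-length d
    ... | suc f , _ , _ , closed , _ = f , trans (sym (trans (cong (λ k → φ^ k d) (ℕₚ.+-comm 1 f)) (φ^-+ f 1 d))) closed

    rep-φ : ∀ d → rep (φ d) ≡ rep d
    rep-φ d = sym (rep-unique 1 (proj₁ (φ⁻¹ d)) refl (proj₂ (φ⁻¹ d)))

    rep-φ^ : ∀ k d → rep (φ^ k d) ≡ rep d
    rep-φ^ zero    d = refl
    rep-φ^ (suc k) d = trans (rep-φ (φ^ k d)) (rep-φ^ k d)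

    isRep : ∀ d → Least d d → isFaceRep d ≡ true
    isRep d least = cong₂ _∧_ (le 5) (cong₂ _∧_ (le 4) (cong₂ _∧_ (le 3) (cong₂ _∧_ (le 2) (cong₂ _∧_ (le 1) refl))))
      where
      T⇒≡ : ∀ {b} → T b → b ≡ true
      T⇒≡ {true} _ = refl
      le : ∀ k → (dartIdx d ≤ᵇ dartIdx (φ^ k d)) ≡ true
      le k = T⇒≡ (ℕₚ.≤⇒≤ᵇ (least k))

    isRep⇒least : ∀ d → isFaceRep d ≡ true → Least d d
    isRep⇒least d h k with orbit-reduce d k
    ... | k′ , k′≤5 , eq = subst (λ x → dartIdx d ≤ dartIdx x) (sym eq) (small k′ k′≤5)
      where
      ∧-split : ∀ {a b} → a ∧ b ≡ true → T a × b ≡ true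
      ∧-split {true} {true} _ = tt , refl
      s5 = ∧-split h
      s4 = ∧-split (proj₂ s5)
      s3 = ∧-split (proj₂ s4)
      s2 = ∧-split (proj₂ s3)
      s1 = ∧-split (proj₂ s2)
      small : ∀ j → j ≤ 5 → dartIdx d ≤ dartIdx (φ^ j d)
      small 0 _ = ℕₚ.≤-refl
      small 1 _ = ℕₚ.≤ᵇ⇒≤ _ _ (proj₁ s1)
      small 2 _ = ℕₚ.≤ᵇ⇒≤ _ _ (proj₁ s2)
      small 3 _ = ℕₚ.≤ᵇ⇒≤ _ _ (proj₁ s3)
      small 4 _ = ℕₚ.≤ᵇ⇒≤ _ _ (proj₁ s4)
      small 5 _ = ℕₚ.≤ᵇ⇒≤ _ _ (proj₁ s5)
      small (suc (suc (suc (suc (suc (suc _)))))) (s≤s (s≤s (s≤s (s≤s (s≤s ())))))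

    rep-fixes : ∀ {r} → isFaceRep r ≡ true → rep r ≡ r
    rep-fixes {r} h = dartIdx-injective (ℕₚ.≤-antisym (rep-least r 0) (isRep⇒least r h (rep-steps r)))

    rep-isRep : ∀ d → isFaceRep (rep d) ≡ true
    rep-isRep d = isRep (rep d) (λ k → subst (λ x → dartIdx (rep d) ≤ dartIdx x) (φ^-+ k (rep-steps d) d) (rep-least d (k + rep-steps d)))

    Rep? : ∀ d → Dec (isFaceRep d ≡ true)
    Rep? d = isFaceRep d Boolₚ.≟ true

    reps : List Dart
    reps = filter Rep? allDarts

    allDarts-product : allDarts ≡ List.cartesianProduct (allFin n) (allFin 3)
    allDarts-product = go (allFin n)
      where
      go : ∀ vs → concatMap (λ v → map (λ i → (v , i)) (allFin 3)) vs ≡ List.cartesianProduct vs (allFin 3)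
      go []       = refl
      go (v ∷ vs) = cong (map (v ,_) (allFin 3) ++_) (go vs)

    reps-unique : Unique reps
    reps-unique = Uniqueₚ.filter⁺ Rep? (subst Unique (sym allDarts-product)
                    (Uniqueₚ.cartesianProduct⁺ (Uniqueₚ.allFin⁺ n) (Uniqueₚ.allFin⁺ 3)))

    opaque
     rep∈reps : ∀ d → rep d ∈ reps
     rep∈reps d = ∈ₚ.∈-filter⁺ Rep? (subst (rep d ∈_) (sym allDarts-product)
                   (∈ₚ.∈-cartesianProduct⁺ (∈ₚ.∈-allFin (src (rep d))) (∈ₚ.∈-allFin (proj₂ (rep d))))) (rep-isRep d)

    length-reps : length reps ≡ numFaces
    length-reps = go allDarts
      where
      go : ∀ ds → length (filter Rep? ds) ≡ sum (map (λ d → if isFaceRep d then 1 else 0) ds)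
      go [] = refl
      go (d ∷ ds) with isFaceRep d
      ... | true  = cong suc (go ds)
      ... | false = go ds

    #F : ℕ
    #F = length reps

    euler : 2 * n + 2 * #F ≡ 4 + 3 * n
    euler = trans (cong (λ f → 2 * n + 2 * f) length-reps) planar

    nthRep : Fin #F → Dart
    nthRep = List.lookup reps

    opaque
      faceIdx : Dart → Fin #F
      faceIdx d = Any.index (rep∈reps d)

      nthRep-faceIdx : ∀ d → nthRep (faceIdx d) ≡ rep d
      nthRep-faceIdx d = sym (Anyₚ.lookup-index (rep∈reps d))

    nthRep-isRep : ∀ i → isFaceRep (nthRep i) ≡ true
    nthRep-isRep i = proj₂ (∈ₚ.∈-filter⁻ Rep? {xs = allDarts} (∈ₚ.∈-lookup {xs = reps} i))

    faceIdx-nthRep : ∀ i → faceIdx (nthRep i) ≡ i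
    faceIdx-nthRep i = lookup-unique reps-unique {faceIdx (nthRep i)} {i} (trans (nthRep-faceIdx (nthRep i)) (rep-fixes (nthRep-isRep i)))

    faceIdx-φ : ∀ d → faceIdx (φ d) ≡ faceIdx d
    faceIdx-φ d = lookup-unique reps-unique {faceIdx (φ d)} {faceIdx d} (trans (nthRep-faceIdx (φ d)) (trans (rep-φ d) (sym (nthRep-faceIdx d))))

    -- Each face contributes the first five darts from its representative. They differ within a face
    -- because its size is at least 5, and across faces because the representative can be recovered
    -- from a dart.
    5F≤3n : #F * 5 ≤ n * 3
    5F≤3n = Finₚ.injective⇒≤ {f = g} g-inj
      where
      at : Fin #F × Fin 5 → Dart
      at (i , k) = φ^ (toℕ k) (nthRep i)
      no-return : ∀ i (k l : Fin 5) → toℕ k < toℕ l → φ^ (toℕ k) (nthRep i) ≢ φ^ (toℕ l) (nthRep i)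
      no-return i k l k<l eq with face-length (nthRep i)
      ... | f , 5≤f , _ , _ , least =
        least (toℕ l ∸ toℕ k) (ℕₚ.m<n⇒0<n∸m k<l)
              (ℕₚ.≤-trans (s≤s (ℕₚ.m∸n≤m (toℕ l) (toℕ k))) (ℕₚ.≤-trans (Finₚ.toℕ<n l) 5≤f))
              (φ^-injective (toℕ k) (trans (sym (φ^-+ (toℕ k) (toℕ l ∸ toℕ k) (nthRep i)))
                (trans (cong (λ j → φ^ j (nthRep i)) (ℕₚ.m+[n∸m]≡n (ℕₚ.<⇒≤ k<l))) (sym eq))))
      at-inj : ∀ x y → at x ≡ at y → x ≡ y
      at-inj (i , k) (j , l) eq with lookup-unique reps-unique {i} {j} nth-eq
        where
        nth-eq : nthRep i ≡ nthRep j
        nth-eq = trans (sym (rep-fixes (nthRep-isRep i))) (trans (sym (rep-φ^ (toℕ k) (nthRep i)))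
                   (trans (cong rep eq) (trans (rep-φ^ (toℕ l) (nthRep j)) (rep-fixes (nthRep-isRep j)))))
      ... | refl with ℕₚ.<-cmp (toℕ k) (toℕ l)
      ...   | tri< k<l _ _ = contradiction eq (no-return i k l k<l)
      ...   | tri≈ _ k≡l _ = cong (i ,_) (Finₚ.toℕ-injective k≡l)
      ...   | tri> _ _ l<k = contradiction (sym eq) (no-return i l k l<k)
      g : Fin (#F * 5) → Fin (n * 3)
      g x = uncurry Fin.combine (at (Fin.remQuot 5 x))
      g-inj : Injective _≡_ _≡_ g
      g-inj {x} {y} eq = trans (sym (Finₚ.combine-remQuot {#F} 5 x)) (trans (cong (uncurry Fin.combine)
          (at-inj (Fin.remQuot 5 x) (Fin.remQuot 5 y) (×ₚ.×-≡,≡→≡ (Finₚ.combine-injective _ _ _ _ eq))))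
          (Finₚ.combine-remQuot {#F} 5 y))

    -- Euler's formula gives 10 F = 20 + 5 n for the number F of faces, while 5 F ≤ 3 n bounds this
    -- by 6 n.
    20≤n : 20 ≤ n
    20≤n = ℕₚ.+-cancelˡ-≤ (5 * n) 20 n (begin
      5 * n + 20        ≡⟨ ℕₚ.+-comm (5 * n) 20 ⟩
      20 + 5 * n        ≡⟨ ℕₚ.+-cancelˡ-≡ (10 * n) _ _ e ⟩
      2 * (#F * 5)      ≤⟨ ℕₚ.*-monoʳ-≤ 2 5F≤3n ⟩
      2 * (n * 3)       ≡⟨ r3 n ⟩
      5 * n + n         ∎)
      where
      open ℕₚ.≤-Reasoning
      r3 : ∀ m → 2 * (m * 3) ≡ 5 * m + m
      r3 = solve-∀
      e : 10 * n + (20 + 5 * n) ≡ 10 * n + 2 * (#F * 5)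
      e = trans (r1 n) (trans (cong (5 *_) (sym euler)) (r2 n #F))
        where
        r1 : ∀ m → 10 * m + (20 + 5 * m) ≡ 5 * (4 + 3 * m)
        r1 = solve-∀
        r2 : ∀ m f → 5 * (2 * m + 2 * f) ≡ 10 * m + 2 * (f * 5)
        r2 = solve-∀

  -- Vanishing of the first homology modulo 2, by counting.

  module Colouring where

    open Faces

    3<n : 3 < n
    3<n = proj₁ threeConn

    opaque
      v₀ : V
      v₀ = Fin.fromℕ< {0} (ℕₚ.≤-trans (s≤s z≤n) 3<n)

    d₀ : Dart
    d₀ = v₀ , fz

    opaque
      connected : ∀ u v → Reach (λ _ → ⊤) u v
      connected u v with fresh (u ∷ v ∷ []) (ℕₚ.≤-trans (ℕₚ.n≤1+n 3) 3<n)
      ... | a , a∉ = reach-map (λ _ → tt) (proj₂ threeConn a a u v (a≢u ∘ sym) (a≢u ∘ sym) (a≢v ∘ sym) (a≢v ∘ sym))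
        where
        a≢u : a ≢ u
        a≢u eq = a∉ (here eq)
        a≢v : a ≢ v
        a≢v eq = a∉ (there (here eq))

    spoke : V → Chain
    spoke u = chain (connected u v₀)

    -- A superposition of walks to `v₀`, which has boundary `w` away from `v₀`. These chains
    -- supplement the coboundaries of face colourings to all edge sets.
    spokes : (V → Bool) → Chain
    spokes w d = ⨁ (λ u → w u ∧ spoke u d)

    ∂-⨁ : ∀ {m} (c : Fin m → Chain) v → ∂ (λ d → ⨁ (λ u → c u d)) v ≡ ⨁ (λ u → ∂ (c u) v)
    ∂-⨁ c v = sym (trans (⨁-xor (λ u → c u (v , fz)) _)
                         (cong (⨁ (λ u → c u (v , fz)) xor_) (⨁-xor (λ u → c u (v , fs fz)) _)))

    ∂-∧ : ∀ b c v → ∂ (λ d → b ∧ c d) v ≡ b ∧ ∂ c v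
    ∂-∧ true  c v = refl
    ∂-∧ false c v = refl

    ∂-spokes : ∀ w v → v ≢ v₀ → ∂ (spokes w) v ≡ w v
    ∂-spokes w v v≢v₀ = begin
      ∂ (spokes w) v                       ≡⟨ ∂-⨁ (λ u d → w u ∧ spoke u d) v ⟩
      ⨁ (λ u → ∂ (λ d → w u ∧ spoke u d) v) ≡⟨ ⨁-cong (λ u → trans (∂-∧ (w u) (spoke u) v) (cong (w u ∧_) (end u))) ⟩
      ⨁ (λ u → w u ∧ ⌊ u ≟ᵥ v ⌋)            ≡⟨ ⨁-pick w v ⟩
      w v                                  ∎
      where
      open ≡-Reasoning
      end : ∀ u → ∂ (spoke u) v ≡ ⌊ u ≟ᵥ v ⌋
      end u = trans (∂-chain (connected u v₀) v)
                (trans (cong (⌊ u ≟ᵥ v ⌋ xor_) (⌊no⌋ (v₀ ≟ᵥ v) (v≢v₀ ∘ sym))) (Boolₚ.xor-identityʳ _))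

    spokes-sym : ∀ w → Symmetric (spokes w)
    spokes-sym w d = ⨁-cong (λ u → cong (w u ∧_) (chain-sym (connected u v₀) d))

    coboundary : (Dart → Bool) → Chain
    coboundary χ d = χ d xor χ (α d)

    FaceColouring : (Dart → Bool) → Set
    FaceColouring χ = ∀ d → χ (φ d) ≡ χ d

    χ-ν : ∀ {χ} → FaceColouring χ → ∀ d → χ (α d) ≡ χ (ν d)
    χ-ν {χ} inv d = trans (sym (inv (α d))) (cong (χ ∘ ν) (α-involutive d))

    coboundary-sym : ∀ χ → Symmetric (coboundary χ)
    coboundary-sym χ d = trans (cong (χ (α d) xor_) (cong χ (α-involutive d))) (Boolₚ.xor-comm (χ (α d)) (χ d))

    ∂-coboundary : ∀ {χ} → FaceColouring χ → ∀ v → ∂ (coboundary χ) v ≡ false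
    ∂-coboundary {χ} inv v = trans (∂-cong (λ d → cong (χ d xor_) (χ-ν inv d)) v) (cyc (χ (v , fz)) _ _)
      where
      cyc : ∀ a b c → (a xor b) xor ((b xor c) xor (c xor a)) ≡ false
      cyc false false false = refl
      cyc false false true  = refl
      cyc false true  false = refl
      cyc false true  true  = refl
      cyc true  false false = refl
      cyc true  false true  = refl
      cyc true  true  false = refl
      cyc true  true  true  = refl

    -- The map whose surjectivity is wanted: the colouring supplies a cycle, the weights supply the
    -- boundary. Only the colour at `d₀` and the weight at `v₀` have to be recorded separately to
    -- make it injective.
    combination : (Fin #F → Bool) → (V → Bool) → Chain
    combination χ w = coboundary (χ ∘ faceIdx) ⊞ spokes w

    faceIdx-colouring : ∀ (χ : Fin #F → Bool) → FaceColouring (χ ∘ faceIdx)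
    faceIdx-colouring χ d = cong χ (faceIdx-φ d)

    combination-sym : ∀ χ w → Symmetric (combination χ w)
    combination-sym χ w = sym-⊞ (coboundary-sym (χ ∘ faceIdx)) (spokes-sym w)

    ∂-combination : ∀ χ w v → v ≢ v₀ → ∂ (combination χ w) v ≡ w v
    ∂-combination χ w v v≢v₀ = trans (∂-⊞ (coboundary (χ ∘ faceIdx)) (spokes w) v)
      (cong₂ _xor_ (∂-coboundary {χ ∘ faceIdx} (faceIdx-colouring χ) v) (∂-spokes w v v≢v₀))

    module _ {χ χ′ : Dart → Bool} (inv : FaceColouring χ) (inv′ : FaceColouring χ′)
             (eq : ∀ d → coboundary χ d ≡ coboundary χ′ d) where

      private
        Δ : Dart → Bool
        Δ d = χ d xor χ′ d

        Δ-α : ∀ d → Δ (α d) ≡ Δ d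
        Δ-α d = sym (xor-0⇒≡ (trans (xor-interchange (χ d) (χ′ d) _ _) (trans (cong (_xor coboundary χ′ d) (eq d)) (Boolₚ.xor-same (coboundary χ′ d)))))

        Δ-ν : ∀ d → Δ (ν d) ≡ Δ d
        Δ-ν d = trans (cong₂ _xor_ (sym (χ-ν {χ} inv d)) (sym (χ-ν {χ′} inv′ d))) (Δ-α d)

        Δ-src : ∀ v i → Δ (v , i) ≡ Δ (v , fz)
        Δ-src v fz           = refl
        Δ-src v (fs fz)      = Δ-ν (v , fz)
        Δ-src v (fs (fs fz)) = trans (Δ-ν (v , fs fz)) (Δ-ν (v , fz))

        Δ-const : ∀ {P u v} → Reach P u v → Δ (u , fz) ≡ Δ (v , fz)
        Δ-const here = refl
        Δ-const (step {u} (i , refl) _ r) =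
          trans (sym (Δ-src u i)) (trans (sym (Δ-α (u , i))) (trans (Δ-src (nb u i) (rev u i)) (Δ-const r)))

      -- The sum of the two colourings is invariant under `α` and `ν`, hence constant by
      -- connectedness, and it vanishes at `d₀`.
      coboundary-injective : χ d₀ ≡ χ′ d₀ → ∀ d → χ d ≡ χ′ d
      coboundary-injective agree d = xor-0⇒≡ (trans (Δ-src (src d) (proj₂ d)) (trans (Δ-const (connected (src d) v₀))
                                       (trans (cong (_xor χ′ d₀) agree) (Boolₚ.xor-same (χ′ d₀)))))

    -- Half of a Boolean vector of length 2 (#F + n) is a pair of a face colouring and a weight on the spokes.
    -- The two halves are encoded together so that the chains live on all 3n darts: the first combination
    -- is recorded on the darts d that precede α d, the second one on the others.

    m : ℕ
    m = #F + n

    colourAt : Fin 2 → Vec Bool (2 * m) → Fin #F → Bool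
    colourAt s x i = Vec.lookup x (Fin.combine s (Fin.join #F n (inj₁ i)))

    weightAt : Fin 2 → Vec Bool (2 * m) → V → Bool
    weightAt s x u = Vec.lookup x (Fin.combine s (Fin.join #F n (inj₂ u)))

    comb : Fin 2 → Vec Bool (2 * m) → Chain
    comb s x = combination (colourAt s x) (weightAt s x)

    positive? : ∀ d → Dec (dartIdx d < dartIdx (α d))
    positive? d = dartIdx d <? dartIdx (α d)

    mixed : Chain → Chain → Chain
    mixed c c′ d = if ⌊ positive? d ⌋ then c d else c′ d

    α≢ : ∀ d → α d ≢ d
    α≢ (v , i) eq = loopless v i (cong proj₁ eq)

    negative-α : ∀ d → ¬ dartIdx d < dartIdx (α d) → dartIdx (α d) < dartIdx (α (α d))
    negative-α d ¬pos = subst (dartIdx (α d) <_) (cong dartIdx (sym (α-involutive d)))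
      (ℕₚ.≤∧≢⇒< (ℕₚ.≮⇒≥ ¬pos) (α≢ d ∘ dartIdx-injective))

    mixed-first : ∀ {c c′ e e′} → Symmetric c → Symmetric e → (∀ d → mixed c c′ d ≡ mixed e e′ d) → ∀ d → c d ≡ e d
    mixed-first {c} {c′} {e} {e′} sc se eq d with positive? d
    ... | yes pos = trans (sym (at c c′)) (trans (eq d) (at e e′))
      where
      at : ∀ c c′ → mixed c c′ d ≡ c d
      at c c′ = cong (if_then c d else c′ d) (⌊yes⌋ (positive? d) pos)
    ... | no ¬pos = trans (sym (sc d)) (trans (sym (at c c′)) (trans (eq (α d)) (trans (at e e′) (se d))))
      where
      at : ∀ c c′ → mixed c c′ (α d) ≡ c (α d)
      at c c′ = cong (if_then c (α d) else c′ (α d)) (⌊yes⌋ (positive? (α d)) (negative-α d ¬pos))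

    mixed-second : ∀ {c c′ e e′} → Symmetric c′ → Symmetric e′ → (∀ d → mixed c c′ d ≡ mixed e e′ d) → ∀ d → c′ d ≡ e′ d
    mixed-second {c} {c′} {e} {e′} sc se eq d with positive? d
    ... | no ¬pos = trans (sym (at c c′)) (trans (eq d) (at e e′))
      where
      at : ∀ c c′ → mixed c c′ d ≡ c′ d
      at c c′ = cong (if_then c d else c′ d) (⌊no⌋ (positive? d) ¬pos)
    ... | yes pos = trans (sym (sc d)) (trans (sym (at c c′)) (trans (eq (α d)) (trans (at e e′) (se d))))
      where
      at : ∀ c c′ → mixed c c′ (α d) ≡ c′ (α d)
      at c c′ = cong (if_then c (α d) else c′ (α d))
        (⌊no⌋ (positive? (α d)) (λ q → ℕₚ.<-asym pos (subst (dartIdx (α d) <_) (cong dartIdx (α-involutive d)) q)))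

    -- The four leading bits hold the colour at `d₀` and the weight at `v₀` for each of the two
    -- combinations.
    record-chain : Vec Bool 4 → Chain → Vec Bool (4 + n * 3)
    record-chain b c = b Vec.++ Vec.tabulate (λ i → c (Fin.remQuot 3 i))

    record-chain-injective : ∀ {b b′ c c′} → record-chain b c ≡ record-chain b′ c′ → b ≡ b′ × (∀ d → c d ≡ c′ d)
    record-chain-injective {b} {b′} {c} {c′} eq with Vecₚ.++-injective b b′ eq
    ... | b-eq , t-eq = b-eq , λ d → subst (λ e → c e ≡ c′ e) (Finₚ.remQuot-combine (proj₁ d) (proj₂ d))
      (trans (sym (Vecₚ.lookup∘tabulate (λ i → c (Fin.remQuot 3 i)) (Fin.combine (proj₁ d) (proj₂ d))))
        (trans (cong (λ t → Vec.lookup t (Fin.combine (proj₁ d) (proj₂ d))) t-eq)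
               (Vecₚ.lookup∘tabulate (λ i → c′ (Fin.remQuot 3 i)) (Fin.combine (proj₁ d) (proj₂ d)))))

    assemble : Vec Bool (2 * m) → Vec Bool (4 + n * 3)
    assemble x = record-chain (colourAt fz x (faceIdx d₀) ∷ weightAt fz x v₀ ∷ colourAt (fs fz) x (faceIdx d₀) ∷ weightAt (fs fz) x v₀ ∷ [])
                              (mixed (comb fz x) (comb (fs fz) x))

    -- The boundary of the chain recovers the weights off `v₀`. Cancelling the spokes leaves a
    -- coboundary, which determines the colouring once its value at `d₀` is known.
    half-injective : ∀ s x y → (∀ d → comb s x d ≡ comb s y d) → colourAt s x (faceIdx d₀) ≡ colourAt s y (faceIdx d₀) →
                     weightAt s x v₀ ≡ weightAt s y v₀ →
                     ∀ j → Vec.lookup x (Fin.combine s j) ≡ Vec.lookup y (Fin.combine s j)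
    half-injective s x y eq c₀ w₀ j = subst (λ j → Vec.lookup x (Fin.combine s j) ≡ Vec.lookup y (Fin.combine s j))
                                        (Finₚ.join-splitAt #F n j) (both (Fin.splitAt #F j))
      where
      weights : ∀ u → weightAt s x u ≡ weightAt s y u
      weights u with u ≟ᵥ v₀
      ... | yes refl = w₀
      ... | no u≢v₀  = trans (sym (∂-combination (colourAt s x) (weightAt s x) u u≢v₀))
                         (trans (∂-cong eq u) (∂-combination (colourAt s y) (weightAt s y) u u≢v₀))
      cobs : ∀ d → coboundary (colourAt s x ∘ faceIdx) d ≡ coboundary (colourAt s y ∘ faceIdx) d
      cobs d = begin
        cx                                                   ≡⟨ xor-cancel cx sx ⟨
        (cx xor sx) xor sx                                   ≡⟨ cong₂ _xor_ (eq d) (⨁-cong (λ u → cong (_∧ spoke u d) (weights u))) ⟩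
        (cy xor sy) xor sy                                   ≡⟨ xor-cancel cy sy ⟩
        cy                                                   ∎
        where
        open ≡-Reasoning
        cx cy sx sy : Bool
        cx = coboundary (colourAt s x ∘ faceIdx) d
        cy = coboundary (colourAt s y ∘ faceIdx) d
        sx = spokes (weightAt s x) d
        sy = spokes (weightAt s y) d
      colours : ∀ i → colourAt s x i ≡ colourAt s y i
      colours i = trans (cong (colourAt s x) (sym (faceIdx-nthRep i)))
        (trans (coboundary-injective {colourAt s x ∘ faceIdx} {colourAt s y ∘ faceIdx}
                  (faceIdx-colouring (colourAt s x)) (faceIdx-colouring (colourAt s y)) cobs c₀ (nthRep i))
               (cong (colourAt s y) (faceIdx-nthRep i)))
      both : ∀ j′ → Vec.lookup x (Fin.combine s (Fin.join #F n j′)) ≡ Vec.lookup y (Fin.combine s (Fin.join #F n j′))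
      both (inj₁ i) = colours i
      both (inj₂ u) = weights u

    lookup-ext : ∀ {k} {x y : Vec Bool k} → (∀ i → Vec.lookup x i ≡ Vec.lookup y i) → x ≡ y
    lookup-ext {x = x} {y} eq = trans (sym (Vecₚ.tabulate∘lookup x)) (trans (Vecₚ.tabulate-cong eq) (Vecₚ.tabulate∘lookup y))

    assemble-injective : Injective _≡_ _≡_ assemble
    assemble-injective {x} {y} eq = lookup-ext at
      where
      parts = record-chain-injective {c = mixed (comb fz x) (comb (fs fz) x)} {c′ = mixed (comb fz y) (comb (fs fz) y)} eq
      bits = proj₁ parts
      bit-at : ∀ i → _
      bit-at i = cong (λ v → Vec.lookup v i) bits
      sym-comb : ∀ s z → Symmetric (comb s z)
      sym-comb s z = combination-sym (colourAt s z) (weightAt s z)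
      half : ∀ s j → Vec.lookup x (Fin.combine s j) ≡ Vec.lookup y (Fin.combine s j)
      half fz = half-injective fz x y (mixed-first (sym-comb fz x) (sym-comb fz y) (proj₂ parts)) (bit-at fz) (bit-at (fs fz))
      half (fs fz) = half-injective (fs fz) x y (mixed-second (sym-comb (fs fz) x) (sym-comb (fs fz) y) (proj₂ parts))
                       (bit-at (fs (fs fz))) (bit-at (fs (fs (fs fz))))
      at : ∀ i → Vec.lookup x i ≡ Vec.lookup y i
      at i = case Finₚ.combine-surjective {2} {m} i of λ
        { (s , j , eq) → subst (λ i → Vec.lookup x i ≡ Vec.lookup y i) eq (half s j) }

    -- Euler's formula in the form of a dimension count. Taking everything twice allows the 3 n
    -- darts to be used in place of half that number of edges.
    counts : 2 * m ≡ 4 + n * 3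
    counts = trans (trans (ℕₚ.*-distribˡ-+ 2 #F n) (ℕₚ.+-comm (2 * #F) (2 * n))) (trans euler (cong (4 +_) (ℕₚ.*-comm 3 n)))

    -- The first homology of the sphere vanishes modulo 2.
    exactness : ∀ c → Symmetric c → (∀ v → ∂ c v ≡ false) →
                      ∃[ χ ] (∀ d → χ (φ d) ≡ χ d) × (∀ d → χ (α d) ≡ χ d xor c d)
    exactness c c-sym ∂c≡0
      with boolVec-surjective counts assemble assemble-injective (record-chain (false ∷ false ∷ false ∷ false ∷ []) (mixed c c))
    ... | x , eq = χ , faceIdx-colouring (colourAt fz x) , jump
      where
      χ : Dart → Bool
      χ = colourAt fz x ∘ faceIdx
      parts = record-chain-injective {c = mixed (comb fz x) (comb (fs fz) x)} {c′ = mixed c c} eq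
      comb≡c : ∀ d → comb fz x d ≡ c d
      comb≡c = mixed-first (combination-sym (colourAt fz x) (weightAt fz x)) c-sym (proj₂ parts)
      -- As `c` has no boundary, its preimage carries no weight, so `c` is the coboundary of `χ`
      -- alone.
      no-weight : ∀ u → weightAt fz x u ≡ false
      no-weight u with u ≟ᵥ v₀
      ... | yes refl = cong (λ v → Vec.lookup v (fs fz)) (proj₁ parts)
      ... | no u≢v₀ = trans (sym (∂-combination (colourAt fz x) (weightAt fz x) u u≢v₀)) (trans (∂-cong comb≡c u) (∂c≡0 u))
      cob : ∀ d → χ d xor χ (α d) ≡ c d
      cob d = trans (sym (Boolₚ.xor-identityʳ _))
        (trans (cong (coboundary χ d xor_) (sym (⨁-zero (λ u → cong (_∧ spoke u d) (no-weight u))))) (comb≡c d))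
      jump : ∀ d → χ (α d) ≡ χ d xor c d
      jump d = begin
        χ (α d)                     ≡⟨ xor-cancel (χ (α d)) (χ d) ⟨
        (χ (α d) xor χ d) xor χ d   ≡⟨ cong (_xor χ d) (trans (Boolₚ.xor-comm (χ (α d)) (χ d)) (cob d)) ⟩
        c d xor χ d                 ≡⟨ Boolₚ.xor-comm (c d) (χ d) ⟩
        χ d xor c d                 ∎
        where open ≡-Reasoning

    opaque
      cycle-colouring : (c : Chain) → Symmetric c → (∀ v → ∂ c v ≡ false) →
                        Σ (Dart → Bool) λ χ → ((d : Dart) → χ (φ d) ≡ χ d) × ((d : Dart) → χ (α d) ≡ χ d xor c d)
      cycle-colouring = exactness

  -- Edge cuts, and their size by 3-connectivity.

  module Cuts where

    a : V → V → ℕ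
    a u v = if ⌊ adj? u v ⌋ then 1 else 0

    a-adj : ∀ {u v} → Adj u v → a u v ≡ 1
    a-adj {u} {v} p = cong (if_then 1 else 0) (⌊yes⌋ (adj? u v) p)

    a-nonadj : ∀ {u v} → ¬ Adj u v → a u v ≡ 0
    a-nonadj {u} {v} p = cong (if_then 1 else 0) (⌊no⌋ (adj? u v) p)

    a-sym : ∀ u v → a u v ≡ a v u
    a-sym u v = cong (if_then 1 else 0) (⌊⌋-cong (adj? u v) (adj? v u) adj-sym adj-sym)

    a-irrefl : ∀ u → a u u ≡ 0
    a-irrefl u = a-nonadj (λ p → adj-irrefl p refl)

    deg : V → List V → ℕ
    deg x L = sum (map (a x) L)

    cross : List V → List V → ℕ
    cross A B = sum (map (λ x → deg x B) A)

    deg-++ : ∀ x A B → deg x (A ++ B) ≡ deg x A + deg x B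
    deg-++ x A B = trans (cong sum (Listₚ.map-++ (a x) A B)) (Sumₚ.sum-++ (map (a x) A) (map (a x) B))

    deg-↭ : ∀ x {A B} → A ↭ B → deg x A ≡ deg x B
    deg-↭ x p = Sumₚ.sum-↭ (↭ₚ.map⁺ (a x) p)

    cross-++ˡ : ∀ A B C → cross (A ++ B) C ≡ cross A C + cross B C
    cross-++ˡ A B C = trans (cong sum (Listₚ.map-++ (λ x → deg x C) A B)) (Sumₚ.sum-++ (map (λ x → deg x C) A) (map (λ x → deg x C) B))

    cross-++ʳ : ∀ A B C → cross A (B ++ C) ≡ cross A B + cross A C
    cross-++ʳ A B C = trans (cong sum (Listₚ.map-cong (λ x → deg-++ x B C) A)) (sum-map-+ (λ x → deg x B) (λ x → deg x C) A)

    cross-↭ˡ : ∀ {A B} C → A ↭ B → cross A C ≡ cross B C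
    cross-↭ˡ C p = Sumₚ.sum-↭ (↭ₚ.map⁺ (λ x → deg x C) p)

    cross-↭ʳ : ∀ A {B C} → B ↭ C → cross A B ≡ cross A C
    cross-↭ʳ A p = cong sum (Listₚ.map-cong (λ x → deg-↭ x p) A)

    cross-[]ʳ : ∀ A → cross A [] ≡ 0
    cross-[]ʳ [] = refl
    cross-[]ʳ (_ ∷ A) = cross-[]ʳ A

    cross-∷ʳ : ∀ A x B → cross A (x ∷ B) ≡ deg x A + cross A B
    cross-∷ʳ [] x B = refl
    cross-∷ʳ (y ∷ A) x B = trans (cong₂ (λ p q → p + deg y B + q) (a-sym y x) (cross-∷ʳ A x B)) (mix (a x y) (deg y B) (deg x A) (cross A B))
      where
      mix : ∀ a b c d → (a + b) + (c + d) ≡ (a + c) + (b + d)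
      mix = solve-∀

    cross-sym : ∀ A B → cross A B ≡ cross B A
    cross-sym []      B = sym (cross-[]ʳ B)
    cross-sym (x ∷ A) B = trans (cong (deg x B +_) (cross-sym A B)) (sym (cross-∷ʳ B x A))

    cross-self : ∀ A → ∃[ e ] cross A A ≡ 2 * e
    cross-self [] = 0 , refl
    cross-self (x ∷ A) with cross-self A
    ... | e , eq = deg x A + e , trans (cong₂ _+_ (cong (_+ deg x A) (a-irrefl x)) (trans (cross-∷ʳ A x A) (cong (deg x A +_) eq))) (mix (deg x A) e)
      where
      mix : ∀ d e → d + (d + 2 * e) ≡ 2 * (d + e)
      mix = solve-∀

    deg-0 : ∀ {x} L → deg x L ≡ 0 → ∀ {y} → y ∈ L → ¬ Adj x y
    deg-0 {x} L eq y∈L xy with trans (sym (a-adj xy)) (sum-map-0 (a x) L eq y∈L)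
    ... | ()

    deg-none : ∀ x L → (∀ {y} → y ∈ L → ¬ Adj x y) → deg x L ≡ 0
    deg-none x L none = trans (sum-map-const (a x) 0 L (a-nonadj ∘ none)) (ℕₚ.*-zeroʳ (length L))

    deg-suc : ∀ {x k} L → deg x L ≡ suc k → ∃₂ λ y L′ → L ↭ y ∷ L′ × Adj x y × deg x L′ ≡ k
    deg-suc {x} (y ∷ L) eq with adj? x y
    ... | yes xy = y , L , ↭-refl , xy , ℕₚ.suc-injective eq
    ... | no ¬xy with deg-suc L eq
    ...   | z , L′ , p , xz , eq′ = z , y ∷ L′ , ↭-trans (prep y p) (swap y z ↭-refl) , xz ,
                                   cong₂ _+_ (a-nonadj {x} {y} ¬xy) eq′

    deg-pair : ∀ {x k} L → deg x L ≡ suc (suc k) → Unique L → ∃₂ λ y z → y ∈ L × z ∈ L × y ≢ z × Adj x y × Adj x z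
    deg-pair {x} L eq uniq with deg-suc {x} L eq
    ... | y , L′ , p , xy , eq′ with deg-suc {x} L′ eq′
    ...   | z , L″ , q , xz , _ with unique-resp-↭ (↭-trans p (prep y q)) uniq
    ...     | (y≢z ∷ _) ∷ _ = y , z , ↭ₚ.∈-resp-↭ (↭-sym p) (here refl) ,
                              ↭ₚ.∈-resp-↭ (↭-sym (↭-trans p (prep y q))) (there (here refl)) , y≢z , xy , xz

    deg-≥2 : ∀ {x u v L} → u ≢ v → u ∈ L → v ∈ L → Adj x u → Adj x v → 2 ≤ deg x L
    deg-≥2 {x} {u} {v} u≢v u∈ v∈ xu xv with extract (u ∷ v ∷ []) ((u≢v ∷ []) ∷ [] ∷ []) (u∈ ∷ v∈ ∷ [])
    ... | R , p = subst (2 ≤_) (sym (trans (deg-↭ x p) (cong₂ _+_ (a-adj xu) (cong (_+ deg x R) (a-adj xv))))) (s≤s (s≤s z≤n))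

    all-↭ : ∀ x → ∃[ R ] allFin n ↭ nb x fz ∷ nb x (fs fz) ∷ nb x (fs (fs fz)) ∷ R × deg x R ≡ 0
    all-↭ x with extract (nb x fz ∷ nb x (fs fz) ∷ nb x (fs (fs fz)) ∷ []) distinct (All.tabulate (λ _ → ∈ₚ.∈-allFin _))
      where
      distinct : Unique (nb x fz ∷ nb x (fs fz) ∷ nb x (fs (fs fz)) ∷ [])
      distinct = ((λ e → case simple x _ _ e of λ ()) ∷ (λ e → case simple x _ _ e of λ ()) ∷ []) ∷
                 ((λ e → case simple x _ _ e of λ ()) ∷ []) ∷ [] ∷ []
    ... | R , p = R , p , deg-none x R (λ {y} y∈R → λ { (i , refl) → unique-disjoint (unique-resp-↭ p (Uniqueₚ.allFin⁺ n)) (mem i) y∈R })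
      where
      mem : ∀ i → nb x i ∈ nb x fz ∷ nb x (fs fz) ∷ nb x (fs (fs fz)) ∷ []
      mem fz           = here refl
      mem (fs fz)      = there (here refl)
      mem (fs (fs fz)) = there (there (here refl))

    deg-all : ∀ x → deg x (allFin n) ≡ 3
    deg-all x with all-↭ x
    ... | R , p , none = trans (deg-↭ x p) (cong₂ _+_ (a-adj (_ , refl)) (cong₂ _+_ (a-adj (_ , refl)) (cong₂ _+_ (a-adj (_ , refl)) none)))

    record Split (A W : List V) : Set where
      constructor mkSplit
      field perm : A ++ W ↭ allFin n
    open Split

    split-sym : ∀ {A W} → Split A W → Split W A
    split-sym {A} {W} s = mkSplit (↭-trans (↭ₚ.++-comm W A) (perm s))

    split-↭ : ∀ {A A′ W W′} → A ↭ A′ → W ↭ W′ → Split A W → Split A′ W′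
    split-↭ p q s = mkSplit (↭-trans (↭-sym (↭ₚ.++⁺ p q)) (perm s))

    split-unique : ∀ {A W} → Split A W → Unique (A ++ W)
    split-unique s = unique-resp-↭ (↭-sym (perm s)) (Uniqueₚ.allFin⁺ n)

    split-uniqueˡ : ∀ {A W} → Split A W → Unique A
    split-uniqueˡ s = unique-++ˡ (split-unique s)

    split-disjoint : ∀ {A W} → Split A W → ∀ {x} → x ∈ A → x ∉ W
    split-disjoint s = unique-disjoint (split-unique s)

    split-∈ : ∀ {A W} → Split A W → ∀ x → x ∈ A ⊎ x ∈ W
    split-∈ {A} s x = ∈ₚ.∈-++⁻ A (↭ₚ.∈-resp-↭ (↭-sym (perm s)) (∈ₚ.∈-allFin x))

    split-length : ∀ {A W} → Split A W → length A + length W ≡ n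
    split-length {A} s = trans (sym (Listₚ.length-++ A)) (trans (↭ₚ.↭-length (perm s)) (Listₚ.length-tabulate id))

    split-deg : ∀ {A W} → Split A W → ∀ x → deg x A + deg x W ≡ 3
    split-deg {A} {W} s x = trans (sym (deg-++ x A W)) (trans (deg-↭ x (perm s)) (deg-all x))

    split-count : ∀ {A W} → Split A W → cross A A + cross A W ≡ length A * 3
    split-count {A} {W} s = trans (sym (sum-map-+ (λ x → deg x A) (λ x → deg x W) A))
                                  (sum-map-const (λ x → deg x A + deg x W) 3 A (λ _ → split-deg s _))

    cut-move : ∀ {x A W} → Split (x ∷ A) W → cross A (x ∷ W) + deg x W ≡ cross (x ∷ A) W + deg x A
    cut-move {x} {A} {W} s = trans (cong (_+ deg x W) (cross-∷ʳ A x W)) (mix (deg x A) (cross A W) (deg x W))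
      where
      mix : ∀ p q r → (p + q) + r ≡ (r + q) + p
      mix = solve-∀

    move-split : ∀ {x A W} → Split (x ∷ A) W → Split A (x ∷ W)
    move-split {x} {A} {W} s = mkSplit (↭-trans (↭ₚ.shift x A W) (perm s))

    -- At most two cut edges have at most two ends `p`, `q` in `A`. Any further vertex of `A` would
    -- stay connected to `y` after deleting `p` and `q`, although walks avoiding them cannot leave
    -- `A`.
    cut-bound : ∀ {A W x y} → Split A W → x ∈ A → y ∈ W → 3 ≤ cross A W
    cut-bound {A} {W} {x} {y} s x∈A y∈W with 3 ≤? cross A W
    ... | yes le = le
    ... | no ≰ with sum-map-≤2 (λ x → deg x W) A x∈A (ℕₚ.≤-pred (ℕₚ.≰⇒> ≰))
    ...   | p , q , p∈A , q∈A , inner with Any.any? (λ u → ¬? (u ≟ᵥ p) ×-dec ¬? (u ≟ᵥ q)) A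
    ...     | yes found with find found
    ...       | u , u∈A , u≢p , u≢q =
      contradiction y∈W (split-disjoint s (stay (proj₂ threeConn p q u y u≢p u≢q (y≢ p∈A) (y≢ q∈A)) u∈A u≢p u≢q))
      where
      y≢ : ∀ {z} → z ∈ A → y ≢ z
      y≢ z∈A refl = split-disjoint s z∈A y∈W
      stay : ∀ {u v} → Reach (λ w → w ≢ p × w ≢ q) u v → u ∈ A → u ≢ p → u ≢ q → v ∈ A
      stay here u∈ _ _ = u∈
      stay (step {w = w} uw (w≢p , w≢q) r) u∈ u≢p u≢q with split-∈ s w
      ... | inj₁ w∈A = stay r w∈A w≢p w≢q
      ... | inj₂ w∈W = contradiction uw (deg-0 W (inner u∈ u≢p u≢q) w∈W)
    -- Now `A` lies within `p` and `q`, and degrees decide: one vertex has 3 cut edges, two vertices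
    -- have at least 6 - 2.
    cut-bound {A} {W} {x} {y} s x∈A y∈W | no ≰ | p , q , p∈A , q∈A , inner | no none = contradiction (small A unq x∈A within count) ≰
      where
      unq : Unique A
      unq = split-uniqueˡ s
      count : cross A A + cross A W ≡ length A * 3
      count = split-count s
      within : ∀ {u} → u ∈ A → u ≡ p ⊎ u ≡ q
      within {u} u∈A with u ≟ᵥ p | u ≟ᵥ q
      ... | yes e | _ = inj₁ e
      ... | _ | yes e = inj₂ e
      ... | no e | no e′ = contradiction (lose u∈A (e , e′)) none
      a≤1 : ∀ u v → a u v ≤ 1
      a≤1 u v with adj? u v
      ... | yes _ = ℕₚ.≤-refl
      ... | no _  = z≤n
      small : ∀ B → Unique B → x ∈ B → (∀ {u} → u ∈ B → u ≡ p ⊎ u ≡ q) → cross B B + cross A W ≡ length B * 3 → 3 ≤ cross A W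
      small (b ∷ []) _ _ _ e = ℕₚ.≤-reflexive (sym (trans (cong (λ k → k + 0 + 0 + cross A W) (sym (a-irrefl b))) e))
      small (b ∷ c ∷ []) _ _ _ e = ℕₚ.≤-trans (ℕₚ.n≤1+n 3) (ℕₚ.+-cancelˡ-≤ 2 4 (cross A W) (subst (_≤ 2 + cross A W) e
        (ℕₚ.+-monoˡ-≤ (cross A W) (subst₂ (λ k l → k + (a b c + 0) + (a c b + (l + 0) + 0) ≤ 2) (sym (a-irrefl b)) (sym (a-irrefl c))
          (ℕₚ.+-mono-≤ (ℕₚ.≤-trans (ℕₚ.≤-reflexive (ℕₚ.+-identityʳ (a b c))) (a≤1 b c))
            (ℕₚ.≤-trans (ℕₚ.≤-reflexive (trans (ℕₚ.+-identityʳ _) (ℕₚ.+-identityʳ (a c b)))) (a≤1 c b)))))))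
      small (b ∷ c ∷ d ∷ _) ((b≢c ∷ b≢d ∷ _) ∷ (c≢d ∷ _) ∷ _) _ two _ with two (here refl) | two (there (here refl)) | two (there (there (here refl)))
      ... | inj₁ refl | inj₁ refl | _         = contradiction refl b≢c
      ... | inj₁ refl | inj₂ _    | inj₁ refl = contradiction refl b≢d
      ... | inj₁ _    | inj₂ refl | inj₂ refl = contradiction refl c≢d
      ... | inj₂ _    | inj₁ refl | inj₁ refl = contradiction refl c≢d
      ... | inj₂ refl | inj₁ _    | inj₂ refl = contradiction refl b≢d
      ... | inj₂ refl | inj₂ refl | _         = contradiction refl b≢c

  -- Chordless cycles of length at most 5 bound faces.

  module ShortCycles where

    open Faces
    open Colouring using (cycle-colouring)
    open Cuts

    pairs : Dart → List Dart → Dart → List (Dart × Dart)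
    pairs x []       z = (x , z) ∷ []
    pairs x (y ∷ ys) z = (x , y) ∷ pairs y ys z

    Turn : Dart × Dart → Set
    Turn (y , z) = src z ≡ tgt y × z ≢ α y

    edges : List Dart → Chain
    edges []       d = false
    edges (x ∷ xs) = edge x ⊞ edges xs

    edges-sym : ∀ xs → Symmetric (edges xs)
    edges-sym []       d = refl
    edges-sym (x ∷ xs) = sym-⊞ (edge-sym x) (edges-sym xs)

    ∂-edges : ∀ x ys z → All Turn (pairs x ys z) → ∀ v → ∂ (edges (x ∷ ys)) v ≡ ⌊ src x ≟ᵥ v ⌋ xor ⌊ src z ≟ᵥ v ⌋
    ∂-edges x [] z ((eq , _) ∷ []) v = trans (∂-cong (λ d → Boolₚ.xor-identityʳ (edge x d)) v)
      (trans (∂-edge x v) (cong (λ u → ⌊ src x ≟ᵥ v ⌋ xor ⌊ u ≟ᵥ v ⌋) (sym eq)))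
    ∂-edges x (y ∷ ys) z ((eq , _) ∷ turns) v =
      trans (∂-⊞ (edge x) (edges (y ∷ ys)) v)
        (trans (cong₂ _xor_ (trans (∂-edge x v) (cong (λ u → ⌊ src x ≟ᵥ v ⌋ xor ⌊ u ≟ᵥ v ⌋) (sym eq))) (∂-edges y ys z turns v))
          (trans (Boolₚ.xor-assoc p q (q xor r)) (cong (p xor_) (trans (sym (Boolₚ.xor-assoc q q r)) (cong (_xor r) (Boolₚ.xor-same q))))))
      where
      p q r : Bool
      p = ⌊ src x ≟ᵥ v ⌋
      q = ⌊ src y ≟ᵥ v ⌋
      r = ⌊ src z ≟ᵥ v ⌋

    edges-off : ∀ xs d → (∀ {x} → x ∈ xs → x ≢ d × α x ≢ d) → edges xs d ≡ false
    edges-off [] d off = refl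
    edges-off (x ∷ xs) d off = cong₂ _xor_ (edge-off x d (proj₁ (off (here refl))) (proj₂ (off (here refl)))) (edges-off xs d (off ∘ there))

    edges-on : ∀ xs d → Unique xs → d ∈ xs → (∀ {x} → x ∈ xs → α x ≢ d) → edges xs d ≡ true
    edges-on (x ∷ xs) d (x∉ ∷ uniq) (here refl) off =
      cong₂ _xor_ (edge-self x) (edges-off xs x (λ y∈ → (λ { refl → All.lookup x∉ y∈ refl }) , off (there y∈)))
    edges-on (x ∷ xs) d (x∉ ∷ uniq) (there d∈) off =
      cong₂ _xor_ (edge-off x d (λ { refl → All.lookup x∉ d∈ refl }) (off (here refl))) (edges-on xs d uniq d∈ (off ∘ there))

    pairs-first : ∀ x ys z → map proj₁ (pairs x ys z) ≡ x ∷ ys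
    pairs-first x []       z = refl
    pairs-first x (y ∷ ys) z = cong (x ∷_) (pairs-first y ys z)

    pairs-second : ∀ x ys z → map proj₂ (pairs x ys z) ≡ ys ++ [ z ]
    pairs-second x []       z = refl
    pairs-second x (y ∷ ys) z = cong (y ∷_) (pairs-second y ys z)

    pairs-∈₁ : ∀ {x ys z p} → p ∈ pairs x ys z → proj₁ p ∈ x ∷ ys
    pairs-∈₁ {x} {ys} {z} p∈ = subst (_ ∈_) (pairs-first x ys z) (∈ₚ.∈-map⁺ proj₁ p∈)

    module Cycle (x : Dart) (ys : List Dart) (turns : All Turn (pairs x ys x))
                 (distinct : Unique (map src (x ∷ ys))) where

      xs : List Dart
      xs = x ∷ ys

      ps : List (Dart × Dart)
      ps = pairs x ys x

      Cy : List V
      Cy = map src xs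

      seconds-↭ : map proj₂ ps ↭ xs
      seconds-↭ = ↭-trans (↭-reflexive (pairs-second x ys x)) (↭ₚ.++-comm ys [ x ])

      second∈ : ∀ {p} → p ∈ ps → proj₂ p ∈ xs
      second∈ p∈ = ↭ₚ.∈-resp-↭ seconds-↭ (∈ₚ.∈-map⁺ proj₂ p∈)

      src∈ : ∀ {d} → d ∈ xs → src d ∈ Cy
      src∈ = ∈ₚ.∈-map⁺ src

      next : ∀ {d} → d ∈ xs → ∃[ e ] (d , e) ∈ ps
      next d∈ with ∈ₚ.∈-map⁻ proj₁ (subst (_ ∈_) (sym (pairs-first x ys x)) d∈)
      ... | (_ , e) , p∈ , refl = e , p∈

      turn : ∀ {y z} → (y , z) ∈ ps → src z ≡ tgt y × z ≢ α y
      turn = All.lookup turns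

      tgt∈ : ∀ {d} → d ∈ xs → tgt d ∈ Cy
      tgt∈ d∈ with next d∈
      ... | e , p∈ = subst (_∈ Cy) (proj₁ (turn p∈)) (src∈ (second∈ p∈))

      src-injective : ∀ {d e} → d ∈ xs → e ∈ xs → src d ≡ src e → d ≡ e
      src-injective = go xs distinct
        where
        go : ∀ zs → Unique (map src zs) → ∀ {d e} → d ∈ zs → e ∈ zs → src d ≡ src e → d ≡ e
        go (z ∷ zs) (z∉ ∷ _) (here refl) (here refl) _ = refl
        go (z ∷ zs) (z∉ ∷ _) (here refl) (there q) eq = contradiction eq (All.lookup z∉ (∈ₚ.∈-map⁺ src q))
        go (z ∷ zs) (z∉ ∷ _) (there p) (here refl) eq = contradiction (sym eq) (All.lookup z∉ (∈ₚ.∈-map⁺ src p))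
        go (z ∷ zs) (_ ∷ uniq) (there p) (there q) eq = go zs uniq p q eq

      c : Chain
      c = edges xs

      c-sym : Symmetric c
      c-sym = edges-sym xs

      -- The two sides of the cycle: crossing one of its edges flips `χ`, crossing any other edge
      -- preserves it.
      colouring : ∃[ χ ] (∀ d → χ (φ d) ≡ χ d) × (∀ d → χ (α d) ≡ χ d xor c d)
      colouring = cycle-colouring c c-sym (λ v → trans (∂-edges x ys x turns v) (Boolₚ.xor-same ⌊ src x ≟ᵥ v ⌋))

      χ : Dart → Bool
      χ = proj₁ colouring

      χ-φ : ∀ d → χ (φ d) ≡ χ d
      χ-φ = proj₁ (proj₂ colouring)

      χ-α : ∀ d → χ (α d) ≡ χ d xor c d
      χ-α = proj₂ (proj₂ colouring)

      χ-ν : ∀ d → χ (ν d) ≡ χ d xor c d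
      χ-ν d = trans (cong (χ ∘ ν) (sym (α-involutive d))) (trans (χ-φ (α d)) (χ-α d))

      c-on : ∀ {d} → d ∈ xs → c d ≡ true
      c-on {d} d∈ = edges-on xs d (Unique-map⁻ distinct) d∈ back
        where
        Unique-map⁻ : ∀ {zs} → Unique (map src zs) → Unique zs
        Unique-map⁻ {[]} _ = []
        Unique-map⁻ {z ∷ zs} (z∉ ∷ uniq) = All.map (λ ne eq → ne (cong src eq)) (Allₚ.map⁻ z∉) ∷ Unique-map⁻ uniq
        back : ∀ {y} → y ∈ xs → α y ≢ d
        back {y} y∈ refl with next y∈
        ... | e , p∈ = proj₂ (turn p∈) (src-injective (second∈ p∈) d∈ (proj₁ (turn p∈)))

      c-off : ∀ {d} → src d ∉ Cy → c d ≡ false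
      c-off {d} d∉ = edges-off xs d (λ y∈ → (λ { refl → d∉ (src∈ y∈) }) , (λ { refl → d∉ (tgt∈ y∈) }))

      c-off′ : ∀ {d} → tgt d ∉ Cy → c d ≡ false
      c-off′ {d} d∉ = trans (sym (c-sym d)) (c-off {α d} d∉)

      -- `o` is the dart off the cycle at the vertex between `y` and `z`; the constructor tells on
      -- which side it leaves.
      data Kind (y z o : Dart) : Set where
        right : φ y ≡ z → o ≡ ν z → Kind y z o
        left  : φ y ≡ o → ν o ≡ z → Kind y z o

      third : ∀ {y z} → (y , z) ∈ ps → ∃[ o ] Kind y z o
      third {y} {z} p∈ with three-darts (α y) z (proj₁ (turn p∈))
      ... | inj₁ eq        = contradiction eq (proj₂ (turn p∈))
      ... | inj₂ (inj₁ eq) = ν z , right (sym eq) refl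
      ... | inj₂ (inj₂ eq) = ν (α y) , left refl (sym eq)

      kind-darts : ∀ {y z o} → Kind y z o → ∀ d → src d ≡ src z → (d ≡ α y) ⊎ (d ≡ z) ⊎ (d ≡ o)
      kind-darts {y} (right refl refl) d eq with three-darts (α y) d eq
      ... | inj₁ e        = inj₁ e
      ... | inj₂ (inj₁ e) = inj₂ (inj₁ e)
      ... | inj₂ (inj₂ e) = inj₂ (inj₂ e)
      kind-darts {y} (left refl refl) d eq with three-darts (α y) d eq
      ... | inj₁ e        = inj₁ e
      ... | inj₂ (inj₁ e) = inj₂ (inj₂ e)
      ... | inj₂ (inj₂ e) = inj₂ (inj₁ e)

      kind-src : ∀ {y z o} → Kind y z o → src o ≡ src z
      kind-src (right _ refl) = refl
      kind-src (left _ refl) = refl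

      -- Reasons why the edge off the cycle at `src z` does not end in the cycle vertex `c`: it
      -- differs from the two cycle edges there, it is no loop, or there is no edge to `c` at all.
      data Harmless : Dart × Dart → V → Set where
        from : ∀ {y z c} → c ≡ src y → Harmless (y , z) c
        at   : ∀ {y z c} → c ≡ src z → Harmless (y , z) c
        to   : ∀ {y z c} → c ≡ tgt z → Harmless (y , z) c
        far  : ∀ {y z c} → ¬ Adj (src z) c → Harmless (y , z) c

      kind-≢ : ∀ {y z o} → Kind y z o → o ≢ α y × o ≢ z
      kind-≢ {y} (right refl refl) = ν²-≢ (α y) , ν-≢ (ν (α y))
      kind-≢ {y} (left refl refl)  = ν-≢ (α y) , (λ e → ν-≢ (ν (α y)) (sym e))

      module Chordless (harmless : All (λ p → All (Harmless p) Cy) ps) (short : length ps ≤ 5) where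

        chordless : ∀ {y z o} → (y , z) ∈ ps → Kind y z o → tgt o ∉ Cy
        chordless {y} {z} {o} p∈ k o∈ with All.lookup (All.lookup harmless p∈) o∈
        ... | from e = proj₁ (kind-≢ k) (dart-≡ (trans (kind-src k) (proj₁ (turn p∈))) (trans e (sym (tgt-α y))))
        ... | at e   = loopless (src o) (proj₂ o) (trans e (sym (kind-src k)))
        ... | to e   = proj₂ (kind-≢ k) (dart-≡ (kind-src k) e)
        ... | far e  = e (subst (λ v → Adj v (tgt o)) (kind-src k) (adj-tgt o))

        -- The edge passed in a left turn is off the cycle because there are no chords, so all darts
        -- of the cycle see the same colour.
        κ-step : ∀ {y z} → (y , z) ∈ ps → χ z ≡ χ y
        κ-step {y} p∈ with third p∈
        ... | o , right refl _ = χ-φ y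
        ... | o , k@(left refl refl) = trans (χ-ν o) (trans (cong (χ o xor_) (c-off′ (chordless p∈ k))) (trans (Boolₚ.xor-identityʳ (χ o)) (χ-φ y)))

        κ-const : ∀ {y z} → (y , z) ∈ ps → χ y ≡ χ x
        κ-const = go x ys x κ-step
          where
          go : ∀ w zs u → (∀ {y z} → (y , z) ∈ pairs w zs u → χ z ≡ χ y) → ∀ {y z} → (y , z) ∈ pairs w zs u → χ y ≡ χ w
          go w [] u st (here refl) = refl
          go w (v ∷ zs) u st (here refl) = refl
          go w (v ∷ zs) u st (there p∈) = trans (go v zs u (st ∘ there) p∈) (st (here refl))

        right-colour : ∀ {y z o} → (y , z) ∈ ps → φ y ≡ z → o ≡ ν z → χ o ≡ not (χ x)
        right-colour {y} {z} p∈ e refl = trans (χ-ν z) (trans (cong₂ _xor_ (trans (κ-step p∈) (κ-const p∈)) (c-on (second∈ p∈))) (xor-true (χ x)))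
          where
          xor-true : ∀ b → b xor true ≡ not b
          xor-true false = refl
          xor-true true  = refl

        left-colour : ∀ {y z o} → (y , z) ∈ ps → φ y ≡ o → χ o ≡ χ x
        left-colour {y} p∈ refl = trans (χ-φ y) (κ-const p∈)

        outer-χ : ∀ {y z o} → (p∈ : (y , z) ∈ ps) → Kind y z o → χ (α o) ≡ χ o
        outer-χ {o = o} p∈ k = trans (χ-α o) (trans (cong (χ o xor_) (c-off′ (chordless p∈ k))) (Boolₚ.xor-identityʳ (χ o)))

        complement : ∃[ R ] allFin n ↭ Cy ++ R
        complement = extract Cy distinct (All.tabulate (λ _ → ∈ₚ.∈-allFin _))

        R : List V
        R = proj₁ complement

        col : V → Bool
        col v = χ (v , fz)

        col-dart : ∀ d → src d ∉ Cy → χ d ≡ col (src d)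
        col-dart (v , fz) _ = refl
        col-dart (v , fs fz) off = trans (χ-ν (v , fz)) (trans (cong (col v xor_) (c-off off)) (Boolₚ.xor-identityʳ _))
        col-dart (v , fs (fs fz)) off = trans (χ-ν (v , fs fz))
          (trans (cong (χ (v , fs fz) xor_) (c-off off)) (trans (Boolₚ.xor-identityʳ _) (col-dart (v , fs fz) off)))

        Q : Bool → List V
        Q b = filter (λ v → col v Boolₚ.≟ b) R

        Rest : Split Cy R
        Rest = mkSplit (↭-sym (proj₂ complement))

        whole : ∀ b → Split (Q b) (Cy ++ Q (not b))
        whole b = mkSplit (↭-trans (↭-trans (↭-reflexive (sym (Listₚ.++-assoc (Q b) Cy (Q (not b))))) (↭-trans (↭ₚ.++⁺ʳ (Q (not b)) (↭ₚ.++-comm (Q b) Cy))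
          (↭-trans (↭-reflexive (Listₚ.++-assoc Cy (Q b) (Q (not b)))) (↭ₚ.++⁺ˡ Cy (both b))))) (↭-sym (proj₂ complement)))
          where
          both : ∀ b → Q b ++ Q (not b) ↭ R
          both true  = ↭-sym (filter-bool-↭ col R)
          both false = ↭-trans (↭ₚ.++-comm (Q false) (Q true)) (↭-sym (filter-bool-↭ col R))

        Q∈ : ∀ {b v} → v ∈ Q b → v ∉ Cy × col v ≡ b
        Q∈ {b} {v} v∈ with ∈ₚ.∈-filter⁻ (λ v → col v Boolₚ.≟ b) {xs = R} v∈
        ... | v∈R , eq = split-disjoint (split-sym Rest) v∈R , eq

        ∈Q : ∀ {b v} → v ∉ Cy → col v ≡ b → v ∈ Q b
        ∈Q {b} {v} v∉ eq with split-∈ Rest v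
        ... | inj₁ v∈ = contradiction v∈ v∉
        ... | inj₂ v∈ = ∈ₚ.∈-filter⁺ (λ v → col v Boolₚ.≟ b) v∈ eq

        separated : ∀ b → cross (Q b) (Q (not b)) ≡ 0
        separated b = trans (sum-map-const (λ v → deg v (Q (not b))) 0 (Q b)
            (λ {v} v∈ → deg-none v (Q (not b)) (λ { {w} w∈ (i , refl) → clash v i v∈ w∈ })))
          (ℕₚ.*-zeroʳ (length (Q b)))
          where
          clash : ∀ v i → v ∈ Q b → nb v i ∈ Q (not b) → ⊥
          clash v i v∈ w∈ = Boolₚ.not-¬ {b} refl
            (trans (sym (proj₂ (Q∈ v∈))) (trans (sym (col-dart (v , i) (proj₁ (Q∈ v∈))))
              (trans (sym (trans (χ-α (v , i)) (trans (cong (χ (v , i) xor_) (c-off (proj₁ (Q∈ v∈)))) (Boolₚ.xor-identityʳ _))))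
                (trans (col-dart (α (v , i)) (proj₁ (Q∈ w∈))) (proj₂ (Q∈ w∈))))))

        isRight : Dart × Dart → Bool
        isRight (y , z) = ⌊ φ y ≟ₐ z ⌋

        outer-colour : ∀ {y z o} → (y , z) ∈ ps → Kind y z o → χ o ≡ χ x xor isRight (y , z)
        outer-colour {y} {z} p∈ (right e e′) = trans (right-colour p∈ e e′)
          (trans (not-xor (χ x)) (cong (χ x xor_) (sym (⌊yes⌋ (φ y ≟ₐ z) e))))
          where
          not-xor : ∀ b → not b ≡ b xor true
          not-xor false = refl
          not-xor true  = refl
        outer-colour {y} {z} {o} p∈ (left e e′) = trans (left-colour p∈ e)
          (trans (sym (Boolₚ.xor-identityʳ (χ x))) (cong (χ x xor_) (sym (⌊no⌋ (φ y ≟ₐ z) (λ q → ν-≢ o (trans e′ (trans (sym q) e)))))))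

        count : Bool → ℕ
        count b = sum (map (λ p → if ⌊ isRight p Boolₚ.≟ b ⌋ then 1 else 0) ps)

        count-total : count true + count false ≡ length ps
        count-total = trans (sym (sum-map-+ (λ p → if ⌊ isRight p Boolₚ.≟ true ⌋ then 1 else 0) _ ps))
          (trans (sum-map-const _ 1 ps (λ {p} _ → one (isRight p))) (ℕₚ.*-identityʳ (length ps)))
          where
          one : ∀ b → (if ⌊ b Boolₚ.≟ true ⌋ then 1 else 0) + (if ⌊ b Boolₚ.≟ false ⌋ then 1 else 0) ≡ 1
          one true  = refl
          one false = refl

        Cy-seconds : Cy ↭ map (src ∘ proj₂) ps
        Cy-seconds = ↭-sym (↭-trans (↭-reflexive (Listₚ.map-∘ ps)) (↭ₚ.map⁺ src seconds-↭))

        -- Two of the three neighbours lie on the cycle. The third edge reaches at most one side,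
        -- determined by the direction of the turn.
        side-degree : ∀ {p} b → p ∈ ps → deg (src (proj₂ p)) (Q (χ x xor b)) ≤ (if ⌊ isRight p Boolₚ.≟ b ⌋ then 1 else 0)
        side-degree {y , z} b p∈ = go (isRight (y , z) Boolₚ.≟ b)
          where
          v : V
          v = src z
          o : Dart
          o = proj₁ (third p∈)
          k : Kind y z o
          k = proj₂ (third p∈)
          others : List V
          others = Cy ++ Q (not (χ x xor b))
          back∈ : src y ∈ others
          back∈ = ∈ₚ.∈-++⁺ˡ (src∈ (pairs-∈₁ p∈))
          forth∈ : tgt z ∈ others
          forth∈ = ∈ₚ.∈-++⁺ˡ (tgt∈ (second∈ p∈))
          v~y : Adj v (src y)
          v~y = subst (λ u → Adj u (src y)) (sym (proj₁ (turn p∈))) (adj-sym (adj-tgt y))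
          distinct-ends : src y ≢ tgt z
          distinct-ends eq = proj₂ (turn p∈) (dart-≡ (proj₁ (turn p∈)) (trans (sym eq) (sym (tgt-α y))))
          two : 2 ≤ deg v others
          two = deg-≥2 distinct-ends back∈ forth∈ v~y (adj-tgt z)
          go : (d : Dec (isRight (y , z) ≡ b)) → deg v (Q (χ x xor b)) ≤ (if ⌊ d ⌋ then 1 else 0)
          go (yes _) = ℕₚ.+-cancelʳ-≤ 2 _ 1 (subst (deg v (Q (χ x xor b)) + 2 ≤_) (split-deg (whole (χ x xor b)) v) (ℕₚ.+-monoʳ-≤ (deg v (Q (χ x xor b))) two))
          go (no ne) = ℕₚ.≤-reflexive (deg-none v (Q (χ x xor b)) (λ { w∈ (i , refl) → nowhere i w∈ }))
            where
            nowhere : ∀ i → nb v i ∈ Q (χ x xor b) → ⊥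
            nowhere i w∈ with kind-darts k (v , i) refl
            ... | inj₁ eq        = proj₁ (Q∈ w∈) (subst (_∈ Cy) (sym (trans (cong tgt eq) (tgt-α y))) (src∈ (pairs-∈₁ p∈)))
            ... | inj₂ (inj₁ eq) = proj₁ (Q∈ w∈) (subst (_∈ Cy) (sym (cong tgt eq)) (tgt∈ (second∈ p∈)))
            ... | inj₂ (inj₂ eq) = ne (xor-injective (χ x) (trans (sym (outer-colour p∈ k))
                (trans (sym (outer-χ p∈ k)) (trans (col-dart (α o) (chordless p∈ k)) (trans (cong (col ∘ tgt) (sym eq)) (proj₂ (Q∈ w∈)))))))
              where
              xor-injective : ∀ a {b c} → a xor b ≡ a xor c → b ≡ c
              xor-injective false eq = eq
              xor-injective true  eq = Boolₚ.not-injective eq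

        side-cut : ∀ b → cross (Q (χ x xor b)) (Cy ++ Q (not (χ x xor b))) ≤ count b
        side-cut b = begin
          cross A (Cy ++ Q (not (χ x xor b)))        ≡⟨ cross-++ʳ A Cy _ ⟩
          cross A Cy + cross A (Q (not (χ x xor b))) ≡⟨ cong₂ _+_ (cross-sym A Cy) (separated (χ x xor b)) ⟩
          cross Cy A + 0                             ≡⟨ ℕₚ.+-identityʳ _ ⟩
          cross Cy A                                 ≡⟨ cross-↭ˡ A Cy-seconds ⟩
          cross (map (src ∘ proj₂) ps) A             ≡⟨ cong sum (Listₚ.map-∘ ps) ⟨
          sum (map (λ p → deg (src (proj₂ p)) A) ps) ≤⟨ sum-map-≤ _ _ ps (side-degree b) ⟩
          count b                                    ∎
          where
          open ℕₚ.≤-Reasoning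
          A : List V
          A = Q (χ x xor b)

        side-inhabited : ∀ {p} b → p ∈ ps → isRight p ≡ b → 3 ≤ count b
        side-inhabited {y , z} b p∈ eq = ℕₚ.≤-trans (cut-bound (whole (χ x xor b)) in-side (∈ₚ.∈-++⁺ˡ {xs = Cy} (here refl))) (side-cut b)
          where
          o : Dart
          o = proj₁ (third p∈)
          k : Kind y z o
          k = proj₂ (third p∈)
          in-side : tgt o ∈ Q (χ x xor b)
          in-side = ∈Q (chordless p∈ k) (trans (sym (col-dart (α o) (chordless p∈ k)))
            (trans (outer-χ p∈ k) (trans (outer-colour p∈ k) (cong (χ x xor_) eq))))

        -- Two inhabited sides would take at least 3 edges each by `cut-bound`, but there are at
        -- most 5. If all edges leave on one side, `φ` traces the cycle in one of its two
        -- directions.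
        one-sided : (∀ {y z} → (y , z) ∈ ps → φ y ≡ z) ⊎ (∀ {y z} → (y , z) ∈ ps → φ (α z) ≡ α y)
        one-sided with Any.any? (λ p → isRight p Boolₚ.≟ true) ps | Any.any? (λ p → isRight p Boolₚ.≟ false) ps
        ... | yes r | yes l = contradiction
          (ℕₚ.≤-trans (ℕₚ.+-mono-≤ (inhabited true r) (inhabited false l)) (ℕₚ.≤-trans (ℕₚ.≤-reflexive count-total) short)) (ℕₚ.<⇒≱ ℕₚ.≤-refl)
          where
          inhabited : ∀ b → Any (λ p → isRight p ≡ b) ps → 3 ≤ count b
          inhabited b found with find found
          ... | p , p∈ , eq = side-inhabited b p∈ eq
        ... | no ¬r | _ = inj₂ (λ {y} {z} p∈ → reverse p∈ (proj₂ (third p∈)) (λ e → ¬r (lose p∈ (⌊yes⌋ (φ y ≟ₐ z) e))))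
          where
          reverse : ∀ {y z o} → (y , z) ∈ ps → Kind y z o → φ y ≢ z → φ (α z) ≡ α y
          reverse p∈ (right e _) ne = contradiction e ne
          reverse {y} {z} p∈ (left refl refl) ne = trans (cong ν (α-involutive z)) (ν³ (α y))
        ... | yes _ | no ¬l = inj₁ (λ {y} {z} p∈ → decidable-stable (φ y ≟ₐ z)
                (λ ne → ¬l (lose p∈ (⌊no⌋ (φ y ≟ₐ z) ne))))

    no-short-face : ∀ {d} k → suc k ≤ 4 → φ^ (suc k) d ≢ d
    no-short-face {d} k k≤ with face-length d
    ... | f , 5≤f , _ , _ , least = least (suc k) (s≤s z≤n) (ℕₚ.≤-trans (s≤s k≤) 5≤f)

    dart : ∀ {u v} → Adj u v → Dart
    dart {u} (i , _) = u , i

    dart-tgt : ∀ {u v} (p : Adj u v) → tgt (dart p) ≡ v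
    dart-tgt (_ , eq) = eq

    turn-at : ∀ {u v w} (p : Adj u v) (q : Adj v w) → u ≢ w → Turn (dart p , dart q)
    turn-at {u} p q u≢w = sym (dart-tgt p) , λ eq → u≢w (trans (sym (tgt-α (dart p))) (trans (cong tgt (sym eq)) (dart-tgt q)))

    adj-≢ : ∀ {u v} → Adj u v → v ≢ u
    adj-≢ p eq = adj-irrefl p (sym eq)

    -- By `one-sided` it would be a face of size 3.
    no-triangle : ∀ {u v w} → Adj u v → Adj v w → Adj w u → ⊥
    no-triangle {u} {v} {w} uv vw wu = rule (Chordless.one-sided chordless (s≤s (s≤s (s≤s z≤n))))
      where
      open Cycle (dart uv) (dart vw ∷ dart wu ∷ [])
        (turn-at uv vw (adj-irrefl (adj-sym wu)) ∷ turn-at vw wu (adj-irrefl (adj-sym uv)) ∷ turn-at wu uv (adj-irrefl (adj-sym vw)) ∷ [])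
        ((adj-irrefl uv ∷ adj-≢ wu ∷ []) ∷ (adj-irrefl vw ∷ []) ∷ [] ∷ [])
      chordless : All (λ p → All (Harmless p) Cy) ps
      chordless =
        (from refl ∷ at refl ∷ to (sym (dart-tgt vw)) ∷ []) ∷
        (to (sym (dart-tgt wu)) ∷ from refl ∷ at refl ∷ []) ∷
        (at refl ∷ to (sym (dart-tgt uv)) ∷ from refl ∷ []) ∷ []
      rule : (∀ {y z} → (y , z) ∈ ps → φ y ≡ z) ⊎ (∀ {y z} → (y , z) ∈ ps → φ (α z) ≡ α y) → ⊥
      rule (inj₁ r) = no-short-face 2 (ℕₚ.n≤1+n 3) (trans (cong (φ^ 2) (r (here refl))) (trans (cong φ (r (there (here refl)))) (r (there (there (here refl))))))
      rule (inj₂ l) = no-short-face 2 (ℕₚ.n≤1+n 3) (trans (cong (φ^ 2) (l (there (there (here refl))))) (trans (cong φ (l (there (here refl)))) (l (here refl))))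

    no-chord : ∀ {u v w} → Adj u v → Adj v w → ¬ Adj u w
    no-chord uv vw uw = no-triangle uv vw (adj-sym uw)

    -- A diagonal would complete a triangle, so the cycle is chordless and would be a face of size
    -- 4.
    no-square : ∀ {u v w t} → Adj u v → Adj v w → Adj w t → Adj t u → u ≢ w → v ≢ t → ⊥
    no-square {u} {v} {w} {t} uv vw wt tu u≢w v≢t = rule (Chordless.one-sided chordless (s≤s (s≤s (s≤s (s≤s z≤n)))))
      where
      open Cycle (dart uv) (dart vw ∷ dart wt ∷ dart tu ∷ [])
        (turn-at uv vw u≢w ∷ turn-at vw wt v≢t ∷ turn-at wt tu (u≢w ∘ sym) ∷ turn-at tu uv (v≢t ∘ sym) ∷ [])
        ((adj-irrefl uv ∷ u≢w ∷ adj-≢ tu ∷ []) ∷ (adj-irrefl vw ∷ v≢t ∷ []) ∷ (adj-irrefl wt ∷ []) ∷ [] ∷ [])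
      chordless : All (λ p → All (Harmless p) Cy) ps
      chordless =
        (from refl ∷ at refl ∷ to (sym (dart-tgt vw)) ∷ far (no-chord vw wt) ∷ []) ∷
        (far (no-chord wt tu) ∷ from refl ∷ at refl ∷ to (sym (dart-tgt wt)) ∷ []) ∷
        (to (sym (dart-tgt tu)) ∷ far (no-chord tu uv) ∷ from refl ∷ at refl ∷ []) ∷
        (at refl ∷ to (sym (dart-tgt uv)) ∷ far (no-chord uv vw) ∷ from refl ∷ []) ∷ []
      rule : (∀ {y z} → (y , z) ∈ ps → φ y ≡ z) ⊎ (∀ {y z} → (y , z) ∈ ps → φ (α z) ≡ α y) → ⊥
      rule (inj₁ r) = no-short-face 3 ℕₚ.≤-refl (trans (cong (φ^ 3) (r (here refl))) (trans (cong (φ^ 2) (r (there (here refl))))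
        (trans (cong φ (r (there (there (here refl))))) (r (there (there (there (here refl))))))))
      rule (inj₂ l) = no-short-face 3 ℕₚ.≤-refl (trans (cong (φ^ 3) (l (there (there (there (here refl)))))) (trans (cong (φ^ 2) (l (there (there (here refl)))))
        (trans (cong φ (l (there (here refl)))) (l (here refl)))))

    Pentagon : (p q r s t : Dart) → Set
    Pentagon p q r s t = φ p ≡ q × φ q ≡ r × φ r ≡ s × φ s ≡ t × φ t ≡ p

    -- Chords are again excluded by triangles. The two alternatives are the two directions in which
    -- the face may run.
    pentagon : ∀ {a b c d e} (ab : Adj a b) (bc : Adj b c) (cd : Adj c d) (de : Adj d e) (ea : Adj e a) →
               a ≢ c → b ≢ d → c ≢ e → d ≢ a → e ≢ b →
               Pentagon (dart ab) (dart bc) (dart cd) (dart de) (dart ea) ⊎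
               Pentagon (α (dart ea)) (α (dart de)) (α (dart cd)) (α (dart bc)) (α (dart ab))
    pentagon ab bc cd de ea a≢c b≢d c≢e d≢a e≢b = rule (Chordless.one-sided chordless (s≤s (s≤s (s≤s (s≤s (s≤s z≤n))))))
      where
      open Cycle (dart ab) (dart bc ∷ dart cd ∷ dart de ∷ dart ea ∷ [])
        (turn-at ab bc a≢c ∷ turn-at bc cd b≢d ∷ turn-at cd de c≢e ∷ turn-at de ea d≢a ∷ turn-at ea ab e≢b ∷ [])
        ((adj-irrefl ab ∷ a≢c ∷ (d≢a ∘ sym) ∷ adj-≢ ea ∷ []) ∷ (adj-irrefl bc ∷ b≢d ∷ (e≢b ∘ sym) ∷ []) ∷
         (adj-irrefl cd ∷ c≢e ∷ []) ∷ (adj-irrefl de ∷ []) ∷ [] ∷ [])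
      chordless : All (λ p → All (Harmless p) Cy) ps
      chordless =
        (from refl ∷ at refl ∷ to (sym (dart-tgt bc)) ∷ far (no-chord bc cd) ∷ far (no-chord (adj-sym ab) (adj-sym ea)) ∷ []) ∷
        (far (no-chord (adj-sym bc) (adj-sym ab)) ∷ from refl ∷ at refl ∷ to (sym (dart-tgt cd)) ∷ far (no-chord cd de) ∷ []) ∷
        (far (no-chord de ea) ∷ far (no-chord (adj-sym cd) (adj-sym bc)) ∷ from refl ∷ at refl ∷ to (sym (dart-tgt de)) ∷ []) ∷
        (to (sym (dart-tgt ea)) ∷ far (no-chord ea ab) ∷ far (no-chord (adj-sym de) (adj-sym cd)) ∷ from refl ∷ at refl ∷ []) ∷
        (at refl ∷ to (sym (dart-tgt ab)) ∷ far (no-chord ab bc) ∷ far (no-chord (adj-sym ea) (adj-sym de)) ∷ from refl ∷ []) ∷ []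
      rule : (∀ {y z} → (y , z) ∈ ps → φ y ≡ z) ⊎ (∀ {y z} → (y , z) ∈ ps → φ (α z) ≡ α y) → _
      rule (inj₁ r) = inj₁ (r (here refl) , r (there (here refl)) , r (there (there (here refl))) , r (there (there (there (here refl)))) , r (there (there (there (there (here refl))))))
      rule (inj₂ l) = inj₂ (l (there (there (there (here refl)))) , l (there (there (here refl))) , l (there (here refl)) , l (here refl) , l (there (there (there (there (here refl))))))

  -- Patches, their gap words, and how faces cross the cut.

  module Patches where

    open Faces
    open Colouring using (cycle-colouring)

    Out : List V → Dart → Set
    Out W d = src d ∈ W × tgt d ∉ W

    hd : List Dart → Dart → Dart
    hd []      e = e
    hd (d ∷ _) _ = d

    -- The face entered along α d leaves W again along e after visiting g vertices of W.
    record Gap (W : List V) (d : Dart) (g : ℕ) (e : Dart) : Set where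
      constructor mkGap
      field
        reaches : φ^ g (α d) ≡ e
        inside  : ∀ m → m < g → tgt (φ^ m (α d)) ∈ W

    data Gaps (W : List V) : List Dart → List ℕ → Dart → Set where
      []  : ∀ {e} → Gaps W [] [] e
      _∷_ : ∀ {d ds g gs e} → Gap W d g (hd ds e) → Gaps W ds gs e → Gaps W (d ∷ ds) (g ∷ gs) e

    -- The legs d ∷ ds are the darts leaving W, in the cyclic order in which the faces around W meet them.
    record Patch (W : List V) (d : Dart) (ds : List Dart) (word : List ℕ) : Set where
      field
        gaps      : Gaps W (d ∷ ds) word d
        out       : ∀ {e} → e ∈ d ∷ ds → Out W e
        complete  : ∀ {e} → Out W e → e ∈ d ∷ ds
        distinct  : Unique (d ∷ ds)
        connected : ∀ {x y} → x ∈ W → y ∈ W → Reach (_∈ W) x y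

    φ^-φ : ∀ k d → φ^ k (φ d) ≡ φ^ (suc k) d
    φ^-φ zero    d = refl
    φ^-φ (suc k) d = cong φ (φ^-φ k d)

    -- If `g` reached the face size f, then `e` would already occur f steps earlier, where its head
    -- still lies in `W`.
    gap-≤5 : ∀ {W d g e} → Gap W d g e → Out W e → g ≤ 5
    gap-≤5 {W} {d} {g} {e} (mkGap reaches inside) (_ , e∉) = go (face-length (α d))
      where
      go : ∃[ f ] 5 ≤ f × f ≤ 6 × φ^ f (α d) ≡ α d × (∀ m → 0 < m → m < f → φ^ m (α d) ≢ α d) → g ≤ 5
      go (f , 5≤f , f≤6 , closed , _) = ℕₚ.≤-pred (ℕₚ.≤-trans (ℕₚ.≰⇒> (λ f≤g → e∉ (subst (λ x → tgt x ∈ W) (wrap f≤g)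
          (inside (g ∸ f) (shrink f≤g))))) f≤6)
        where
        wrap : f ≤ g → φ^ (g ∸ f) (α d) ≡ e
        wrap f≤g = trans (cong (φ^ (g ∸ f)) (sym closed)) (trans (sym (φ^-+ (g ∸ f) f (α d)))
                     (trans (cong (λ k → φ^ k (α d)) (ℕₚ.m∸n+n≡m f≤g)) reaches))
        shrink : f ≤ g → g ∸ f < g
        shrink f≤g = ℕₚ.∸-monoʳ-< (ℕₚ.≤-trans (s≤s z≤n) 5≤f) f≤g

    -- The face returns to `α d` after g + 1 steps, so g + 1 is at least 5.
    gap-closes : ∀ {W d g e} → Gap W d g e → Out W e → φ e ≡ α d → g ≡ 4 ⊎ g ≡ 5
    gap-closes {W} {d} {g} {e} G o closes = go (face-length (α d))
      where
      four : ∀ {k} → 5 ≤ suc k → k ≤ 5 → k ≡ 4 ⊎ k ≡ 5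
      four {4} _ _ = inj₁ refl
      four {5} _ _ = inj₂ refl
      four {0} (s≤s ()) _
      four {1} (s≤s (s≤s ())) _
      four {2} (s≤s (s≤s (s≤s ()))) _
      four {3} (s≤s (s≤s (s≤s (s≤s ())))) _
      four {suc (suc (suc (suc (suc (suc _)))))} _ (s≤s (s≤s (s≤s (s≤s (s≤s ())))))
      go : ∃[ f ] 5 ≤ f × f ≤ 6 × φ^ f (α d) ≡ α d × (∀ m → 0 < m → m < f → φ^ m (α d) ≢ α d) → g ≡ 4 ⊎ g ≡ 5
      go (f , 5≤f , _ , _ , least) = four (ℕₚ.≤-trans 5≤f (ℕₚ.≮⇒≥ (λ lt → least (suc g) (s≤s z≤n) lt (trans (cong φ (Gap.reaches G)) closes)))) (gap-≤5 G o)

    gaps-≤5 : ∀ {W ds gs e} → Gaps W ds gs e → (∀ {f} → f ∈ ds → Out W f) → Out W e → All (_≤ 5) gs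
    gaps-≤5 [] _ _ = []
    gaps-≤5 {ds = d ∷ []} (G ∷ []) out oe = gap-≤5 G oe ∷ []
    gaps-≤5 {ds = d ∷ d′ ∷ ds} (G ∷ Gs) out oe = gap-≤5 G (out (there (here refl))) ∷ gaps-≤5 Gs (out ∘ there) oe

    word-≤5 : ∀ {W d ds w} → Patch W d ds w → All (_≤ 5) w
    word-≤5 P = gaps-≤5 (Patch.gaps P) (Patch.out P) (Patch.out P (here refl))

    gaps-snoc : ∀ {W ds gs d g z} → Gaps W ds gs d → Gap W d g z → Gaps W (ds ++ [ d ]) (gs ++ [ g ]) z
    gaps-snoc [] G = G ∷ []
    gaps-snoc {ds = d ∷ []} (H ∷ []) G = H ∷ G ∷ []
    gaps-snoc {ds = d ∷ e ∷ ds} (H ∷ Hs) G = H ∷ gaps-snoc Hs G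

    rotate : ∀ {W d e ds g w} → Patch W d (e ∷ ds) (g ∷ w) → Patch W e (ds ++ [ d ]) (w ++ [ g ])
    rotate {W} {d} {e} {ds} {g} {w} P = record
      { gaps = turn-gaps (Patch.gaps P)
      ; out = Patch.out P ∘ ↭ₚ.∈-resp-↭ shift
      ; complete = ↭ₚ.∈-resp-↭ (↭-sym shift) ∘ Patch.complete P
      ; distinct = unique-resp-↭ (↭-sym shift) (Patch.distinct P)
      ; connected = Patch.connected P }
      where
      shift : e ∷ ds ++ [ d ] ↭ d ∷ e ∷ ds
      shift = ↭ₚ.++-comm (e ∷ ds) [ d ]
      turn-gaps : Gaps W (d ∷ e ∷ ds) (g ∷ w) d → Gaps W (e ∷ ds ++ [ d ]) (w ++ [ g ]) e
      turn-gaps (G ∷ Gs) = gaps-snoc Gs G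

    rotate-at : ∀ {W d e w} us {vs} → Patch W d (us ++ e ∷ vs) w → ∃[ w′ ] Rotation w w′ × Patch W e (vs ++ d ∷ us) w′
    rotate-at {w = []} us P = case Patch.gaps P of λ ()
    rotate-at {w = g ∷ w} [] P = _ , rot fixed , rotate P
    rotate-at {W} {d} {e} {g ∷ w} (u ∷ us) {vs} P =
      let w′ , r , Q = rotate-at {W} {u} {e} {w ++ [ g ]} us {vs ++ [ d ]}
                         (subst (λ l → Patch W u l (w ++ [ g ])) (Listₚ.++-assoc us (e ∷ vs) [ d ]) (rotate P))
      in w′ , rot r , subst (λ l → Patch W e l w′) (Listₚ.++-assoc vs [ d ] (u ∷ us)) Q

    rotate-to : ∀ {W d ds w e} → Patch W d ds w → e ∈ d ∷ ds → ∃₂ λ ds′ w′ → Rotation w w′ × Patch W e ds′ w′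
    rotate-to {ds = ds} P (here refl) = ds , _ , fixed , P
    rotate-to P (there e∈) with ∈ₚ.∈-∃++ e∈
    ... | us , vs , refl = _ , rotate-at us P

    -- If the face through two consecutive legs of W came back to W elsewhere, a cycle through the legs e and l
    -- would have this face on both sides.
    module Crossing {W d ds w} (P : Patch W d ds w)
                    (outside : ∀ {x y} → x ∉ W → y ∉ W → Reach (_∉ W) x y) where
      open Patch P

      module Loop {l e} (l∈ : l ∈ d ∷ ds) (e∈ : e ∈ d ∷ ds) (l≢e : l ≢ e) where

        inner : Reach (_∈ W) (src l) (src e)
        inner = connected (proj₁ (out l∈)) (proj₁ (out e∈))

        outer : Reach (_∉ W) (tgt l) (tgt e)
        outer = outside (proj₂ (out l∈)) (proj₂ (out e∈))

        -- A closed curve: out along `l`, through the complement, in along `e`, and back inside `W`.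
        -- Among the legs it uses just these two, so the colour changes only there on a walk around
        -- `W`.
        c : Chain
        c = (edge l ⊞ edge e) ⊞ (chain inner ⊞ chain outer)

        c-sym : Symmetric c
        c-sym = sym-⊞ (sym-⊞ (edge-sym l) (edge-sym e)) (sym-⊞ (chain-sym inner) (chain-sym outer))

        ∂c : ∀ v → ∂ c v ≡ false
        ∂c v = trans (∂-⊞ (edge l ⊞ edge e) (chain inner ⊞ chain outer) v)
          (trans (cong₂ _xor_ (trans (∂-⊞ (edge l) (edge e) v) (cong₂ _xor_ (∂-edge l v) (∂-edge e v)))
                              (trans (∂-⊞ (chain inner) (chain outer) v) (cong₂ _xor_ (∂-chain inner v) (∂-chain outer v))))
            (trans (cong (_xor ((p xor r) xor (q xor s))) (xor-interchange p q r s)) (Boolₚ.xor-same ((p xor r) xor (q xor s)))))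
          where
          p q r s : Bool
          p = ⌊ src l ≟ᵥ v ⌋
          q = ⌊ tgt l ≟ᵥ v ⌋
          r = ⌊ src e ≟ᵥ v ⌋
          s = ⌊ tgt e ≟ᵥ v ⌋

        leg-edge : ∀ {f g} → f ∈ d ∷ ds → g ∈ d ∷ ds → edge g f ≡ ⌊ g ≟ₐ f ⌋
        leg-edge {f} {g} f∈ g∈ = trans (cong (⌊ g ≟ₐ f ⌋ xor_) (⌊no⌋ (α g ≟ₐ f) (λ { refl → proj₂ (out g∈) (proj₁ (out f∈)) })))
                                       (Boolₚ.xor-identityʳ _)

        off : ∀ b → ¬ (b ≡ true) → b ≡ false
        off false _ = refl
        off true ne = contradiction refl ne

        c-leg : ∀ {f} → f ∈ d ∷ ds → c f ≡ ⌊ l ≟ₐ f ⌋ xor ⌊ e ≟ₐ f ⌋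
        c-leg {f} f∈ = trans (cong₂ _xor_ (cong₂ _xor_ (leg-edge f∈ l∈) (leg-edge f∈ e∈))
            (cong₂ _xor_ (off (chain inner f) (λ t → proj₂ (out f∈) (proj₂ (chain-support inner (proj₁ (out l∈)) f t))))
                         (off (chain outer f) (λ t → proj₁ (chain-support outer (proj₂ (out l∈)) f t) (proj₁ (out f∈))))))
          (Boolₚ.xor-identityʳ _)

        colouring : Σ (Dart → Bool) λ χ → (∀ d → χ (φ d) ≡ χ d) × (∀ d → χ (α d) ≡ χ d xor c d)
        colouring = cycle-colouring c c-sym ∂c

        χ : Dart → Bool
        χ = proj₁ colouring

        χ-φ^ : ∀ k f → χ (φ^ k f) ≡ χ f
        χ-φ^ zero    f = refl
        χ-φ^ (suc k) f = trans (proj₁ (proj₂ colouring) (φ^ k f)) (χ-φ^ k f)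

        χ-α : ∀ f → χ (α f) ≡ χ f xor c f
        χ-α = proj₂ (proj₂ colouring)

        gap-χ : ∀ {f g f′} → Gap W f g f′ → c f ≡ false → χ f′ ≡ χ f
        gap-χ {f} {g} (mkGap refl _) cf = trans (χ-φ^ g (α f)) (trans (χ-α f) (trans (cong (χ f xor_) cf) (Boolₚ.xor-identityʳ (χ f))))

        walk : ∀ {d} us {vs gs z} → Gaps W (d ∷ us ++ e ∷ vs) gs z → (∀ {f} → f ∈ d ∷ us → c f ≡ false) → χ e ≡ χ d
        walk [] (G ∷ _) quiet = gap-χ G (quiet (here refl))
        walk (u ∷ us) (G ∷ Gs) quiet = trans (walk us Gs (quiet ∘ there)) (gap-χ G (quiet (here refl)))

      -- The curve goes through `e` and its successor `v`. The legs from `d` up to `e` avoid it, so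
      -- `e` has the colour of `d`; the face left along `d` gives the same colour to `α e`; but the
      -- colour flips at `e`.
      crossing-split : ∀ h us e v vs → ds ≡ us ++ e ∷ v ∷ vs → φ^ h d ≡ α e → ⊥
      crossing-split h us e v vs refl eq = Boolₚ.not-¬ {χ e} refl (begin
        χ e                       ≡⟨ walk us gaps quiet ⟩
        χ d                       ≡⟨ χ-φ^ h d ⟨
        χ (φ^ h d)                ≡⟨ cong χ eq ⟩
        χ (α e)                   ≡⟨ χ-α e ⟩
        χ e xor c e               ≡⟨ cong (χ e xor_) (trans (c-leg e∈) (cong₂ _xor_ (⌊no⌋ (v ≟ₐ e) v≢e) (⌊yes⌋ (e ≟ₐ e) refl))) ⟩
        χ e xor true              ≡⟨ Boolₚ.xor-comm (χ e) true ⟩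
        not (χ e)                 ∎)
        where
        open ≡-Reasoning
        tail-unique : Unique (e ∷ v ∷ vs)
        tail-unique = unique-++ʳ (d ∷ us) distinct
        e∈ : e ∈ d ∷ us ++ e ∷ v ∷ vs
        e∈ = ∈ₚ.∈-++⁺ʳ (d ∷ us) (here refl)
        v∈ : v ∈ d ∷ us ++ e ∷ v ∷ vs
        v∈ = ∈ₚ.∈-++⁺ʳ (d ∷ us) (there (here refl))
        v≢e : v ≢ e
        v≢e refl = unique-disjoint {xs = e ∷ []} tail-unique (here refl) (here refl)
        open Loop v∈ e∈ v≢e
        quiet : ∀ {f} → f ∈ d ∷ us → c f ≡ false
        quiet {f} f∈ = trans (c-leg (∈ₚ.∈-++⁺ˡ f∈)) (cong₂ _xor_
          (⌊no⌋ (v ≟ₐ f) (λ { refl → unique-disjoint distinct f∈ (there (here refl)) }))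
          (⌊no⌋ (e ≟ₐ f) (λ { refl → unique-disjoint distinct f∈ (here refl) })))

      -- Being last in the list means being cyclically just before `d`. So the outer face left along
      -- `d` meets no other leg than its predecessor.
      crossing : ∀ h {e} → e ∈ ds → φ^ h d ≡ α e → ∃[ us ] ds ≡ us ++ [ e ]
      crossing h {e} e∈ eq with ∈ₚ.∈-∃++ e∈
      ... | us , [] , p = us , p
      ... | us , v ∷ vs , p = ⊥-elim (crossing-split h us e v vs p eq)

  -- Adding a vertex to a patch.

  module PatchMoves where

    open Cuts
    open Patches
    open ShortCycles using (dart; dart-tgt)

    gap-mono : ∀ {W x d g e} → Gap W d g e → Gap (x ∷ W) d g e
    gap-mono (mkGap r i) = mkGap r (λ m lt → there (i m lt))

    gap-forward : ∀ {W d g l p} → Gap W d g l → φ l ≡ p → Gap (tgt l ∷ W) d (suc g) p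
    gap-forward {W} {d} {g} {l} (mkGap refl i) refl = mkGap refl inside
      where
      inside : ∀ m → m < suc g → tgt (φ^ m (α d)) ∈ tgt l ∷ W
      inside m m<1+g with ℕₚ.m≤n⇒m<n∨m≡n (ℕₚ.≤-pred m<1+g)
      ... | inj₁ m<g  = there (i m m<g)
      ... | inj₂ refl = here refl

    gap-backward : ∀ {W d g e p} → Gap W d g e → src p ∈ W → φ (α p) ≡ α d → Gap W p (suc g) e
    gap-backward {W} {d} {g} {e} {p} (mkGap r i) p∈ eq =
      mkGap (trans (sym (φ^-φ g (α p))) (trans (cong (φ^ g) eq) r)) inside
      where
      inside : ∀ m → m < suc g → tgt (φ^ m (α p)) ∈ W
      inside zero _ = subst (_∈ W) (sym (tgt-α p)) p∈
      inside (suc m) (s≤s lt) = subst (λ z → tgt z ∈ W) (trans (cong (φ^ m) (sym eq)) (φ^-φ m (α p))) (i m lt)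

    gaps-forward : ∀ {W d ds g gs l p} → Gaps W (d ∷ ds) (g ∷ gs) l → φ l ≡ p → Gaps (tgt l ∷ W) (d ∷ ds) (bump (g ∷ gs)) p
    gaps-forward {ds = []} (G ∷ []) eq = gap-forward G eq ∷ []
    gaps-forward {ds = _ ∷ _} (G ∷ Gs@(_ ∷ _)) eq = gap-mono G ∷ gaps-forward Gs eq

    connect : ∀ {W l} → src l ∈ W → (∀ {x y} → x ∈ W → y ∈ W → Reach (_∈ W) x y) →
              ∀ {x y} → x ∈ tgt l ∷ W → y ∈ tgt l ∷ W → Reach (_∈ tgt l ∷ W) x y
    connect {W} {l} l∈ conn = λ x∈ y∈ → reach-trans (to-src x∈) (reach-sym y∈ (to-src y∈))
      where
      to-src : ∀ {x} → x ∈ tgt l ∷ W → Reach (_∈ tgt l ∷ W) x (src l)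
      to-src (here refl) = step (adj-sym (adj-tgt l)) (there l∈) here
      to-src (there x∈) = reach-map {P = _∈ W} {Q = _∈ tgt l ∷ W} there (conn x∈ l∈)

    deg-≥3 : ∀ {x u v w L} → u ≢ v → u ≢ w → v ≢ w → u ∈ L → v ∈ L → w ∈ L → Adj x u → Adj x v → Adj x w → 3 ≤ deg x L
    deg-≥3 {x} {u} {v} {w} u≢v u≢w v≢w u∈ v∈ w∈ xu xv xw =
      let R , p = extract (u ∷ v ∷ w ∷ []) ((u≢v ∷ u≢w ∷ []) ∷ (v≢w ∷ []) ∷ [] ∷ []) (u∈ ∷ v∈ ∷ w∈ ∷ [])
      in subst (3 ≤_) (sym (trans (deg-↭ x p) (cong₂ _+_ (a-adj xu) (cong₂ _+_ (a-adj xv) (cong (_+ deg x R) (a-adj xw)))))) (s≤s (s≤s (s≤s z≤n)))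

    -- A leg `p` at the new vertex takes the place of `d`: the gap after it gains the vertex at its
    -- start, the final gap gains it at its end. With a single leg both happen to the same gap.
    reroute : ∀ {W d ds g gs l p p′} → Gaps W (d ∷ ds) (g ∷ gs) l → φ l ≡ p′ → src p ≡ tgt l → φ (α p) ≡ α d →
              Gaps (tgt l ∷ W) (p ∷ ds) (bump (suc g ∷ gs)) p′
    reroute {ds = []} (G ∷ []) f s b = gap-backward (gap-forward G f) (here s) b ∷ []
    reroute {ds = _ ∷ _} (G ∷ Gs@(_ ∷ _)) f s b = gap-backward (gap-mono G) (here s) b ∷ gaps-forward Gs f

    outer-leg : ∀ {W x e} → src e ≡ x → tgt e ∉ W → Out (x ∷ W) e
    outer-leg {e = e} s t = here s , λ { (here eq) → loopless (src e) (proj₂ e) (trans eq (sym s)) ; (there t∈) → t t∈ }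

    -- Since only one neighbour of the new vertex lies in `W`, its two other darts are legs; they
    -- replace `l`, with the vertex alone between them.
    extend : ∀ {W l ds g gs} → Patch W l ds (g ∷ gs) → deg (tgt l) W ≡ 1 →
             Patch (tgt l ∷ W) (ν (α l)) (ν (ν (α l)) ∷ ds) (1 ∷ bump (suc g ∷ gs))
    extend {W} {l} {ds} {g} {gs} P one = record
      { gaps = mkGap (cong ν (α-involutive p)) (λ { zero _ → here (tgt-α p) ; (suc _) (s≤s ()) })
               ∷ reroute gaps refl refl (trans (cong ν (α-involutive q)) (ν³ (α l)))
      ; out = new-out
      ; complete = λ (s , t) → new-complete s t
      ; distinct = ((λ eq → ν-≢ p (sym eq)) ∷ new-leg refl) ∷ new-leg refl ∷ unique-tail distinct
      ; connected = connect {l = l} (proj₁ (out (here refl))) connected }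
      where
      open Patch P
      x : V
      x = tgt l
      p q : Dart
      p = ν (α l)
      q = ν p
      lone : ∀ {e} → src e ≡ x → e ≢ α l → tgt e ∉ W
      lone {e} s ne t∈ = ℕₚ.<⇒≱ (ℕₚ.≤-refl {2}) (subst (2 ≤_) one
        (deg-≥2 {x} {tgt e} {tgt (α l)} (λ t → ne (dart-≡ s t)) t∈ (subst (_∈ W) (sym (tgt-α l)) (proj₁ (out (here refl))))
                (subst (λ v → Adj v (tgt e)) s (adj-tgt e)) (adj-tgt (α l))))
      new-leg : ∀ {e} → src e ≡ x → All (e ≢_) ds
      new-leg s = All.tabulate (λ f∈ → λ { refl → proj₂ (out (here refl)) (subst (_∈ W) s (proj₁ (out (there f∈)))) })
      new-out : ∀ {e} → e ∈ p ∷ q ∷ ds → Out (x ∷ W) e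
      new-out (here refl) = outer-leg refl (lone refl (ν-≢ (α l)))
      new-out (there (here refl)) = outer-leg refl (lone refl (ν²-≢ (α l)))
      new-out {e} (there (there e∈)) = there (proj₁ (out (there e∈))) ,
        λ { (here eq) → lone {α e} eq (λ e≡ → unique-head distinct e∈ (sym (α-injective e≡))) (subst (_∈ W) (sym (tgt-α e)) (proj₁ (out (there e∈))))
          ; (there t∈) → proj₂ (out (there e∈)) t∈ }
      new-complete : ∀ {e} → src e ∈ x ∷ W → tgt e ∉ x ∷ W → e ∈ p ∷ q ∷ ds
      new-complete {e} (there s∈) t∉ = go (complete (s∈ , λ t∈ → t∉ (there t∈)))
        where
        go : e ∈ l ∷ ds → e ∈ p ∷ q ∷ ds
        go (here refl) = contradiction (here refl) t∉
        go (there e∈)  = there (there e∈)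
      new-complete {e} (here s) t∉ = go (three-darts (α l) e s)
        where
        go : (e ≡ α l) ⊎ (e ≡ p) ⊎ (e ≡ q) → e ∈ p ∷ q ∷ ds
        go (inj₁ refl)        = contradiction (there (subst (_∈ W) (sym (tgt-α l)) (proj₁ (out (here refl))))) t∉
        go (inj₂ (inj₁ refl)) = here refl
        go (inj₂ (inj₂ refl)) = there (here refl)

    -- `φ d ≡ α l` says that the face between the legs `l` and `d` is completed by the new vertex.
    -- Its third dart replaces both legs.
    close : ∀ {W l d ds g g′ gs} → Patch W l (d ∷ ds) (g ∷ g′ ∷ gs) → tgt d ≡ tgt l → φ d ≡ α l → deg (tgt l) W ≡ 2 →
            Patch (tgt l ∷ W) (ν (α l)) ds (bump (suc g′ ∷ gs))
    close {W} {l} {d} {ds} {g} {g′} {gs} P t≡ φd two = record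
      { gaps = new-gaps gaps
      ; out = new-out
      ; complete = λ (s , t) → new-complete s t
      ; distinct = new-leg ∷ unique-tail (unique-tail distinct)
      ; connected = connect {l = l} (proj₁ (out (here refl))) connected }
      where
      open Patch P
      x : V
      x = tgt l
      p : Dart
      p = ν (α l)
      νp : ν p ≡ α d
      νp = trans (cong (ν ∘ ν) (sym φd)) (ν³ (α d))
      new-gaps : Gaps W (l ∷ d ∷ ds) (g ∷ g′ ∷ gs) l → Gaps (x ∷ W) (p ∷ ds) (bump (suc g′ ∷ gs)) p
      new-gaps (_ ∷ Gs) = reroute Gs refl refl (trans (cong ν (α-involutive p)) νp)
      l≢d : l ≢ d
      l≢d eq = unique-disjoint {xs = l ∷ []} distinct (here refl) (here eq)
      lone : ∀ {e} → src e ≡ x → e ≢ α l → e ≢ α d → tgt e ∉ W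
      lone {e} s ne ne′ t∈ = ℕₚ.<⇒≱ (ℕₚ.≤-refl {3}) (subst (3 ≤_) two
        (deg-≥3 {x} {tgt e} {tgt (α l)} {tgt (α d)} (λ t → ne (dart-≡ s t)) (λ t → ne′ (dart-≡ (trans s (sym t≡)) t))
                (λ t → l≢d (α-injective (dart-≡ (sym t≡) t))) t∈
                (subst (_∈ W) (sym (tgt-α l)) (proj₁ (out (here refl)))) (subst (_∈ W) (sym (tgt-α d)) (proj₁ (out (there (here refl)))))
                (subst (λ v → Adj v (tgt e)) s (adj-tgt e)) (adj-tgt (α l)) (subst (λ v → Adj v (tgt (α d))) t≡ (adj-tgt (α d)))))
      new-leg : All (p ≢_) ds
      new-leg = All.tabulate (λ f∈ → λ { refl → proj₂ (out (here refl)) (proj₁ (out (there (there f∈)))) })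
      new-out : ∀ {e} → e ∈ p ∷ ds → Out (x ∷ W) e
      new-out (here refl) = outer-leg refl (lone refl (ν-≢ (α l)) (λ eq → ν-≢ p (trans νp (sym eq))))
      new-out {e} (there e∈) = there (proj₁ (out (there (there e∈)))) ,
        λ { (here eq) → lone {α e} eq (λ e≡ → unique-disjoint {xs = l ∷ []} distinct (here (α-injective e≡)) (there e∈))
                                      (λ e≡ → unique-disjoint {xs = d ∷ []} (unique-tail distinct) (here (α-injective e≡)) e∈)
                                      (subst (_∈ W) (sym (tgt-α e)) (proj₁ (out (there (there e∈)))))
          ; (there t∈) → proj₂ (out (there (there e∈))) t∈ }
      new-complete : ∀ {e} → src e ∈ x ∷ W → tgt e ∉ x ∷ W → e ∈ p ∷ ds
      new-complete {e} (there s∈) t∉ = go (complete (s∈ , λ t∈ → t∉ (there t∈)))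
        where
        go : e ∈ l ∷ d ∷ ds → e ∈ p ∷ ds
        go (here refl)         = contradiction (here refl) t∉
        go (there (here refl)) = contradiction (here t≡) t∉
        go (there (there e∈))  = there e∈
      new-complete {e} (here s) t∉ = go (three-darts (α l) e s)
        where
        go : (e ≡ α l) ⊎ (e ≡ p) ⊎ (e ≡ ν p) → e ∈ p ∷ ds
        go (inj₁ refl)        = contradiction (there (subst (_∈ W) (sym (tgt-α l)) (proj₁ (out (here refl))))) t∉
        go (inj₂ (inj₁ refl)) = here refl
        go (inj₂ (inj₂ e≡))   = contradiction (there (subst (_∈ W) (sym (trans (cong tgt (trans e≡ νp)) (tgt-α d))) (proj₁ (out (there (here refl)))))) t∉

    -- `at` keeps the new leg attached to `x`: when `x` is a leaf of the complement, this leg must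
    -- lead to its mate.
    record Closing (W : List V) (x : V) (w : List ℕ) : Set where
      field
        {g g′} : ℕ
        {gs}   : List ℕ
        rotation : Rotation w (g ∷ g′ ∷ gs)
        size   : g ≡ 4 ⊎ g ≡ 5
        {leg}  : Dart
        {legs} : List Dart
        at     : src leg ≡ x
        patch  : Patch (x ∷ W) leg legs (bump (suc g′ ∷ gs))

    -- Of the two darts from `x` into `W`, one follows the other in the rotation at `x`, so a single
    -- face step leads from one leg to the reverse of the other. By `crossing` the legs are
    -- consecutive.
    closing : ∀ {W d ds w x} → Patch W d ds w → (∀ {y z} → y ∉ W → z ∉ W → Reach (_∉ W) y z) →
              x ∉ W → Unique W → deg x W ≡ 2 → Closing W x w
    closing {W} {d₀} {ds₀} {w} {x} P outside x∉ uniq two =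
      let y , z , y∈ , z∈ , y≢z , xy , xz = deg-pair {x} W two uniq in both (adj-sym xy) (adj-sym xz) y∈ z∈ y≢z
      where
      finish : ∀ {l d} us {w′} → l ∈ d₀ ∷ ds₀ → Rotation w w′ → Patch W l (d ∷ us) w′ → tgt l ≡ x → tgt d ≡ x → φ d ≡ α l → Closing W x w
      finish us {[]} _ _ Q _ _ _ = case Patch.gaps Q of λ ()
      finish us {_ ∷ []} _ _ Q _ _ _ = case Patch.gaps Q of λ { (_ ∷ ()) }
      finish {l} {d} us {g ∷ g′ ∷ gs} _ r Q refl td φd = record
        { rotation = r ; size = gap-closes (first (Patch.gaps Q)) (Patch.out Q (there (here refl))) φd
        ; at = refl ; patch = close Q td φd two }
        where
        first : Gaps W (l ∷ d ∷ us) (g ∷ g′ ∷ gs) l → Gap W l g d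
        first (G ∷ _) = G
      consecutive : ∀ {l d} → l ∈ d₀ ∷ ds₀ → d ∈ d₀ ∷ ds₀ → l ≢ d → tgt l ≡ x → tgt d ≡ x → φ d ≡ α l → Closing W x w
      consecutive {l} {d} l∈ d∈ l≢d tl td φd with rotate-to P d∈
      ... | ds , w′ , r , Q with Crossing.crossing Q outside 1 (other (Patch.complete Q (Patch.out P l∈))) φd
        where
        other : l ∈ d ∷ ds → l ∈ ds
        other (here eq)  = contradiction eq l≢d
        other (there l∈) = l∈
      ...   | us , refl = let w″ , r′ , Q′ = rotate-at us {[]} Q in finish us l∈ (rotation-trans r r′) Q′ tl td φd
      both : ∀ {y z} → Adj y x → Adj z x → y ∈ W → z ∈ W → y ≢ z → Closing W x w
      both {y} {z} yx zx y∈ z∈ y≢z = go (three-darts (α d₁) (α d₂) (trans (dart-tgt zx) (sym (dart-tgt yx))))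
        where
        d₁ d₂ : Dart
        d₁ = dart yx
        d₂ = dart zx
        leg : ∀ {y} (p : Adj y x) → y ∈ W → dart p ∈ d₀ ∷ ds₀
        leg p y∈ = Patch.complete P (y∈ , subst (_∉ W) (sym (dart-tgt p)) x∉)
        d₁≢d₂ : d₁ ≢ d₂
        d₁≢d₂ eq = y≢z (cong src eq)
        go : (α d₂ ≡ α d₁) ⊎ (α d₂ ≡ φ d₁) ⊎ (α d₂ ≡ ν (φ d₁)) → Closing W x w
        go (inj₁ eq) = contradiction (sym (α-injective eq)) d₁≢d₂
        go (inj₂ (inj₁ eq)) = consecutive (leg zx z∈) (leg yx y∈) (≢-sym d₁≢d₂) (dart-tgt zx) (dart-tgt yx) (sym eq)
        go (inj₂ (inj₂ eq)) = consecutive (leg yx y∈) (leg zx z∈) d₁≢d₂ (dart-tgt yx) (dart-tgt zx) (trans (cong ν eq) (ν³ (α d₁)))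

  -- The faces around a patch, read from the complement.

  module Trails where

    open Faces
    open Patches

    -- Counterpart of `Gaps`: the face left along `l′` returns along `α l` after `h` steps. The
    -- bound 4 keeps a gap plus `h` at most 9, as `face-total` demands.
    data Trail (W : List V) : Dart → List ℕ → Set where
      stop : ∀ {l} → Trail W l []
      turn : ∀ {l l′ hs} h → h ≤ 4 → Out W l′ → l′ ≢ l → φ^ h l′ ≡ α l → Trail W l′ hs → Trail W l (h ∷ hs)

    last-unique : ∀ {l : Dart} vs us us′ → Unique (vs ++ l ∷ us) → vs ++ l ∷ us ≡ us′ ++ [ l ] → us ≡ []
    last-unique vs [] us′ _ _ = refl
    last-unique [] (u ∷ us) [] _ ()
    last-unique {l} [] (u ∷ us) (v ∷ us′) (l∉ ∷ _) eq =
      contradiction refl (All.lookup l∉ (subst (l ∈_) (sym (Listₚ.∷-injectiveʳ eq)) (∈ₚ.∈-++⁺ʳ us′ (here refl))))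
    last-unique (v ∷ vs) (u ∷ us) [] (v∉ ∷ _) eq = contradiction (Listₚ.∷-injectiveʳ eq) (nonempty vs)
      where
      nonempty : ∀ {l : Dart} vs {us} → vs ++ l ∷ us ≢ []
      nonempty [] ()
      nonempty (_ ∷ _) ()
    last-unique (v ∷ vs) (u ∷ us) (_ ∷ us′) (_ ∷ uniq) eq = last-unique vs (u ∷ us) us′ uniq (Listₚ.∷-injectiveʳ eq)

    -- Seen from `l′`, `crossing` makes `l` its predecessor, so `l′` is the first leg after `l`.
    next-leg : ∀ {W l ds w l′} h → Patch W l ds w → (∀ {y z} → y ∉ W → z ∉ W → Reach (_∉ W) y z) →
               Out W l′ → l′ ≢ l → φ^ h l′ ≡ α l → ∃[ ds′ ] ds ≡ l′ ∷ ds′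
    next-leg {W} {l} {ds} {w} {l′} h P outside o l′≢l eq with Patch.complete P o
    ... | here e = contradiction e l′≢l
    ... | there l′∈ with ∈ₚ.∈-∃++ l′∈
    ...   | us , vs , refl = finish (rotate-at us P)
      where
      finish : ∃[ w′ ] Rotation w w′ × Patch W l′ (vs ++ l ∷ us) w′ → ∃[ ds′ ] us ++ l′ ∷ vs ≡ l′ ∷ ds′
      finish (w′ , _ , Q) = vs , cong (_++ l′ ∷ vs) us≡[]
        where
        us≡[] : us ≡ []
        us≡[] = let us′ , e = Crossing.crossing Q outside h (∈ₚ.∈-++⁺ʳ vs (here refl)) eq
                in last-unique vs us us′ (unique-++ʳ [ l′ ] (Patch.distinct Q)) e

    -- A return time at most 9 is less than twice the face size, so only one turn around the face
    -- fits in.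
    face-total : ∀ {k d} → φ^ k d ≡ d → 0 < k → k ≤ 9 → k ≡ 5 ⊎ k ≡ 6
    face-total {k} {d} closed 0<k k≤9 = go (face-length d)
      where
      five-or-six : ∀ {f} → 5 ≤ f → f ≤ 6 → f ≡ 5 ⊎ f ≡ 6
      five-or-six 5≤f f≤6 with ℕₚ.m≤n⇒m<n∨m≡n 5≤f
      ... | inj₁ 5<f  = inj₂ (ℕₚ.≤-antisym f≤6 5<f)
      ... | inj₂ refl = inj₁ refl
      go : ∃[ f ] 5 ≤ f × f ≤ 6 × φ^ f d ≡ d × (∀ m → 0 < m → m < f → φ^ m d ≢ d) → k ≡ 5 ⊎ k ≡ 6
      go (f , 5≤f , f≤6 , closed′ , least) = subst (λ k → k ≡ 5 ⊎ k ≡ 6) (sym k≡f) (five-or-six 5≤f f≤6)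
        where
        f≤k : f ≤ k
        f≤k = ℕₚ.≮⇒≥ (λ k<f → least k 0<k k<f closed)
        k<f+f : k < f + f
        k<f+f = ℕₚ.≤-trans (s≤s k≤9) (ℕₚ.+-mono-≤ 5≤f 5≤f)
        rest : φ^ (k ∸ f) d ≡ d
        rest = trans (cong (φ^ (k ∸ f)) (sym closed′)) (trans (sym (φ^-+ (k ∸ f) f d)) (trans (cong (λ j → φ^ j d) (ℕₚ.m∸n+n≡m f≤k)) closed))
        k≡f : k ≡ f
        k≡f with ℕₚ.m≤n⇒m<n∨m≡n f≤k
        ... | inj₂ f≡k = sym f≡k
        ... | inj₁ f<k = contradiction rest (least (k ∸ f) (ℕₚ.m<n⇒0<n∸m f<k)
                           (ℕₚ.+-cancelʳ-< f (k ∸ f) f (subst (_< f + f) (sym (ℕₚ.m∸n+n≡m f≤k)) k<f+f)))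

    -- The gap from `l` to `l′` and the `h` steps back make one full turn around a face.
    follow : ∀ {W l ds w hs} → Patch W l ds w → (∀ {y z} → y ∉ W → z ∉ W → Reach (_∉ W) y z) → Trail W l hs → Follows hs w
    follow P outside stop = tt
    follow {w = []} P outside (turn _ _ _ _ _ _) = case Patch.gaps P of λ ()
    follow {W} {l} {ds} {g ∷ w} P outside (turn {l′ = l′} h h≤4 o ne eq t) with next-leg h P outside o ne eq
    ... | ds′ , refl = face-total closed (positive G) (ℕₚ.+-mono-≤ (gap-≤5 G o) h≤4) , follow (rotate P) outside t
      where
      G : Gap W l g l′
      G = first (Patch.gaps P)
        where
        first : Gaps W (l ∷ l′ ∷ ds′) (g ∷ w) l → Gap W l g l′
        first (G ∷ _) = G
      positive : ∀ {g} → Gap W l g l′ → 0 < g + h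
      positive {suc g} _ = s≤s z≤n
      positive {zero} (mkGap refl _) = contradiction (subst (_∉ W) (tgt-α l) (proj₂ o)) (λ ∉W → ∉W (proj₁ (Patch.out P (here refl))))
      closed : φ^ (g + h) (α l) ≡ α l
      closed = trans (cong (λ k → φ^ k (α l)) (ℕₚ.+-comm g h)) (trans (φ^-+ h g (α l)) (trans (cong (φ^ h) (Gap.reaches G)) eq))

  -- The tree on six vertices from which the search starts.

  module Spider where

    open Cuts renaming (a to adjacency)
    open Patches
    open PatchMoves
    open ShortCycles

    seed : ∀ d → Patch (src d ∷ []) d (ν d ∷ ν (ν d) ∷ []) (1 ∷ 1 ∷ 1 ∷ [])
    seed d = record
      { gaps = gap d (ν d) refl ∷ gap (ν d) (ν (ν d)) refl ∷ gap (ν (ν d)) d (ν³ d) ∷ []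
      ; out = λ { (here refl) → out d refl ; (there (here refl)) → out (ν d) refl ; (there (there (here refl))) → out (ν (ν d)) refl }
      ; complete = λ { {e} (here s , _) → member e (three-darts d e s) }
      ; distinct = ((λ e → ν-≢ d (sym e)) ∷ (λ e → ν²-≢ d (sym e)) ∷ []) ∷ ((λ e → ν-≢ (ν d) (sym e)) ∷ []) ∷ [] ∷ []
      ; connected = λ { (here refl) (here refl) → here } }
      where
      gap : ∀ e e′ → ν e ≡ e′ → Gap (src e ∷ []) e 1 e′
      gap e e′ refl = mkGap (cong ν (α-involutive e)) (λ { zero _ → here (tgt-α e) ; (suc _) (s≤s ()) })
      out : ∀ e {v} → src e ≡ v → Out (v ∷ []) e
      out e refl = here refl , λ { (here eq) → loopless (src e) (proj₂ e) eq }
      member : ∀ e → (e ≡ d) ⊎ (e ≡ ν d) ⊎ (e ≡ ν (ν d)) → e ∈ d ∷ ν d ∷ ν (ν d) ∷ []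
      member e (inj₁ p)        = here p
      member e (inj₂ (inj₁ p)) = there (here p)
      member e (inj₂ (inj₂ p)) = there (there (here p))

    data One (u : V) : List V → Set where
      hit  : ∀ {v L} → Adj u v → All (λ w → ¬ Adj u w) L → One u (v ∷ L)
      miss : ∀ {v L} → ¬ Adj u v → One u L → One u (v ∷ L)

    one-deg : ∀ {u L} → One u L → deg u L ≡ 1
    one-deg {u} (hit {L = L} uv others) = cong₂ _+_ (a-adj uv) (deg-none u L (All.lookup others))
    one-deg (miss ¬uv one) = cong₂ _+_ (a-nonadj ¬uv) (one-deg one)

    -- In `safe₆` the second 6 is the number of vertices of the tree; the first is a number of
    -- rounds sufficient for each of its possible words.
    record SafePatch (W : List V) : Set where
      constructor mkSafe
      field
        {leg}  : Dart
        {legs} : List Dart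
        {word} : List ℕ
        safe₆  : safe 6 6 word ≡ true
        patch  : Patch W leg legs word

    -- The tree arises from the one-vertex patch by five extensions. Its word depends only on which
    -- of the two free legs at `x` leads to `x′`, and likewise at `y`: four words in all.
    spider : ∀ d {x′ y′} (xx : Adj (tgt (ν d)) x′) (yy : Adj (tgt (ν (ν d))) y′) →
             let a = src d ; b = tgt d ; x = tgt (ν d) ; y = tgt (ν (ν d)) in
             One b (a ∷ []) → One x (b ∷ a ∷ []) → One y (x ∷ b ∷ a ∷ []) →
             One x′ (y ∷ x ∷ b ∷ a ∷ []) → One y′ (x′ ∷ y ∷ x ∷ b ∷ a ∷ []) →
             x′ ∉ y ∷ x ∷ b ∷ a ∷ [] → y′ ∉ x′ ∷ y ∷ x ∷ b ∷ a ∷ [] → x ≢ y → b ≢ x → b ≢ y →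
             SafePatch (y′ ∷ x′ ∷ y ∷ x ∷ b ∷ a ∷ [])
    spider d {x′} {y′} xx yy db dx dy dx′ dy′ x′∉ y′∉ x≢y b≢x b≢y =
      subst₂ (λ x y → SafePatch (y ∷ x ∷ W₄)) (dart-tgt xx) (dart-tgt yy) (at-x (Patch.complete P₄ (there (here refl) , subst (_∉ W₄) (sym (dart-tgt xx)) x′∉)))
      where
      b x y a : V
      a = src d
      b = tgt d
      x = tgt (ν d)
      y = tgt (ν (ν d))
      W₄ W₅ : List V
      W₄ = y ∷ x ∷ b ∷ a ∷ []
      eˣ eʸ : Dart
      eˣ = dart xx
      eʸ = dart yy
      W₅ = tgt eˣ ∷ W₄
      P₂ : Patch (b ∷ a ∷ []) (ν d) (ν (ν d) ∷ ν (α d) ∷ ν (ν (α d)) ∷ []) (1 ∷ 2 ∷ 1 ∷ 2 ∷ [])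
      P₂ = rotate (rotate (extend (seed d) (one-deg db)))
      P₃ : Patch (x ∷ b ∷ a ∷ []) (ν (ν d)) (ν (α d) ∷ ν (ν (α d)) ∷ ν (α (ν d)) ∷ ν (ν (α (ν d))) ∷ []) (2 ∷ 1 ∷ 3 ∷ 1 ∷ 2 ∷ [])
      P₃ = rotate (rotate (extend P₂ (one-deg dx)))
      P₄ : Patch W₄ (ν (α (ν (ν d)))) (ν (ν (α (ν (ν d)))) ∷ ν (α d) ∷ ν (ν (α d)) ∷ ν (α (ν d)) ∷ ν (ν (α (ν d))) ∷ []) (1 ∷ 3 ∷ 1 ∷ 3 ∷ 1 ∷ 3 ∷ [])
      P₄ = extend P₃ (one-deg dy)
      one-x : deg (tgt eˣ) W₄ ≡ 1
      one-x = trans (cong (λ v → deg v W₄) (dart-tgt xx)) (one-deg dx′)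
      one-y : deg (tgt eʸ) W₅ ≡ 1
      one-y = trans (cong₂ (λ v w → deg v (w ∷ W₄)) (dart-tgt yy) (dart-tgt xx)) (one-deg dy′)
      out-y : Out W₅ eʸ
      out-y = there (here refl) , subst₂ (λ v w → v ∉ w ∷ W₄) (sym (dart-tgt yy)) (sym (dart-tgt xx)) y′∉
      y≢x′ : y ≢ tgt eˣ
      y≢x′ eq = x′∉ (here (trans (sym (dart-tgt xx)) (sym eq)))
      Goal : Set
      Goal = SafePatch (tgt eʸ ∷ W₅)
      not-leg : ∀ {e e′ : Dart} → e ≡ e′ → src e ≢ src e′ → Goal
      not-leg eq ne = contradiction (cong src eq) ne
      at-y₁ : (∀ {l ds g gs} → Patch W₅ l ds (g ∷ gs) → eʸ ≡ l → safe 6 6 (extendWord (g ∷ gs)) ≡ true → Goal)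
      at-y₁ Q refl s = mkSafe s (extend Q one-y)
      after-x₁ : ∀ {p q r} → Patch W₅ p (q ∷ r ∷ ν (α (ν (ν d))) ∷ ν (ν (α (ν (ν d)))) ∷ ν (α d) ∷ ν (ν (α d)) ∷ []) (1 ∷ 2 ∷ 3 ∷ 1 ∷ 3 ∷ 1 ∷ 4 ∷ []) →
                 src p ≡ tgt eˣ → src q ≡ tgt eˣ → src r ≡ x → Goal
      after-x₁ Q sp sq sr with Patch.complete Q out-y
      ... | here eq = not-leg eq (λ e → y≢x′ (trans e sp))
      ... | there (here eq) = not-leg eq (λ e → y≢x′ (trans e sq))
      ... | there (there (here eq)) = not-leg eq (λ e → x≢y (sym (trans e sr)))
      -- The last `refl` evaluates the whole search from this word; the same holds in the three
      -- sibling cases.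
      ... | there (there (there (here eq))) = at-y₁ (rotate (rotate (rotate Q))) eq refl
      ... | there (there (there (there (here eq)))) = at-y₁ (rotate (rotate (rotate (rotate Q)))) eq refl
      ... | there (there (there (there (there (here eq))))) = not-leg eq (λ e → b≢y (sym e))
      ... | there (there (there (there (there (there (here eq)))))) = not-leg eq (λ e → b≢y (sym e))
      after-x₂ : ∀ {p q r} → Patch W₅ p (q ∷ ν (α (ν (ν d))) ∷ ν (ν (α (ν (ν d)))) ∷ ν (α d) ∷ ν (ν (α d)) ∷ r ∷ []) (1 ∷ 4 ∷ 1 ∷ 3 ∷ 1 ∷ 3 ∷ 2 ∷ []) →
                 src p ≡ tgt eˣ → src q ≡ tgt eˣ → src r ≡ x → Goal
      after-x₂ Q sp sq sr with Patch.complete Q out-y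
      ... | here eq = not-leg eq (λ e → y≢x′ (trans e sp))
      ... | there (here eq) = not-leg eq (λ e → y≢x′ (trans e sq))
      ... | there (there (here eq)) = at-y₁ (rotate (rotate Q)) eq refl
      ... | there (there (there (here eq))) = at-y₁ (rotate (rotate (rotate Q))) eq refl
      ... | there (there (there (there (here eq)))) = not-leg eq (λ e → b≢y (sym e))
      ... | there (there (there (there (there (here eq))))) = not-leg eq (λ e → b≢y (sym e))
      ... | there (there (there (there (there (there (here eq)))))) = not-leg eq (λ e → x≢y (sym (trans e sr)))
      extend-at : ∀ {l ds g gs} → eˣ ≡ l → Patch W₄ l ds (g ∷ gs) → Patch W₅ (ν (α eˣ)) (ν (ν (α eˣ)) ∷ ds) (1 ∷ bump (suc g ∷ gs))
      extend-at refl Q = extend Q one-x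
      at-x : eˣ ∈ _ → Goal
      at-x (here eq) = not-leg eq x≢y
      at-x (there (here eq)) = not-leg eq x≢y
      at-x (there (there (here eq))) = not-leg eq (λ e → b≢x (sym e))
      at-x (there (there (there (here eq)))) = not-leg eq (λ e → b≢x (sym e))
      at-x (there (there (there (there (here eq))))) = after-x₁ (extend-at eq (rotate (rotate (rotate (rotate P₄))))) refl refl refl
      at-x (there (there (there (there (there (here eq)))))) = after-x₂ (extend-at eq (rotate (rotate (rotate (rotate (rotate P₄)))))) refl refl refl

  module WithMatching (M : PerfectMatching F) where
    open ↭Solver {A = V} using (solve; _⊜_; _⊕_)

    -- Kotzig's theorem by a search with blossoms.

    module Matchings where

      open Cuts

      μ : V → V
      μ = partner M

      μ-adj : ∀ v → Adj v (μ v)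
      μ-adj = adj M

      μμ : ∀ v → μ (μ v) ≡ v
      μμ = involutive M

      data PM : List V → Set where
        none : PM []
        pair : ∀ {L R u v} → Adj u v → PM R → L ↭ u ∷ v ∷ R → PM L

      -- The part of the given matching `M` on a set, whereas `PM` is any perfect matching of it.
      data MPM : List V → Set where
        none : MPM []
        pair : ∀ {L R} u → MPM R → L ↭ u ∷ μ u ∷ R → MPM L

      pm-↭ : ∀ {L L′} → L ↭ L′ → PM L → PM L′
      pm-↭ p none rewrite ↭ₚ.↭-empty-inv (↭-sym p) = none
      pm-↭ p (pair uv m q) = pair uv m (↭-trans (↭-sym p) q)

      pm-++ : ∀ {A B} → PM A → PM B → PM (A ++ B)
      pm-++ none m = m
      pm-++ {B = B} (pair uv m p) m′ = pair uv (pm-++ m m′) (↭ₚ.++⁺ʳ B p)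

      mpm-++ : ∀ {A B} → MPM A → MPM B → MPM (A ++ B)
      mpm-++ none m = m
      mpm-++ {B = B} (pair u m p) m′ = pair u (mpm-++ m m′) (↭ₚ.++⁺ʳ B p)

      mpm⇒pm : ∀ {A} → MPM A → PM A
      mpm⇒pm none = none
      mpm⇒pm (pair u m p) = pair (μ-adj u) (mpm⇒pm m) p

      Closed : List V → Set
      Closed A = ∀ {x} → x ∈ A → μ x ∈ A

      mpm⇒closed : ∀ {A} → MPM A → Closed A
      mpm⇒closed {A} (pair {R = R} u m p) x∈A = ↭ₚ.∈-resp-↭ (↭-sym p) (go (↭ₚ.∈-resp-↭ p x∈A))
        where
        go : ∀ {x} → x ∈ u ∷ μ u ∷ R → μ x ∈ u ∷ μ u ∷ R
        go (here refl)         = there (here refl)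
        go (there (here refl)) = here (μμ u)
        go (there (there q))   = there (there (mpm⇒closed m q))

      closed-pull : ∀ {A u} → Unique A → Closed A → u ∈ A → ∃[ R ] A ↭ u ∷ μ u ∷ R × Closed R
      closed-pull {A} {u} uniq cl u∈A with extract (u ∷ μ u ∷ []) ((adj-irrefl (μ-adj u) ∷ []) ∷ [] ∷ []) (u∈A ∷ cl u∈A ∷ [])
      ... | R , p = R , p , closed
        where
        uniq′ : Unique (u ∷ μ u ∷ R)
        uniq′ = unique-resp-↭ p uniq
        closed : Closed R
        closed {x} x∈R with ↭ₚ.∈-resp-↭ p (cl (↭ₚ.∈-resp-↭ (↭-sym p) (there (there x∈R))))
        ... | here eq = contradiction x∈R
              (unique-disjoint {xs = u ∷ μ u ∷ []} uniq′ (there (here (trans (sym (μμ x)) (cong μ eq)))))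
        ... | there (here eq) = contradiction x∈R
              (unique-disjoint {xs = u ∷ μ u ∷ []} uniq′ (here (trans (sym (μμ x)) (trans (cong μ eq) (μμ u)))))
        ... | there (there q) = q

      closed⇒mpm : ∀ k {A} → length A ≤ k → Unique A → Closed A → MPM A
      closed⇒mpm k {[]} _ _ _ = none
      closed⇒mpm (suc k) {x ∷ A} len uniq cl with closed-pull uniq cl (here refl)
      ... | R , p , cl′ = pair x (closed⇒mpm k len′ (unique-++ʳ (x ∷ μ x ∷ []) (unique-resp-↭ p uniq)) cl′) p
        where
        len′ : length R ≤ k
        len′ = ℕₚ.≤-pred (ℕₚ.≤-trans (ℕₚ.n≤1+n _) (subst (_≤ suc k) (↭ₚ.↭-length p) len))

      mpm-pull : ∀ {A u} → Unique A → MPM A → u ∈ A → ∃[ R ] A ↭ u ∷ μ u ∷ R × MPM R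
      mpm-pull {u = u} uniq m u∈A with closed-pull uniq (mpm⇒closed m) u∈A
      ... | R , p , cl = R , p , closed⇒mpm (length R) ℕₚ.≤-refl (unique-++ʳ (u ∷ μ u ∷ []) (unique-resp-↭ p uniq)) cl

      -- Uniqueness edge by edge: an edge that extends to a perfect matching of `L` belongs to `M`.
      UPM : List V → Set
      UPM L = ∀ {u v R} → Adj u v → L ↭ u ∷ v ∷ R → PM R → μ u ≡ v

      upm-↭ : ∀ {L L′} → L ↭ L′ → UPM L → UPM L′
      upm-↭ p unq uv q = unq uv (↭-trans p q)

      -- A matching of `A` is completed by `M` on `B`.
      upm-sub : ∀ {A B} → MPM B → UPM (A ++ B) → UPM A
      upm-sub {B = B} m unq uv p pm = unq uv (↭ₚ.++⁺ʳ B p) (pm-++ pm (mpm⇒pm m))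

      -- As `root` and its mate are adjacent, their edge is the single one that crosses. Both sides
      -- are odd, being matched by `M` except for these ends.
      record Bridge (L : List V) : Set where
        field
          root  : V
          rest  : List V
          other : List V
          split : L ↭ (root ∷ rest) ++ (μ root ∷ other)
          rest-mpm  : MPM rest
          other-mpm : MPM other
          single : cross (root ∷ rest) (μ root ∷ other) ≡ 1

      FactorCritical : List V → Set
      FactorCritical Z = ∀ {z Q} → Z ↭ z ∷ Q → PM Q

      -- A blossom chain that grew out of the blossom with base z₀ and stops at an edge xt to an older vertex.
      -- A vertex of the chain can be left exposed either directly, or after turning the chain so that
      -- z₀ and x are exposed as well (this happens for the stem vertices between the blossoms).
      record Exit (z₀ : V) (Z R Old : List V) : Set where
        field
          E R′ : List V
          x t  : V
          grown : Z ++ R ↭ E ++ R′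
          E-mpm  : MPM E
          R′-mpm : MPM R′
          x∈   : x ∈ z₀ ∷ E
          t∈   : t ∈ Old
          xt   : Adj x t
          at-x : ∀ {Q} → z₀ ∷ E ↭ x ∷ Q → PM Q
          at   : ∀ {z Q} → z₀ ∷ E ↭ z ∷ Q → PM Q ⊎ (∃[ Q′ ] Q ↭ z₀ ∷ x ∷ Q′ × PM Q′)

      fc-pm : ∀ {Z x} → FactorCritical Z → x ∈ Z → ∃[ Q ] Z ↭ x ∷ Q × PM Q
      fc-pm fc x∈ with pull-out x∈
      ... | Q , p = Q , p , fc p

      module Search {L : List V} (L-unique : Unique L) (L-upm : UPM L) where

        -- z₀ and y₀ are matched; y₀ is visited before the blossom Z = z₀ ∷ Z₀.
        explore : ∀ k y₀ z₀ Z₀ R Old → length R ≤ k → μ z₀ ≡ y₀ → L ↭ (z₀ ∷ Z₀) ++ y₀ ∷ R ++ Old →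
                  FactorCritical (z₀ ∷ Z₀) → MPM Z₀ → MPM R → MPM Old →
                  Bridge L ⊎ Exit z₀ Z₀ R Old
        -- The edge reaches an unvisited `t`, and the mate of `t` becomes the base of a new blossom.
        -- If its search exits, the exit leads to `y₀` (a second matching), into the present blossom
        -- (which grows), or to an older vertex (the chain is passed on). `R` loses `t` and its
        -- mate, so `k` decreases.
        grow : ∀ k y₀ z₀ Z₀ R Old → length R ≤ k → μ z₀ ≡ y₀ → L ↭ (z₀ ∷ Z₀) ++ y₀ ∷ R ++ Old →
               FactorCritical (z₀ ∷ Z₀) → MPM Z₀ → MPM R → MPM Old →
               ∀ x t → x ∈ z₀ ∷ Z₀ → t ∈ R → Adj x t → Bridge L ⊎ Exit z₀ Z₀ R Old

        leave : ∀ k y₀ z₀ Z₀ R Old → length R ≤ k → μ z₀ ≡ y₀ → L ↭ (z₀ ∷ Z₀) ++ y₀ ∷ R ++ Old →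
                FactorCritical (z₀ ∷ Z₀) → MPM Z₀ → MPM R → MPM Old →
                ∀ x t → x ∈ z₀ ∷ Z₀ → t ∈ R ++ Old → Adj x t → Bridge L ⊎ Exit z₀ Z₀ R Old
        leave k y₀ z₀ Z₀ R Old len μz Leq fc mZ mR mO x t x∈ t∈ xt with ∈ₚ.∈-++⁻ R t∈
        ... | inj₁ t∈R = grow k y₀ z₀ Z₀ R Old len μz Leq fc mZ mR mO x t x∈ t∈R xt
        ... | inj₂ t∈O = inj₂ (record
          { E = Z₀ ; R′ = R ; x = x ; t = t ; grown = ↭-refl ; E-mpm = mZ ; R′-mpm = mR ; x∈ = x∈ ; t∈ = t∈O ; xt = xt
          ; at-x = fc ; at = λ p → inj₁ (fc p) })

        explore k y₀ z₀ Z₀ R Old len refl Leq fc mZ mR mO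
          with Any.any? (adj? z₀) (R ++ Old) | Any.any? (λ x → Any.any? (adj? x) (y₀ ∷ R ++ Old)) Z₀
        ... | yes found | _ with find found
        ...   | t , t∈ , xt = leave k y₀ z₀ Z₀ R Old len refl Leq fc mZ mR mO z₀ t (here refl) t∈ xt
        explore k y₀ z₀ Z₀ R Old len refl Leq fc mZ mR mO
            | no _ | yes found with find found
        ... | x , x∈ , found′ with find found′
        ...   | t , there t∈ , xt = leave k y₀ z₀ Z₀ R Old len refl Leq fc mZ mR mO x t (there x∈) t∈ xt
        -- Matching `x` with `y₀` and the rest of the blossom within itself gives a perfect matching
        -- other than `M`.
        ...   | .y₀ , here refl , xt with fc-pm fc (there x∈)
        ...     | Q , p , pm = contradiction x∈ (subst (_∉ Z₀) (trans (sym (μμ z₀)) μy≡x) z₀∉)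
          where
          z₀∉ : z₀ ∉ Z₀
          z₀∉ z∈ = unique-head (unique-resp-↭ Leq L-unique) (∈ₚ.∈-++⁺ˡ z∈) refl
          μy≡x : μ y₀ ≡ x
          μy≡x = L-upm (adj-sym xt)
            (↭-trans Leq (↭-trans (↭ₚ.++⁺ʳ (y₀ ∷ R ++ Old) p)
              (solve 4 (λ x Q y R → (x ⊕ Q) ⊕ (y ⊕ R) ⊜ y ⊕ (x ⊕ (Q ⊕ R))) ↭-refl [ x ] Q [ y₀ ] (R ++ Old))))
            (pm-++ pm (pm-++ (mpm⇒pm mR) (mpm⇒pm mO)))
        -- No edge but the one from `z₀` to its mate leaves the blossom.
        explore k y₀ z₀ Z₀ R Old len refl Leq fc mZ mR mO | no ¬z | no ¬Z = inj₁ (record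
          { root = z₀ ; rest = Z₀ ; other = R ++ Old ; split = Leq ; rest-mpm = mZ ; other-mpm = mpm-++ mR mO
          ; single = cong₂ _+_ (cong₂ _+_ (a-adj (μ-adj z₀)) (deg-none z₀ (R ++ Old) (λ y∈ zy → ¬z (lose y∈ zy))))
                       (trans (sum-map-const (λ x → deg x (y₀ ∷ R ++ Old)) 0 Z₀
                           (λ {x} x∈ → deg-none x (y₀ ∷ R ++ Old) (λ y∈ xy → ¬Z (lose x∈ (lose y∈ xy)))))
                         (ℕₚ.*-zeroʳ (length Z₀))) })

        grow zero y₀ z₀ Z₀ (_ ∷ _) Old ()
        grow (suc k) y₀ z₀ Z₀ R Old len refl Leq fc mZ mR mO x t x∈ t∈ xt
          with mpm-pull R-unique mR t∈
          where
          R-unique : Unique R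
          R-unique = unique-++ˡ {xs = R} {ys = Old} (unique-++ʳ (z₀ ∷ Z₀ ++ y₀ ∷ [])
            (subst Unique (sym (Listₚ.++-assoc (z₀ ∷ Z₀) (y₀ ∷ []) (R ++ Old))) (unique-resp-↭ Leq L-unique)))
        ... | R₁ , R↭ , mR₁ with explore k t (μ t) [] R₁ (y₀ ∷ (z₀ ∷ Z₀) ++ Old) len₁ (μμ t) Leq₁ single none mR₁ mOld
          where
          len₁ : length R₁ ≤ k
          len₁ = ℕₚ.≤-pred (ℕₚ.≤-trans (ℕₚ.n≤1+n _) (subst (_≤ suc k) (↭ₚ.↭-length R↭) len))
          Leq₁ : L ↭ (μ t ∷ []) ++ t ∷ R₁ ++ (y₀ ∷ (z₀ ∷ Z₀) ++ Old)
          Leq₁ = ↭-trans Leq (↭-trans (↭ₚ.++⁺ˡ (z₀ ∷ Z₀) (prep y₀ (↭ₚ.++⁺ʳ Old R↭)))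
            (solve 7 (λ z Z y t u R O → (z ⊕ Z) ⊕ (y ⊕ ((t ⊕ (u ⊕ R)) ⊕ O)) ⊜ u ⊕ (t ⊕ (R ⊕ (y ⊕ ((z ⊕ Z) ⊕ O))))) ↭-refl
              [ z₀ ] Z₀ [ y₀ ] [ t ] [ μ t ] R₁ Old))
          single : FactorCritical (μ t ∷ [])
          single p with ↭ₚ.↭-length p
          single {Q = []} p | _ = none
          mOld : MPM (y₀ ∷ (z₀ ∷ Z₀) ++ Old)
          mOld = pair z₀ (mpm-++ mZ mO) (swap y₀ z₀ ↭-refl)
        ... | inj₁ bridge = inj₁ bridge
        ... | inj₂ e = finish (∈ₚ.∈-++⁻ (y₀ ∷ z₀ ∷ Z₀) e.t∈)
          where
          module e = Exit e
          Z : List V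
          Z = z₀ ∷ Z₀
          E₁ : List V
          E₁ = μ t ∷ e.E
          E₂ : List V
          E₂ = Z₀ ++ t ∷ E₁
          mE₂ : MPM E₂
          mE₂ = mpm-++ mZ (pair t e.E-mpm ↭-refl)
          R₁≡ : R₁ ↭ e.E ++ e.R′
          R₁≡ = e.grown
          grown₂ : Z₀ ++ R ↭ E₂ ++ e.R′
          grown₂ = ↭-trans (↭ₚ.++⁺ˡ Z₀ (↭-trans R↭ (prep t (prep (μ t) R₁≡))))
            (solve 5 (λ Z t u E R → Z ⊕ (t ⊕ (u ⊕ (E ⊕ R))) ⊜ (Z ⊕ (t ⊕ (u ⊕ E))) ⊕ R) ↭-refl Z₀ [ t ] [ μ t ] e.E e.R′)
          Leq₂ : L ↭ (z₀ ∷ E₂) ++ y₀ ∷ e.R′ ++ Old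
          Leq₂ = ↭-trans Leq (↭-trans (prep z₀ (solve 4 (λ Z y R O → Z ⊕ (y ⊕ (R ⊕ O)) ⊜ (Z ⊕ R) ⊕ (y ⊕ O)) ↭-refl Z₀ [ y₀ ] R Old))
            (↭-trans (prep z₀ (↭ₚ.++⁺ʳ (y₀ ∷ Old) grown₂))
              (solve 5 (λ z E R y O → z ⊕ ((E ⊕ R) ⊕ (y ⊕ O)) ⊜ (z ⊕ E) ⊕ (y ⊕ (R ⊕ O))) ↭-refl [ z₀ ] E₂ e.R′ [ y₀ ] Old)))
          len₂ : length e.R′ ≤ k
          len₂ = ℕₚ.≤-trans (ℕₚ.m≤n+m (length e.R′) (length e.E)) (ℕₚ.≤-trans (ℕₚ.≤-reflexive (trans (sym (Listₚ.length-++ e.E)) (sym (↭ₚ.↭-length R₁≡)))) len₁)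
            where
            len₁ : length R₁ ≤ k
            len₁ = ℕₚ.≤-pred (ℕₚ.≤-trans (ℕₚ.n≤1+n _) (subst (_≤ suc k) (↭ₚ.↭-length R↭) len))
          Qx : ∃[ Q ] Z ↭ x ∷ Q × PM Q
          Qx = fc-pm fc x∈
          Q′ : ∃[ Q ] E₁ ↭ e.x ∷ Q
          Q′ = pull-out e.x∈
          pm-at-x : PM (x ∷ t ∷ proj₁ Qx ++ proj₁ Q′)
          pm-at-x = pair xt (pm-++ (proj₂ (proj₂ Qx)) (e.at-x (proj₂ Q′))) ↭-refl
          split-x : z₀ ∷ E₂ ↭ e.x ∷ x ∷ t ∷ proj₁ Qx ++ proj₁ Q′
          split-x = ↭-trans (↭ₚ.++⁺ (proj₁ (proj₂ Qx)) (prep t (proj₂ Q′)))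
            (solve 5 (λ x Q t e Q′ → (x ⊕ Q) ⊕ (t ⊕ (e ⊕ Q′)) ⊜ e ⊕ (x ⊕ (t ⊕ (Q ⊕ Q′)))) ↭-refl [ x ] (proj₁ Qx) [ t ] [ e.x ] (proj₁ Q′))
          drop : ∀ {z Q P} → z₀ ∷ E₂ ↭ z ∷ Q → z₀ ∷ E₂ ↭ z ∷ P → P ↭ Q
          drop p q = ↭ₚ.drop-∷ (↭-trans (↭-sym q) p)

          -- What can be matched when `z` is left out, before the edge from `e.x` to `e.t` is used.
          -- In `inner` and `stem` the vertex `e.x` remains and waits for that edge; `stem` is the
          -- case of `t` itself.
          data Exposed (z : V) (Q : List V) : Set where
            direct : PM Q → Exposed z Q
            inner  : ∀ {Q′} → Q ↭ Z ++ t ∷ μ t ∷ e.x ∷ Q′ → PM Q′ → Exposed z Q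
            stem   : Q ↭ Z ++ e.x ∷ proj₁ Q′ → Exposed z Q

          exposed : ∀ {z Q} → z₀ ∷ E₂ ↭ z ∷ Q → Exposed z Q
          exposed {z} p with ∈ₚ.∈-++⁻ Z (↭ₚ.∈-resp-↭ (↭-sym p) (here refl))
          ... | inj₁ z∈Z with fc-pm fc z∈Z
          ...   | Qz , q , pm = direct (pm-↭ (drop p (↭ₚ.++⁺ʳ (t ∷ E₁) q)) (pm-++ pm (pair (μ-adj t) (mpm⇒pm e.E-mpm) ↭-refl)))
          exposed {z} p | inj₂ (here refl) = stem (↭-sym (drop p (↭-trans (↭ₚ.++⁺ˡ Z (prep t (proj₂ Q′)))
              (solve 4 (λ Z t e Q → Z ⊕ (t ⊕ (e ⊕ Q)) ⊜ t ⊕ (Z ⊕ (e ⊕ Q))) ↭-refl Z [ t ] [ e.x ] (proj₁ Q′)))))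
          exposed {z} p | inj₂ (there z∈E) with pull-out z∈E
          ... | Qz , q with e.at q
          ...   | inj₁ pm = direct (pm-↭ (drop p (↭-trans (↭ₚ.++⁺ (proj₁ (proj₂ Qx)) (prep t q))
                    (solve 5 (λ x Q t z P → (x ⊕ Q) ⊕ (t ⊕ (z ⊕ P)) ⊜ z ⊕ (x ⊕ (t ⊕ (Q ⊕ P)))) ↭-refl [ x ] (proj₁ Qx) [ t ] [ z ] Qz)))
                    (pair xt (pm-++ (proj₂ (proj₂ Qx)) pm) ↭-refl))
          ...   | inj₂ (Q″ , r , pm) = inner (↭-sym (drop p (↭-trans (↭ₚ.++⁺ˡ Z (prep t (↭-trans q (prep z r))))
                    (solve 6 (λ Z t z u e P → Z ⊕ (t ⊕ (z ⊕ (u ⊕ (e ⊕ P)))) ⊜ z ⊕ (Z ⊕ (t ⊕ (u ⊕ (e ⊕ P))))) ↭-refl Z [ t ] [ z ] [ μ t ] [ e.x ] Q″))))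
                    pm

          at₂ : ∀ {z Q} → Exposed z Q → PM Q ⊎ (∃[ Q′ ] Q ↭ z₀ ∷ e.x ∷ Q′ × PM Q′)
          at₂ (direct pm) = inj₁ pm
          at₂ (inner {Q′ = P} p pm) = inj₂ (Z₀ ++ t ∷ μ t ∷ P , ↭-trans p
            (solve 6 (λ z Z t u e P → (z ⊕ Z) ⊕ (t ⊕ (u ⊕ (e ⊕ P))) ⊜ z ⊕ (e ⊕ (Z ⊕ (t ⊕ (u ⊕ P))))) ↭-refl [ z₀ ] Z₀ [ t ] [ μ t ] [ e.x ] P)
            , pm-++ (mpm⇒pm mZ) (pair (μ-adj t) pm ↭-refl))
          at₂ (stem p) = inj₂ (Z₀ ++ proj₁ Q′ , ↭-trans p
            (solve 4 (λ z Z e P → (z ⊕ Z) ⊕ (e ⊕ P) ⊜ z ⊕ (e ⊕ (Z ⊕ P))) ↭-refl [ z₀ ] Z₀ [ e.x ] (proj₁ Q′))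
            , pm-++ (mpm⇒pm mZ) (e.at-x (proj₂ Q′)))

          -- The waiting vertex `e.x` is matched with `e.t`, and the old blossom without `e.t` has a
          -- perfect matching because it is factor-critical.
          fc₂ : e.t ∈ Z → FactorCritical (z₀ ∷ E₂)
          fc₂ t∈Z p with exposed p | fc-pm fc t∈Z
          ... | direct pm | _ = pm
          ... | inner {Q′ = P} q pm | Qt , r , pmt = pair e.xt (pair (μ-adj t) (pm-++ pmt pm) ↭-refl) (↭-trans q (↭-trans (↭ₚ.++⁺ʳ (t ∷ μ t ∷ e.x ∷ P) r)
              (solve 6 (λ s Z t u e P → (s ⊕ Z) ⊕ (t ⊕ (u ⊕ (e ⊕ P))) ⊜ e ⊕ (s ⊕ (t ⊕ (u ⊕ (Z ⊕ P))))) ↭-refl [ e.t ] Qt [ t ] [ μ t ] [ e.x ] P)))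
          ... | stem q | Qt , r , pmt = pair e.xt (pm-++ pmt (e.at-x (proj₂ Q′))) (↭-trans q (↭-trans (↭ₚ.++⁺ʳ (e.x ∷ proj₁ Q′) r)
              (solve 4 (λ s Z e P → (s ⊕ Z) ⊕ (e ⊕ P) ⊜ e ⊕ (s ⊕ (Z ⊕ P))) ↭-refl [ e.t ] Qt [ e.x ] (proj₁ Q′))))

          widen : Exit z₀ E₂ e.R′ Old → Exit z₀ Z₀ R Old
          widen f = record
            { E = f.E ; R′ = f.R′ ; x = f.x ; t = f.t ; grown = ↭-trans grown₂ f.grown ; E-mpm = f.E-mpm ; R′-mpm = f.R′-mpm
            ; x∈ = f.x∈ ; t∈ = f.t∈ ; xt = f.xt ; at-x = f.at-x ; at = f.at }
            where module f = Exit f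

          x∈E₂ : e.x ∈ E₂
          x∈E₂ = ∈ₚ.∈-++⁺ʳ Z₀ (there e.x∈)

          finish : e.t ∈ y₀ ∷ z₀ ∷ Z₀ ⊎ e.t ∈ Old → Bridge L ⊎ Exit z₀ Z₀ R Old
          -- The chain returns to the mate of `z₀`, which closes an alternating cycle and
          -- contradicts uniqueness.
          finish (inj₁ (here t≡y₀)) = contradiction x∈E₂ (subst (_∉ E₂) (trans (sym (μμ z₀)) μy≡x) z₀∉)
            where
            z₀∉ : z₀ ∉ E₂
            z₀∉ = unique-disjoint {xs = z₀ ∷ []} (unique-++ˡ {xs = z₀ ∷ E₂} (unique-resp-↭ Leq₂ L-unique)) (here refl)
            μy≡x : μ (μ z₀) ≡ e.x
            μy≡x = L-upm (adj-sym (subst (Adj e.x) t≡y₀ e.xt))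
              (↭-trans Leq₂ (↭-trans (↭ₚ.++⁺ʳ (μ z₀ ∷ e.R′ ++ Old) split-x)
                (solve 4 (λ x P y R → (x ⊕ P) ⊕ (y ⊕ R) ⊜ y ⊕ (x ⊕ (P ⊕ R))) ↭-refl [ e.x ] (x ∷ t ∷ proj₁ Qx ++ proj₁ Q′) [ μ z₀ ] (e.R′ ++ Old))))
              (pm-++ pm-at-x (pm-++ (mpm⇒pm e.R′-mpm) (mpm⇒pm mO)))
          finish (inj₁ (there t∈Z)) with explore k (μ z₀) z₀ E₂ e.R′ Old len₂ refl Leq₂ (fc₂ t∈Z) mE₂ e.R′-mpm mO
          ... | inj₁ bridge = inj₁ bridge
          ... | inj₂ f = inj₂ (widen f)
          finish (inj₂ t∈Old) = inj₂ (record
            { E = E₂ ; R′ = e.R′ ; x = e.x ; t = e.t ; grown = grown₂ ; E-mpm = mE₂ ; R′-mpm = e.R′-mpm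
            ; x∈ = there x∈E₂ ; t∈ = t∈Old ; xt = e.xt
            ; at-x = λ p → pm-↭ (drop p split-x) pm-at-x
            ; at = λ p → at₂ (exposed p) })

      -- Kotzig's theorem.
      bridge : ∀ {L x} → Unique L → UPM L → MPM L → x ∈ L → Bridge L
      bridge {L} {x} uniq upm mpm x∈L with mpm-pull uniq mpm x∈L
      ... | R , p , mR with Search.explore uniq upm (length R) x (μ x) [] R [] ℕₚ.≤-refl (μμ x)
            (↭-trans p (↭-trans (swap x (μ x) (↭-reflexive (sym (Listₚ.++-identityʳ R)))) ↭-refl))
            (λ { {Q = []} _ → none ; {Q = _ ∷ _} q → case ↭ₚ.↭-length q of λ () }) none mR none
      ...   | inj₁ b = b
      ...   | inj₂ e = case Exit.t∈ e of λ ()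

    -- Sets with a unique perfect matching, split at a bridge.

    module Classification where

      open Cuts
      open ShortCycles
      open Matchings

      -- `U` is the part that is still forced, `W` its complement, kept nonempty for the sake of
      -- `cut-bound`.
      record Part (U W : List V) : Set where
        field
          sp  : Split U W
          upm : UPM U
          mpm : MPM U
          {w} : V
          w∈  : w ∈ W

      open Part

      mpm-even : ∀ {L} → MPM L → ∃[ k ] length L ≡ 2 * k
      mpm-even none = 0 , refl
      mpm-even (pair u m p) with mpm-even m
      ... | k , eq = suc k , trans (↭ₚ.↭-length p) (trans (cong (2 +_) eq) (sym (ℕₚ.*-suc 2 k)))

      part-even : ∀ {U W} → Part U W → ∃[ k ] cross U W ≡ 2 * k
      part-even {U} {W} P with mpm-even (mpm P) | cross-self U
      ... | l , len | e , self = l * 3 ∸ e , (begin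
        cross U W                   ≡⟨ ℕₚ.m+n∸m≡n (cross U U) (cross U W) ⟨
        cross U U + cross U W ∸ cross U U ≡⟨ cong₂ _∸_ (trans (split-count (sp P)) (cong (_* 3) len)) self ⟩
        2 * l * 3 ∸ 2 * e           ≡⟨ cong (_∸ 2 * e) (ℕₚ.*-assoc 2 l 3) ⟩
        2 * (l * 3) ∸ 2 * e         ≡⟨ ℕₚ.*-distribˡ-∸ 2 (l * 3) e ⟨
        2 * (l * 3 ∸ e)             ∎)
        where open ≡-Reasoning

      -- `U` has an even number of vertices, so its cut is even and cannot be 3.
      part-bound : ∀ {U W x} → Part U W → x ∈ U → 4 ≤ cross U W
      part-bound P x∈ = let k , eq = part-even P in
        subst (4 ≤_) (sym eq) (even≥3 k (subst (3 ≤_) eq (cut-bound (sp P) x∈ (w∈ P))))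
        where
        even≥3 : ∀ k → 3 ≤ 2 * k → 4 ≤ 2 * k
        even≥3 zero ()
        even≥3 (suc zero) (s≤s (s≤s ()))
        even≥3 (suc (suc k)) _ = ℕₚ.*-monoʳ-≤ 2 (s≤s (s≤s z≤n))

      part-sub : ∀ {A B U W} → U ↭ A ++ B → Part U W → MPM A → MPM B → Part A (B ++ W)
      part-sub {A} {B} {U} {W} p P mA mB = record
        { sp  = mkSplit (↭-trans (↭-trans (↭-reflexive (sym (Listₚ.++-assoc A B W))) (↭ₚ.++⁺ʳ W (↭-sym p))) (Split.perm (sp P)))
        ; upm = upm-sub mB (upm-↭ p (upm P)) ; mpm = mA ; w∈ = ∈ₚ.∈-++⁺ʳ B (w∈ P) }

      -- One side of a bridge, with `r` as its end of the bridge; `A` is again matched within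
      -- itself, which drives the recursion.
      record Limb (r : V) (A W : List V) : Set where
        field
          lsp  : Split (r ∷ A) W
          part : Part A (r ∷ W)
          mate : μ r ∈ W

      open Limb

      -- Moving `r` across exchanges its edges to `W` for its edges to `A`, three edges altogether.
      -- As the cut of `A` is even, this also yields the parity in `limb-odd`.
      limb-move : ∀ {r A W} → Limb r A W → cross A (r ∷ W) + 3 ≡ cross (r ∷ A) W + 2 * deg r A
      limb-move {r} {A} {W} L = begin
        cross A (r ∷ W) + 3                        ≡⟨ cong (cross A (r ∷ W) +_) (trans (sym (split-deg (lsp L) r)) (cong (λ k → k + deg r A + deg r W) (a-irrefl r))) ⟩
        cross A (r ∷ W) + (deg r A + deg r W)      ≡⟨ mix₁ (cross A (r ∷ W)) (deg r A) (deg r W) ⟩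
        cross A (r ∷ W) + deg r W + deg r A        ≡⟨ cong (_+ deg r A) (cut-move (lsp L)) ⟩
        cross (r ∷ A) W + deg r A + deg r A        ≡⟨ mix₂ (cross (r ∷ A) W) (deg r A) ⟩
        cross (r ∷ A) W + 2 * deg r A              ∎
        where
        open ≡-Reasoning
        mix₁ : ∀ p q r → p + (q + r) ≡ p + r + q
        mix₁ = solve-∀
        mix₂ : ∀ p q → p + q + q ≡ p + 2 * q
        mix₂ = solve-∀

      limb-deg : ∀ {r A W} → Limb r A W → deg r A ≤ 2
      limb-deg {r} {A} {W} L with pull-out (mate L)
      ... | R , p = ℕₚ.+-cancelʳ-≤ 1 (deg r A) 2 (begin
        deg r A + 1              ≤⟨ ℕₚ.+-monoʳ-≤ (deg r A) (ℕₚ.≤-trans (ℕₚ.m≤m+n 1 (deg r R)) (ℕₚ.≤-reflexive (sym (trans (deg-↭ r p) (cong (_+ deg r R) (a-adj (μ-adj r))))))) ⟩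
        deg r A + deg r W        ≡⟨ cong (λ k → k + deg r A + deg r W) (a-irrefl r) ⟨
        deg r (r ∷ A) + deg r W  ≡⟨ split-deg (lsp L) r ⟩
        3                        ∎)
        where open ℕₚ.≤-Reasoning

      limb-bound : ∀ {r A W} → Limb r A W → 3 ≤ cross (r ∷ A) W
      limb-bound L = cut-bound (lsp L) (here refl) (mate L)

      limb-odd : ∀ {r A W} → Limb r A W → ∃[ k ] cross (r ∷ A) W ≡ 1 + 2 * k
      limb-odd {r} {A} {W} L = let c , eq = part-even (part L) in
        odd (cross (r ∷ A) W) c (deg r A) (trans (cong (_+ 3) (sym eq)) (limb-move L))
        where
        odd : ∀ x c d → 2 * c + 3 ≡ x + 2 * d → ∃[ k ] x ≡ 1 + 2 * k
        odd x c d e with ℕₚ.≤-total d (suc c)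
        ... | inj₁ d≤ = suc c ∸ d , ℕₚ.+-cancelʳ-≡ (2 * d) x _ (trans (sym e) (trans (mix c) (trans (cong (λ z → 1 + 2 * z) (sym (ℕₚ.m∸n+n≡m d≤))) (mix′ (suc c ∸ d) d))))
          where
          mix : ∀ c → 2 * c + 3 ≡ 1 + 2 * suc c
          mix = solve-∀
          mix′ : ∀ p d → 1 + 2 * (p + d) ≡ 1 + 2 * p + 2 * d
          mix′ = solve-∀
        ... | inj₂ d≥ with ℕₚ.m≤n⇒m<n∨m≡n d≥
        ...   | inj₂ refl = 0 , ℕₚ.+-cancelʳ-≡ (2 * suc c) x 1 (trans (sym e) (mix c))
          where
          mix : ∀ c → 2 * c + 3 ≡ 1 + 2 * suc c
          mix = solve-∀
        ...   | inj₁ c<d = contradiction (ℕₚ.≤-trans (ℕₚ.*-monoʳ-≤ 2 c<d) (ℕₚ.≤-trans (ℕₚ.m≤n+m (2 * d) x) (ℕₚ.≤-reflexive (sym e)))) (ℕₚ.<⇒≱ (ℕₚ.≤-reflexive (mix c)))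
          where
          mix : ∀ c → suc (2 * c + 3) ≡ 2 * suc (suc c)
          mix = solve-∀

      record Halves (U W : List V) : Set where
        field
          r s : V
          A B : List V
          mate-r : μ r ≡ s
          whole  : U ↭ (r ∷ A) ++ (s ∷ B)
          single : cross (r ∷ A) (s ∷ B) ≡ 1
          limbˡ  : Limb r A (s ∷ B ++ W)
          limbʳ  : Limb s B (r ∷ A ++ W)
          cuts   : cross (r ∷ A) (s ∷ B ++ W) + cross (s ∷ B) (r ∷ A ++ W) ≡ cross U W + 2

      halves : ∀ {U W x} → Part U W → x ∈ U → Halves U W
      halves {U} {W} P x∈ = record
        { r = b.root ; s = μ b.root ; A = b.rest ; B = b.other ; mate-r = refl ; whole = b.split ; single = b.single
        ; limbˡ = record
            { lsp = mkSplit (↭-trans (↭-trans (↭-reflexive (sym (Listₚ.++-assoc rA sB W))) (↭ₚ.++⁺ʳ W (↭-sym b.split))) (Split.perm (sp P)))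
            ; part = part-sub′ (↭-trans b.split (solve 4 (λ r A s B → (r ⊕ A) ⊕ (s ⊕ B) ⊜ A ⊕ (r ⊕ (s ⊕ B))) ↭-refl [ b.root ] b.rest [ μ b.root ] b.other))
                       b.rest-mpm (pair b.root b.other-mpm ↭-refl)
            ; mate = here refl }
        ; limbʳ = record
            { lsp = mkSplit (↭-trans (↭-trans (solve 3 (λ sB rA W → sB ⊕ (rA ⊕ W) ⊜ (rA ⊕ sB) ⊕ W) ↭-refl sB rA W) (↭ₚ.++⁺ʳ W (↭-sym b.split))) (Split.perm (sp P)))
            ; part = part-sub′ (↭-trans b.split (solve 4 (λ r A s B → (r ⊕ A) ⊕ (s ⊕ B) ⊜ B ⊕ (s ⊕ (r ⊕ A))) ↭-refl [ b.root ] b.rest [ μ b.root ] b.other))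
                       b.other-mpm (pair b.root b.rest-mpm (swap _ _ ↭-refl))
            ; mate = here (μμ b.root) }
        ; cuts = begin
            cross rA (sB ++ W) + cross sB (rA ++ W)                     ≡⟨ cong₂ _+_ (cross-++ʳ rA sB W) (cross-++ʳ sB rA W) ⟩
            (cross rA sB + cross rA W) + (cross sB rA + cross sB W)     ≡⟨ cong₂ (λ p q → (p + cross rA W) + (q + cross sB W)) b.single (trans (cross-sym sB rA) b.single) ⟩
            (1 + cross rA W) + (1 + cross sB W)                         ≡⟨ mix (cross rA W) (cross sB W) ⟩
            (cross rA W + cross sB W) + 2                               ≡⟨ cong (_+ 2) (trans (sym (cross-++ˡ rA sB W)) (cross-↭ˡ W (↭-sym b.split))) ⟩
            cross U W + 2                                               ∎ }
        where
        open ≡-Reasoning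
        module b = Bridge (bridge (split-uniqueˡ (sp P)) (upm P) (mpm P) x∈)
        rA sB : List V
        rA = b.root ∷ b.rest
        sB = μ b.root ∷ b.other
        part-sub′ : ∀ {A B} → U ↭ A ++ B → MPM A → MPM B → Part A (B ++ W)
        part-sub′ p mA mB = part-sub p P mA mB
        mix : ∀ p q → (1 + p) + (1 + q) ≡ (p + q) + 2
        mix = solve-∀

      swap-halves : ∀ {U W} → Halves U W → Halves U W
      swap-halves {U} {W} h = record
        { r = s ; s = r ; A = B ; B = A ; mate-r = trans (cong μ (sym mate-r)) (μμ r)
        ; whole = ↭-trans whole (↭ₚ.++-comm (r ∷ A) (s ∷ B)) ; single = trans (cross-sym (s ∷ B) (r ∷ A)) single
        ; limbˡ = limbʳ ; limbʳ = limbˡ ; cuts = trans (ℕₚ.+-comm (cross (s ∷ B) (r ∷ A ++ W)) _) cuts }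
        where open Halves h

    -- The sets with 3, 4, 5 or 6 cut edges.

    module Pieces where

      open Cuts
      open ShortCycles
      open Matchings
      open Classification

      -- Both pentagons are faces, and a dart lies on one face only, so they cannot share a path of two edges.
      two-pentagons : ∀ {b p q s t r a} (bp : Adj b p) (pq : Adj p q) (qs : Adj q s) (st : Adj s t) (tb : Adj t b)
                      (qr : Adj q r) (ra : Adj r a) (ab : Adj a b) →
                      b ≢ q → p ≢ s → q ≢ t → s ≢ b → t ≢ p → p ≢ r → q ≢ a → r ≢ b → a ≢ p → s ≢ r → ⊥
      two-pentagons bp pq qs st tb qr ra ab b≢q p≢s q≢t s≢b t≢p p≢r q≢a r≢b a≢p s≢r
        with pentagon bp pq qs st tb b≢q p≢s q≢t s≢b t≢p | pentagon bp pq qr ra ab b≢q p≢r q≢a r≢b a≢p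
      ... | inj₁ (_ , e , _) | inj₁ (_ , f , _) = s≢r (trans (sym (dart-tgt qs)) (trans (cong tgt (trans (sym e) f)) (dart-tgt qr)))
      ... | inj₁ (e , _) | inj₂ (_ , _ , _ , f , _) = ν²-≢ (α (dart bp)) (trans (cong ν e) (trans (sym (cong ν (α-involutive (dart pq)))) f))
      ... | inj₂ (_ , _ , _ , e , _) | inj₁ (f , _) = ν²-≢ (α (dart bp)) (trans (cong ν f) (trans (sym (cong ν (α-involutive (dart pq)))) e))
      ... | inj₂ (_ , _ , e , _) | inj₂ (_ , _ , f , _) =
        s≢r (trans (sym (dart-tgt qs)) (trans (cong tgt (α-injective (φ-injective (trans e (sym f))))) (dart-tgt qr)))

      -- Neighbours of `r` at distance 1 or 2 along the path would give a triangle or a square,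
      -- which leaves the two ends.
      path-ends : ∀ {r p q s t} → Adj p q → Adj q s → Adj s t → Unique (p ∷ q ∷ s ∷ t ∷ []) →
                  (∀ {v} → v ∈ p ∷ q ∷ s ∷ t ∷ [] → r ≢ v) →
                  ∀ {y z} → y ∈ p ∷ q ∷ s ∷ t ∷ [] → z ∈ p ∷ q ∷ s ∷ t ∷ [] → y ≢ z → Adj r y → Adj r z → Adj r p × Adj t r
      path-ends {r} {p} {q} {s} {t} pq qs st uniq r≢ = go
        where
        go : ∀ {y z} → y ∈ p ∷ q ∷ s ∷ t ∷ [] → z ∈ p ∷ q ∷ s ∷ t ∷ [] → y ≢ z → Adj r y → Adj r z → Adj r p × Adj t r
        go (here refl) (here refl) y≢z ry rz = contradiction refl y≢z
        go (here refl) (there (here refl)) y≢z ry rz = ⊥-elim (no-triangle ry pq (adj-sym rz))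
        go (here refl) (there (there (here refl))) y≢z ry rz = ⊥-elim (no-square ry pq qs (adj-sym rz) (r≢ (there (here refl))) y≢z)
        go (here refl) (there (there (there (here refl)))) y≢z ry rz = ry , adj-sym rz
        go (there (here refl)) (here refl) y≢z ry rz = ⊥-elim (no-triangle ry (adj-sym pq) (adj-sym rz))
        go (there (here refl)) (there (here refl)) y≢z ry rz = contradiction refl y≢z
        go (there (here refl)) (there (there (here refl))) y≢z ry rz = ⊥-elim (no-triangle ry qs (adj-sym rz))
        go (there (here refl)) (there (there (there (here refl)))) y≢z ry rz = ⊥-elim (no-square ry qs st (adj-sym rz) (r≢ (there (there (here refl)))) y≢z)
        go (there (there (here refl))) (here refl) y≢z ry rz = ⊥-elim (no-square ry (adj-sym qs) (adj-sym pq) (adj-sym rz) (r≢ (there (here refl))) y≢z)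
        go (there (there (here refl))) (there (here refl)) y≢z ry rz = ⊥-elim (no-triangle ry (adj-sym qs) (adj-sym rz))
        go (there (there (here refl))) (there (there (here refl))) y≢z ry rz = contradiction refl y≢z
        go (there (there (here refl))) (there (there (there (here refl)))) y≢z ry rz = ⊥-elim (no-triangle ry st (adj-sym rz))
        go (there (there (there (here refl)))) (here refl) y≢z ry rz = rz , adj-sym ry
        go (there (there (there (here refl)))) (there (here refl)) y≢z ry rz = ⊥-elim (no-square ry (adj-sym st) (adj-sym qs) (adj-sym rz) (r≢ (there (there (here refl)))) y≢z)
        go (there (there (there (here refl)))) (there (there (here refl))) y≢z ry rz = ⊥-elim (no-triangle ry (adj-sym st) (adj-sym rz))
        go (there (there (there (here refl)))) (there (there (there (here refl)))) y≢z ry rz = contradiction refl y≢z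

      -- Without triangles and squares, `r` can only be joined to the leaf `a` and to `q` or `s`.
      -- The resulting pentagon shares a path of two edges with the given one.
      pendant-full : ∀ {r a b p q s t} → Adj a b → Adj b p → Adj p q → Adj q s → Adj s t → Adj t b →
                     Unique (a ∷ b ∷ p ∷ q ∷ s ∷ t ∷ []) → (∀ {v} → v ∈ a ∷ b ∷ p ∷ q ∷ s ∷ t ∷ [] → r ≢ v) →
                     ∀ {y z} → y ∈ a ∷ b ∷ p ∷ q ∷ s ∷ t ∷ [] → z ∈ a ∷ b ∷ p ∷ q ∷ s ∷ t ∷ [] → y ≢ z → Adj r y → Adj r z → ⊥
      pendant-full {r} {a} {b} {p} {q} {s} {t} ab bp pq qs st tb uneq r≢ = go
        where
        a≢p : a ≢ p
        a≢p = unique-head uneq (there (here refl))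
        q≢a : q ≢ a
        q≢a = ≢-sym (unique-head uneq (there (there (here refl))))
        a≢s : a ≢ s
        a≢s = unique-head uneq (there (there (there (here refl))))
        a≢t : a ≢ t
        a≢t = unique-head uneq (there (there (there (there (here refl)))))
        b≢q : b ≢ q
        b≢q = unique-head (unique-tail uneq) (there (here refl))
        s≢b : s ≢ b
        s≢b = ≢-sym (unique-head (unique-tail uneq) (there (there (here refl))))
        p≢s : p ≢ s
        p≢s = unique-head (unique-tail (unique-tail uneq)) (there (here refl))
        t≢p : t ≢ p
        t≢p = ≢-sym (unique-head (unique-tail (unique-tail uneq)) (there (there (here refl))))
        q≢t : q ≢ t
        q≢t = unique-head (unique-tail (unique-tail (unique-tail uneq))) (there (here refl))
        go : ∀ {y z} → y ∈ a ∷ b ∷ p ∷ q ∷ s ∷ t ∷ [] → z ∈ a ∷ b ∷ p ∷ q ∷ s ∷ t ∷ [] → y ≢ z → Adj r y → Adj r z → ⊥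
        go (here refl) (here refl) y≢z ry rz = contradiction refl y≢z
        go (here refl) (there (here refl)) y≢z ry rz = ⊥-elim (no-triangle ry ab (adj-sym rz))
        go (here refl) (there (there (here refl))) y≢z ry rz = ⊥-elim (no-square ry ab bp (adj-sym rz) (r≢ (there (here refl))) y≢z)
        go (here refl) (there (there (there (here refl)))) y≢z ry rz = two-pentagons bp pq qs st tb (adj-sym rz) ry ab b≢q p≢s q≢t s≢b t≢p (≢-sym (r≢ (there (there (here refl))))) q≢a (r≢ (there (here refl))) a≢p (≢-sym (r≢ (there (there (there (there (here refl)))))))
        go (here refl) (there (there (there (there (here refl))))) y≢z ry rz = two-pentagons (adj-sym tb) (adj-sym st) (adj-sym qs) (adj-sym pq) (adj-sym bp) (adj-sym rz) ry ab (≢-sym s≢b) (≢-sym q≢t) (≢-sym p≢s) (≢-sym b≢q) (≢-sym t≢p) (≢-sym (r≢ (there (there (there (there (there (here refl)))))))) (≢-sym a≢s) (r≢ (there (here refl))) a≢t (≢-sym (r≢ (there (there (there (here refl))))))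
        go (here refl) (there (there (there (there (there (here refl)))))) y≢z ry rz = ⊥-elim (no-square ry ab (adj-sym tb) (adj-sym rz) (r≢ (there (here refl))) y≢z)
        go (there (here refl)) (here refl) y≢z ry rz = ⊥-elim (no-triangle ry (adj-sym ab) (adj-sym rz))
        go (there (here refl)) (there (here refl)) y≢z ry rz = contradiction refl y≢z
        go (there (here refl)) (there (there (here refl))) y≢z ry rz = ⊥-elim (no-triangle ry bp (adj-sym rz))
        go (there (here refl)) (there (there (there (here refl)))) y≢z ry rz = ⊥-elim (no-square ry bp pq (adj-sym rz) (r≢ (there (there (here refl)))) y≢z)
        go (there (here refl)) (there (there (there (there (here refl))))) y≢z ry rz = ⊥-elim (no-square ry (adj-sym tb) (adj-sym st) (adj-sym rz) (r≢ (there (there (there (there (there (here refl))))))) y≢z)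
        go (there (here refl)) (there (there (there (there (there (here refl)))))) y≢z ry rz = ⊥-elim (no-triangle ry (adj-sym tb) (adj-sym rz))
        go (there (there (here refl))) (here refl) y≢z ry rz = ⊥-elim (no-square ry (adj-sym bp) (adj-sym ab) (adj-sym rz) (r≢ (there (here refl))) y≢z)
        go (there (there (here refl))) (there (here refl)) y≢z ry rz = ⊥-elim (no-triangle ry (adj-sym bp) (adj-sym rz))
        go (there (there (here refl))) (there (there (here refl))) y≢z ry rz = contradiction refl y≢z
        go (there (there (here refl))) (there (there (there (here refl)))) y≢z ry rz = ⊥-elim (no-triangle ry pq (adj-sym rz))
        go (there (there (here refl))) (there (there (there (there (here refl))))) y≢z ry rz = ⊥-elim (no-square ry pq qs (adj-sym rz) (r≢ (there (there (there (here refl))))) y≢z)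
        go (there (there (here refl))) (there (there (there (there (there (here refl)))))) y≢z ry rz = ⊥-elim (no-square ry (adj-sym bp) (adj-sym tb) (adj-sym rz) (r≢ (there (here refl))) y≢z)
        go (there (there (there (here refl)))) (here refl) y≢z ry rz = two-pentagons bp pq qs st tb (adj-sym ry) rz ab b≢q p≢s q≢t s≢b t≢p (≢-sym (r≢ (there (there (here refl))))) q≢a (r≢ (there (here refl))) a≢p (≢-sym (r≢ (there (there (there (there (here refl)))))))
        go (there (there (there (here refl)))) (there (here refl)) y≢z ry rz = ⊥-elim (no-square ry (adj-sym pq) (adj-sym bp) (adj-sym rz) (r≢ (there (there (here refl)))) y≢z)
        go (there (there (there (here refl)))) (there (there (here refl))) y≢z ry rz = ⊥-elim (no-triangle ry (adj-sym pq) (adj-sym rz))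
        go (there (there (there (here refl)))) (there (there (there (here refl)))) y≢z ry rz = contradiction refl y≢z
        go (there (there (there (here refl)))) (there (there (there (there (here refl))))) y≢z ry rz = ⊥-elim (no-triangle ry qs (adj-sym rz))
        go (there (there (there (here refl)))) (there (there (there (there (there (here refl)))))) y≢z ry rz = ⊥-elim (no-square ry qs st (adj-sym rz) (r≢ (there (there (there (there (here refl)))))) y≢z)
        go (there (there (there (there (here refl))))) (here refl) y≢z ry rz = two-pentagons (adj-sym tb) (adj-sym st) (adj-sym qs) (adj-sym pq) (adj-sym bp) (adj-sym ry) rz ab (≢-sym s≢b) (≢-sym q≢t) (≢-sym p≢s) (≢-sym b≢q) (≢-sym t≢p) (≢-sym (r≢ (there (there (there (there (there (here refl)))))))) (≢-sym a≢s) (r≢ (there (here refl))) a≢t (≢-sym (r≢ (there (there (there (here refl))))))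
        go (there (there (there (there (here refl))))) (there (here refl)) y≢z ry rz = ⊥-elim (no-square ry st tb (adj-sym rz) (r≢ (there (there (there (there (there (here refl))))))) y≢z)
        go (there (there (there (there (here refl))))) (there (there (here refl))) y≢z ry rz = ⊥-elim (no-square ry (adj-sym qs) (adj-sym pq) (adj-sym rz) (r≢ (there (there (there (here refl))))) y≢z)
        go (there (there (there (there (here refl))))) (there (there (there (here refl)))) y≢z ry rz = ⊥-elim (no-triangle ry (adj-sym qs) (adj-sym rz))
        go (there (there (there (there (here refl))))) (there (there (there (there (here refl))))) y≢z ry rz = contradiction refl y≢z
        go (there (there (there (there (here refl))))) (there (there (there (there (there (here refl)))))) y≢z ry rz = ⊥-elim (no-triangle ry st (adj-sym rz))
        go (there (there (there (there (there (here refl)))))) (here refl) y≢z ry rz = ⊥-elim (no-square ry tb (adj-sym ab) (adj-sym rz) (r≢ (there (here refl))) y≢z)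
        go (there (there (there (there (there (here refl)))))) (there (here refl)) y≢z ry rz = ⊥-elim (no-triangle ry tb (adj-sym rz))
        go (there (there (there (there (there (here refl)))))) (there (there (here refl))) y≢z ry rz = ⊥-elim (no-square ry tb bp (adj-sym rz) (r≢ (there (here refl))) y≢z)
        go (there (there (there (there (there (here refl)))))) (there (there (there (here refl)))) y≢z ry rz = ⊥-elim (no-square ry (adj-sym st) (adj-sym qs) (adj-sym rz) (r≢ (there (there (there (there (here refl)))))) y≢z)
        go (there (there (there (there (there (here refl)))))) (there (there (there (there (here refl))))) y≢z ry rz = ⊥-elim (no-triangle ry (adj-sym st) (adj-sym rz))
        go (there (there (there (there (there (here refl)))))) (there (there (there (there (there (here refl)))))) y≢z ry rz = contradiction refl y≢z

      data Limb₅ (r : V) (A : List V) : Set where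
        path : ∀ x → A ↭ x ∷ μ x ∷ [] → Adj r x → ¬ Adj r (μ x) → Limb₅ r A
        pent : ∀ p s → A ↭ p ∷ μ p ∷ s ∷ μ s ∷ [] → Adj r p → Adj (μ p) s → Adj (μ s) r → Limb₅ r A

      -- In `pendant` the leaf `a` hangs on the pentagon through `μ a`.
      data Six (U : List V) : Set where
        path    : ∀ p s → U ↭ p ∷ μ p ∷ s ∷ μ s ∷ [] → Adj (μ p) s → Six U
        pendant : ∀ a p s → U ↭ a ∷ μ a ∷ p ∷ μ p ∷ s ∷ μ s ∷ [] → Adj (μ a) p → Adj (μ p) s → Adj (μ s) (μ a) → Six U

      inhabited : ∀ {c} U {W} → cross U W ≡ suc c → ∃[ x ] x ∈ U
      inhabited (x ∷ U) _ = x , here refl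

      odd-cases : ∀ {r A W} → Limb r A W → cross (r ∷ A) W ≡ 3 ⊎ cross (r ∷ A) W ≡ 5 ⊎ 7 ≤ cross (r ∷ A) W
      odd-cases {r} {A} {W} L = let k , eq = limb-odd L in go k eq (limb-bound L)
        where
        go : ∀ {c} k → c ≡ 1 + 2 * k → 3 ≤ c → c ≡ 3 ⊎ c ≡ 5 ⊎ 7 ≤ c
        go 0 refl (s≤s ())
        go 1 refl _ = inj₁ refl
        go 2 refl _ = inj₂ (inj₁ refl)
        go (suc (suc (suc k))) refl _ = inj₂ (inj₂ (s≤s (ℕₚ.*-monoʳ-≤ 2 (s≤s (s≤s (s≤s (z≤n {k})))))))

      too-big : ∀ {a b c} p q → p ≤ a → q ≤ b → a + b ≡ c → c < p + q → ⊥
      too-big p q pa qb refl lt = ℕₚ.<⇒≱ lt (ℕₚ.+-mono-≤ pa qb)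

      ≥5 : ∀ {c} → c ≡ 5 ⊎ 7 ≤ c → 5 ≤ c
      ≥5 (inj₁ refl) = ℕₚ.≤-refl
      ≥5 (inj₂ le) = ℕₚ.≤-trans (ℕₚ.m≤n+m 5 2) le

      shorterˡ : ∀ {U W k} (h : Halves U W) → length U ≤ suc k → length (Halves.A h) ≤ k
      shorterˡ {U} h len = ℕₚ.≤-pred (ℕₚ.≤-trans (ℕₚ.≤-trans (ℕₚ.m≤m+n (suc (length A)) (length (s ∷ B)))
          (ℕₚ.≤-reflexive (sym (trans (↭ₚ.↭-length whole) (Listₚ.length-++ (r ∷ A)))))) len)
        where open Halves h

      empty-or-bound : ∀ {A W} → Part A W → A ≡ [] ⊎ 4 ≤ cross A W
      empty-or-bound {[]}    P = inj₁ refl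
      empty-or-bound {x ∷ A} P = inj₂ (part-bound P (here refl))

      edge-sides : ∀ {r A u v} → A ↭ u ∷ v ∷ [] → deg r A ≡ 2 → Adj r u × Adj r v
      edge-sides {r} {A} {u} {v} p eq with adj? r u | adj? r v | trans (sym (deg-↭ r p)) eq
      ... | yes ru | yes rv | _  = ru , rv
      ... | yes _  | no _   | ()
      ... | no _   | yes _  | ()
      ... | no _   | no _   | ()

      one-side : ∀ {r A u v} → A ↭ u ∷ v ∷ [] → deg r A ≡ 1 → (Adj r u × ¬ Adj r v) ⊎ (Adj r v × ¬ Adj r u)
      one-side {r} {A} {u} {v} p eq with adj? r u | adj? r v | trans (sym (deg-↭ r p)) eq
      ... | yes ru | no ¬rv | _  = inj₁ (ru , ¬rv)
      ... | no ¬ru | yes rv | _  = inj₂ (rv , ¬ru)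
      ... | yes _  | yes _  | ()
      ... | no _   | no _   | ()

      -- The cuts of the two halves are odd, at least 3 and sum to 6, so both are 3.
      cut₄  : ∀ k {U W} → length U ≤ k → Part U W → cross U W ≡ 4 → ∃[ u ] U ↭ u ∷ μ u ∷ []
      -- The cut of `A` is twice the degree of `r` in `A`. If `A` is nonempty this must be 4, so `A`
      -- is an edge and forms a triangle with `r`.
      limb₃ : ∀ k {r A W} → length A ≤ k → Limb r A W → cross (r ∷ A) W ≡ 3 → A ≡ []

      cut₄ zero {[]} _ _ ()
      cut₄ (suc k) {U} {W} len P eq = let x , x∈ = inhabited U {W} eq in go (halves P x∈)
        where
        go : Halves U W → ∃[ u ] U ↭ u ∷ μ u ∷ []
        go h = both (odd-cases limbˡ) (odd-cases limbʳ)
          where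
          open Halves h
          pair-of : A ≡ [] → B ≡ [] → U ↭ r ∷ μ r ∷ []
          pair-of refl refl = ↭-trans whole (↭-reflexive (cong (λ v → r ∷ v ∷ []) (sym mate-r)))
          both : _ → _ → ∃[ u ] U ↭ u ∷ μ u ∷ []
          both (inj₁ l) (inj₁ l′) = r , pair-of (limb₃ k (shorterˡ h len) limbˡ l) (limb₃ k (shorterˡ (swap-halves h) len) limbʳ l′)
          both (inj₂ l) _ = ⊥-elim (too-big 5 3 (≥5 l) (limb-bound limbʳ) (trans cuts (cong (_+ 2) eq)) (ℕₚ.n≤1+n 7))
          both (inj₁ _) (inj₂ l′) = ⊥-elim (too-big 3 5 (limb-bound limbˡ) (≥5 l′) (trans cuts (cong (_+ 2) eq)) (ℕₚ.n≤1+n 7))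

      limb₃ k {r} {A} {W} len L eq = go (deg r A) refl (limb-deg L) (empty-or-bound (Limb.part L))
        where
        c₀ : ∀ d → deg r A ≡ d → cross A (r ∷ W) ≡ 2 * d
        c₀ d refl = ℕₚ.+-cancelʳ-≡ 3 _ _ (trans (limb-move L) (trans (cong (_+ 2 * deg r A) eq) (ℕₚ.+-comm 3 (2 * deg r A))))
        go : ∀ d → deg r A ≡ d → d ≤ 2 → A ≡ [] ⊎ 4 ≤ cross A (r ∷ W) → A ≡ []
        go _ _ _ (inj₁ e) = e
        go 0 e _ (inj₂ le) = contradiction (subst (4 ≤_) (c₀ 0 e) le) λ ()
        go 1 e _ (inj₂ le) = contradiction (subst (4 ≤_) (c₀ 1 e) le) λ { (s≤s (s≤s ())) }
        go 2 e _ (inj₂ le) = let u , p = cut₄ k len (Limb.part L) (c₀ 2 e)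
                                 ru , rv = edge-sides p e
                             in ⊥-elim (no-triangle ru (μ-adj u) (adj-sym rv))
        go (suc (suc (suc _))) _ (s≤s (s≤s ())) _

      -- The cuts of the halves sum to 8, so one half is a single vertex and the other is described
      -- by `limb₅`.
      six   : ∀ k {U W} → length U ≤ k → Part U W → cross U W ≡ 6 → Six U
      -- The cut of `A` is 2 plus twice the degree of `r` in `A`: degree 1 leaves an edge, degree 2
      -- a set from `six`, where short cycles permit only the completion of a path to a pentagon.
      limb₅ : ∀ k {r A W} → length A ≤ k → Limb r A W → cross (r ∷ A) W ≡ 5 → Limb₅ r A

      six zero {[]} _ _ ()
      six (suc k) {U} {W} len P eq = let x , x∈ = inhabited U {W} eq in go (halves P x∈)
        where
        leaf-limb : (h : Halves U W) → cross (Halves.r h ∷ Halves.A h) (Halves.s h ∷ Halves.B h ++ W) ≡ 3 → Six U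
        leaf-limb h e = go (limb₃ k (shorterˡ h len) limbˡ e) (limb₅ k (shorterˡ (swap-halves h) len) limbʳ
            (ℕₚ.+-cancelˡ-≡ 3 _ 5 (trans (cong (_+ cross (s ∷ B) (r ∷ A ++ W)) (sym e)) (trans cuts (cong (_+ 2) eq)))))
          where
          open Halves h
          go : A ≡ [] → Limb₅ s B → Six U
          go refl (path x p rx _) = path r x (↭-trans whole (prep r (↭-trans (prep s p) (↭-reflexive (cong (_∷ x ∷ μ x ∷ []) (sym mate-r))))))
                                      (subst (λ v → Adj v x) (sym mate-r) rx)
          go refl (pent x y p sx xy ys) = pendant r x y (↭-trans whole (prep r (↭-trans (prep s p) (↭-reflexive (cong (_∷ x ∷ μ x ∷ y ∷ μ y ∷ []) (sym mate-r))))))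
                                      (subst (λ v → Adj v x) (sym mate-r) sx) xy (subst (Adj (μ y)) (sym mate-r) ys)
        go : Halves U W → Six U
        go h = both (odd-cases (Halves.limbˡ h)) (odd-cases (Halves.limbʳ h))
          where
          both : _ → _ → Six U
          both (inj₁ l) _ = leaf-limb h l
          both (inj₂ _) (inj₁ l′) = leaf-limb (swap-halves h) l′
          both (inj₂ l) (inj₂ l′) = ⊥-elim (too-big 5 5 (≥5 l) (≥5 l′) (trans (Halves.cuts h) (cong (_+ 2) eq)) (ℕₚ.n≤1+n 9))

      limb₅ k {r} {A} {W} len L eq = go (deg r A) refl (limb-deg L) (empty-or-bound (Limb.part L))
        where
        c₀ : ∀ d → deg r A ≡ d → cross A (r ∷ W) ≡ 2 + 2 * d
        c₀ d refl = ℕₚ.+-cancelʳ-≡ 3 _ _ (trans (limb-move L) (trans (cong (_+ 2 * deg r A) eq) (mix (deg r A))))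
          where
          mix : ∀ d → 5 + 2 * d ≡ 2 + 2 * d + 3
          mix = solve-∀
        rA-unique : Unique (r ∷ A)
        rA-unique = split-uniqueˡ (Limb.lsp L)
        A-unique : Unique A
        A-unique = unique-++ʳ (r ∷ []) rA-unique
        r≢A : ∀ {v L′} → A ↭ L′ → v ∈ L′ → r ≢ v
        r≢A p v∈ refl = unique-disjoint {xs = r ∷ []} rA-unique (here refl) (↭ₚ.∈-resp-↭ (↭-sym p) v∈)
        two : Six A → deg r A ≡ 2 → Limb₅ r A
        two (path p s A↭ qs) e = let y , z , y∈ , z∈ , y≢z , ry , rz = deg-pair {r} A e A-unique
                                     rp , tr = path-ends (μ-adj p) qs (μ-adj s) (unique-resp-↭ A↭ A-unique) (r≢A A↭)
                                                 (↭ₚ.∈-resp-↭ A↭ y∈) (↭ₚ.∈-resp-↭ A↭ z∈) y≢z ry rz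
                                 in pent p s A↭ rp qs tr
        two (pendant a p s A↭ bp qs tb) e =
          let y , z , y∈ , z∈ , y≢z , ry , rz = deg-pair {r} A e A-unique
          in ⊥-elim (pendant-full (μ-adj a) bp (μ-adj p) qs (μ-adj s) tb (unique-resp-↭ A↭ A-unique) (r≢A A↭)
                       (↭ₚ.∈-resp-↭ A↭ y∈) (↭ₚ.∈-resp-↭ A↭ z∈) y≢z ry rz)
        go : ∀ d → deg r A ≡ d → d ≤ 2 → A ≡ [] ⊎ 4 ≤ cross A (r ∷ W) → Limb₅ r A
        go d e _ (inj₁ refl) = contradiction (c₀ 0 refl) λ ()
        go 0 e _ (inj₂ le) = contradiction (subst (4 ≤_) (c₀ 0 e) le) λ { (s≤s (s≤s ())) }
        go 1 e _ (inj₂ le) = let u , p = cut₄ k len (Limb.part L) (c₀ 1 e) in [ (λ (ru , ¬rv) → path u p ru ¬rv)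
          , (λ (rv , ¬ru) → path (μ u) (↭-trans p (↭-trans (swap u (μ u) ↭-refl) (↭-reflexive (cong (λ v → μ u ∷ v ∷ []) (sym (μμ u))))))
                                 rv (subst (λ v → ¬ Adj r v) (sym (μμ u)) ¬ru)) ]′ (one-side p e)
        go 2 e _ (inj₂ le) = two (six k len (Limb.part L) (c₀ 2 e)) e
        go (suc (suc (suc _))) _ (s≤s (s≤s ())) _

    -- Sets with 8 cut edges, and the removal of a leaf with its mate.

    module Steps where

      open Cuts renaming (a to adjacency)
      open Matchings
      open Classification
      open Pieces

      record Pent (r : V) (A : List V) : Set where
        constructor mkPent
        field
          p s  : V
          A↭   : A ↭ p ∷ μ p ∷ s ∷ μ s ∷ []
          rp   : Adj r p
          qs   : Adj (μ p) s
          tr   : Adj (μ s) r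

      data Eight (U : List V) : Set where
        leaf : ∀ a U′ → U ↭ a ∷ μ a ∷ U′ → deg a U′ ≡ 0 → Eight U
        pentagons : ∀ r A s B → U ↭ (r ∷ A) ++ (s ∷ B) → μ r ≡ s → cross (r ∷ A) (s ∷ B) ≡ 1 → Pent r A → Pent s B → Eight U

      -- The cuts of the halves sum to 10. A half with 3 cut edges is a leaf. If both have 5, a half
      -- that is a path ends in a leaf, and otherwise both are pentagons.
      eight : ∀ {U W} → Part U W → cross U W ≡ 8 → Eight U
      eight {U} {W} P eq = let x , x∈ = inhabited U {W} eq in go (halves P x∈)
        where
        leaf-limb : (h : Halves U W) → cross (Halves.r h ∷ Halves.A h) (Halves.s h ∷ Halves.B h ++ W) ≡ 3 → Eight U
        leaf-limb h e = go (limb₃ (length A) ℕₚ.≤-refl limbˡ e)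
          where
          open Halves h
          go : A ≡ [] → Eight U
          go refl = leaf r B (↭-trans whole (↭-reflexive (cong (λ v → r ∷ v ∷ B) (sym mate-r))))
            (ℕₚ.suc-injective (trans (cong (_+ deg r B) (sym (a-adj (subst (Adj r) mate-r (μ-adj r))))) (trans (sym (ℕₚ.+-identityʳ _)) single)))
        path-limb : (h : Halves U W) → ∀ x → Halves.A h ↭ x ∷ μ x ∷ [] → ¬ Adj (Halves.r h) (μ x) → Eight U
        path-limb h x p ¬ry = leaf (μ x) (r ∷ s ∷ B)
            (↭-trans whole (↭-trans (prep r (↭ₚ.++⁺ʳ (s ∷ B) p)) (↭-trans
              (solve 4 (λ r x y B → r ⊕ ((x ⊕ y) ⊕ B) ⊜ y ⊕ (x ⊕ (r ⊕ B))) ↭-refl [ r ] [ x ] [ μ x ] (s ∷ B))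
              (↭-reflexive (cong (λ v → μ x ∷ v ∷ r ∷ s ∷ B) (sym (μμ x)))))))
            (cong₂ _+_ (a-nonadj (¬ry ∘ adj-sym)) (sum-map-0 (λ v → deg v (s ∷ B)) A no-cross (↭ₚ.∈-resp-↭ (↭-sym p) (there (here refl)))))
          where
          open Halves h
          no-cross : cross A (s ∷ B) ≡ 0
          no-cross = ℕₚ.m+n≡0⇒n≡0 (deg r B) (ℕₚ.suc-injective (trans (cong (λ k → k + deg r B + cross A (s ∷ B)) (sym (a-adj (subst (Adj r) mate-r (μ-adj r))))) single))
        go : Halves U W → Eight U
        go h = both (odd-cases limbˡ) (odd-cases limbʳ)
          where
          open Halves h
          both-five : Limb₅ r A → Limb₅ s B → Eight U
          both-five (path x p _ ¬ry) _ = path-limb h x p ¬ry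
          both-five _ (path x p _ ¬ry) = path-limb (swap-halves h) x p ¬ry
          both-five (pent p s A↭ rp qs tr) (pent p′ s′ B↭ rp′ qs′ tr′) =
            pentagons r A (Halves.s h) B whole mate-r single (mkPent p s A↭ rp qs tr) (mkPent p′ s′ B↭ rp′ qs′ tr′)
          both : _ → _ → Eight U
          both (inj₁ l) _ = leaf-limb h l
          both (inj₂ _) (inj₁ l′) = leaf-limb (swap-halves h) l′
          both (inj₂ (inj₁ l)) (inj₂ (inj₁ l′)) =
            both-five (limb₅ (length A) ℕₚ.≤-refl limbˡ l) (limb₅ (length B) ℕₚ.≤-refl limbʳ l′)
          both (inj₂ (inj₂ l)) (inj₂ l′) = ⊥-elim (too-big 7 5 l (≥5 l′) (trans cuts (cong (_+ 2) eq)) (ℕₚ.n≤1+n 11))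
          both (inj₂ (inj₁ l)) (inj₂ (inj₂ l′)) = ⊥-elim (too-big 5 7 (ℕₚ.≤-reflexive (sym l)) l′ (trans cuts (cong (_+ 2) eq)) (ℕₚ.n≤1+n 11))

      Connected : List V → Set
      Connected U = ∀ {x y} → x ∈ U → y ∈ U → Reach (_∈ U) x y

      record Separated (U : List V) : Set where
        field
          C R   : List V
          {c r} : V
          whole : U ↭ C ++ R
          c∈    : c ∈ C
          r∈    : r ∈ R
          apart : cross C R ≡ 0

      connected? : ∀ U → Connected U ⊎ Separated U
      connected? [] = inj₁ λ ()
      connected? U@(u ∷ U′) = search (length U′) (u ∷ []) U′ ℕₚ.≤-refl ↭-refl (here refl) λ { (here refl) → here }
        where
        search : ∀ k C R → length R ≤ k → U ↭ C ++ R → u ∈ C → (∀ {c} → c ∈ C → Reach (_∈ U) u c) → Connected U ⊎ Separated U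
        search k C [] _ p u∈ reach = inj₁ λ x∈ y∈ → reach-trans (reach-sym (here refl) (reach (all x∈))) (reach (all y∈))
          where
          all : ∀ {x} → x ∈ U → x ∈ C
          all x∈ = subst (_ ∈_) (Listₚ.++-identityʳ C) (↭ₚ.∈-resp-↭ p x∈)
        search (suc k) C R@(r ∷ _) len p u∈ reach = go (Any.any? (λ c → Any.any? (adj? c) R) C)
          where
          extend : ∀ {c t} → c ∈ C → t ∈ R → Adj c t → Connected U ⊎ Separated U
          extend {c} {t} c∈ t∈ ct = let R′ , q = pull-out t∈ in
            search k (t ∷ C) R′ (ℕₚ.≤-pred (subst (_≤ suc k) (↭ₚ.↭-length q) len))
              (↭-trans p (↭-trans (↭ₚ.++⁺ˡ C q) (↭ₚ.shift t C R′))) (there u∈)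
              (λ { (here refl) → reach-trans (reach c∈) (step ct (↭ₚ.∈-resp-↭ (↭-sym p) (∈ₚ.∈-++⁺ʳ C t∈)) here) ; (there c′∈) → reach c′∈ })
          go : Dec (Any (λ c → Any (Adj c) R) C) → Connected U ⊎ Separated U
          go (yes found) = let c , c∈ , found′ = find found
                               t , t∈ , ct = find found′
                           in extend c∈ t∈ ct
          go (no ¬found) = inj₂ (record { C = C ; R = R ; whole = p ; c∈ = u∈ ; r∈ = here refl
            ; apart = trans (sum-map-const (λ c → deg c R) 0 C (λ {c} c∈ → deg-none c R (λ t∈ ct →
                        ¬found (lose c∈ (lose t∈ ct))))) (ℕₚ.*-zeroʳ (length C)) })

      apart-¬adj : ∀ {C R c r} → cross C R ≡ 0 → c ∈ C → r ∈ R → ¬ Adj c r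
      apart-¬adj {C} {R} eq c∈ r∈ = deg-0 R (sum-map-0 (λ c → deg c R) C eq c∈) r∈

      module Sides {U W} (P : Part U W) (S : Separated U) where
        open Separated S

        C-closed : Closed C
        C-closed {x} x∈ = go (∈ₚ.∈-++⁻ C (↭ₚ.∈-resp-↭ whole (mpm⇒closed (Part.mpm P) (↭ₚ.∈-resp-↭ (↭-sym whole) (∈ₚ.∈-++⁺ˡ x∈)))))
          where
          go : μ x ∈ C ⊎ μ x ∈ R → μ x ∈ C
          go (inj₁ p) = p
          go (inj₂ p) = contradiction (μ-adj x) (apart-¬adj apart x∈ p)

        R-closed : Closed R
        R-closed {x} x∈ = go (∈ₚ.∈-++⁻ C (↭ₚ.∈-resp-↭ whole (mpm⇒closed (Part.mpm P) (↭ₚ.∈-resp-↭ (↭-sym whole) (∈ₚ.∈-++⁺ʳ C x∈)))))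
          where
          go : μ x ∈ C ⊎ μ x ∈ R → μ x ∈ R
          go (inj₁ p) = contradiction (adj-sym (μ-adj x)) (apart-¬adj apart p x∈)
          go (inj₂ p) = p

        CR-unique : Unique (C ++ R)
        CR-unique = unique-resp-↭ whole (split-uniqueˡ (Part.sp P))

        mC : MPM C
        mC = closed⇒mpm (length C) ℕₚ.≤-refl (unique-++ˡ CR-unique) C-closed

        mR : MPM R
        mR = closed⇒mpm (length R) ℕₚ.≤-refl (unique-++ʳ C CR-unique) R-closed

        partC : Part C (R ++ W)
        partC = part-sub whole P mC mR

        partR : Part R (C ++ W)
        partR = part-sub (↭-trans whole (↭ₚ.++-comm C R)) P mR mC

        total : cross C (R ++ W) + cross R (C ++ W) ≡ cross U W
        total = begin
          cross C (R ++ W) + cross R (C ++ W)                       ≡⟨ cong₂ _+_ (cross-++ʳ C R W) (cross-++ʳ R C W) ⟩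
          (cross C R + cross C W) + (cross R C + cross R W)         ≡⟨ cong₂ (λ k l → (k + cross C W) + (l + cross R W)) apart (trans (cross-sym R C) apart) ⟩
          cross C W + cross R W                                     ≡⟨ cross-++ˡ C R W ⟨
          cross (C ++ R) W                                          ≡⟨ cross-↭ˡ W whole ⟨
          cross U W                                                 ∎
          where open ≡-Reasoning

        ≥4ˡ : 4 ≤ cross C (R ++ W)
        ≥4ˡ = part-bound partC c∈

        ≥4ʳ : 4 ≤ cross R (C ++ W)
        ≥4ʳ = part-bound partR r∈

      -- Separated pieces are unions of matching edges and inherit uniqueness, so each contributes
      -- at least 4 cut edges.
      connected-≤6 : ∀ {U W} → Part U W → cross U W ≤ 6 → Connected U
      connected-≤6 {U} P le = [ id , (λ S → ⊥-elim (ℕₚ.<⇒≱ (s≤s le) (ℕₚ.≤-trans (ℕₚ.n≤1+n 7) (ℕₚ.≤-trans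
          (ℕₚ.+-mono-≤ (Sides.≥4ˡ P S) (Sides.≥4ʳ P S)) (ℕₚ.≤-reflexive (Sides.total P S)))))) ]′ (connected? U)

      record TwoEdges (U : List V) : Set where
        constructor mkTwo
        field
          u v   : V
          whole : U ↭ u ∷ μ u ∷ v ∷ μ v ∷ []
          apart : cross (u ∷ μ u ∷ []) (v ∷ μ v ∷ []) ≡ 0

      -- Two separated pieces must have exactly 4 cut edges each, and then `cut₄` applies to both.
      connected-8 : ∀ {U W} → Part U W → cross U W ≡ 8 → Connected U ⊎ TwoEdges U
      connected-8 {U} {W} P eq = [ inj₁ , (λ S → inj₂ (two S)) ]′ (connected? U)
        where
        two : Separated U → TwoEdges U
        two S = mkTwo (proj₁ c₄) (proj₁ r₄) (↭-trans whole (↭ₚ.++⁺ (proj₂ c₄) (proj₂ r₄)))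
                  (trans (cross-↭ʳ (proj₁ c₄ ∷ μ (proj₁ c₄) ∷ []) (↭-sym (proj₂ r₄))) (trans (cross-↭ˡ R (↭-sym (proj₂ c₄))) apart))
          where
          open Separated S
          open Sides P S
          exactly : ∀ {a b} → 4 ≤ a → 4 ≤ b → a + b ≡ 8 → a ≡ 4
          exactly {a} {b} a≥ b≥ e = ℕₚ.≤-antisym (ℕₚ.+-cancelʳ-≤ 4 a 4 (ℕₚ.≤-trans (ℕₚ.+-monoʳ-≤ a b≥) (ℕₚ.≤-reflexive e))) a≥
          c₄ : ∃[ u ] C ↭ u ∷ μ u ∷ []
          c₄ = cut₄ (length C) ℕₚ.≤-refl partC (exactly ≥4ˡ ≥4ʳ (trans total eq))
          r₄ : ∃[ u ] R ↭ u ∷ μ u ∷ []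
          r₄ = cut₄ (length R) ℕₚ.≤-refl partR (exactly ≥4ʳ ≥4ˡ (trans (ℕₚ.+-comm _ (cross C (R ++ W))) (trans total eq)))

      module LeafStep {U W a U′} (P : Part U W) (U↭ : U ↭ a ∷ μ a ∷ U′) (leaf : deg a U′ ≡ 0) where

        b : V
        b = μ a

        U-unique : Unique (a ∷ b ∷ U′)
        U-unique = unique-resp-↭ U↭ (split-uniqueˡ (Part.sp P))

        part′ : Part U′ (a ∷ b ∷ W)
        part′ = part-sub (↭-trans U↭ (↭ₚ.++-comm (a ∷ b ∷ []) U′)) P
                  (closed⇒mpm (length U′) ℕₚ.≤-refl (unique-++ʳ (a ∷ b ∷ []) U-unique) closed) (pair a none ↭-refl)
          where
          closed : Closed U′
          closed {x} x∈ = go (↭ₚ.∈-resp-↭ U↭ (mpm⇒closed (Part.mpm P) (↭ₚ.∈-resp-↭ (↭-sym U↭) (there (there x∈)))))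
            where
            go : μ x ∈ a ∷ b ∷ U′ → μ x ∈ U′
            go (here e) = contradiction x∈ (unique-disjoint {xs = a ∷ b ∷ []} U-unique (there (here (trans (sym (μμ x)) (cong μ e)))))
            go (there (here e)) = contradiction x∈ (unique-disjoint {xs = a ∷ b ∷ []} U-unique (here (trans (sym (μμ x)) (trans (cong μ e) (μμ a)))))
            go (there (there q)) = q

        split₁ : Split (a ∷ b ∷ U′) W
        split₁ = split-↭ U↭ ↭-refl (Part.sp P)

        ab : adjacency a b ≡ 1
        ab = a-adj (μ-adj a)

        deg-a : deg a W ≡ 2
        deg-a = ℕₚ.suc-injective (trans (cong (_+ deg a W) (sym (cong₂ _+_ (a-irrefl a) (cong₂ _+_ ab leaf)))) (split-deg split₁ a))

        deg-b : deg b U′ + deg b W ≡ 2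
        deg-b = ℕₚ.suc-injective (trans (cong (_+ deg b W) (sym (cong₂ _+_ (trans (a-sym b a) ab) (cong (_+ deg b U′) (a-irrefl b))))) (split-deg split₁ b))

        -- Starting from 8, the cut becomes 4, 6 or 8 as the mate `b` has 0, 1 or 2 neighbours left
        -- in `U′`.
        cut′ : cross U′ (a ∷ b ∷ W) + 4 ≡ cross U W + 2 * deg b U′
        cut′ = begin
          cross U′ (a ∷ b ∷ W) + 4                             ≡⟨ cong (_+ 4) (trans (cross-∷ʳ U′ a (b ∷ W)) (cong₂ _+_ leaf (cross-∷ʳ U′ b W))) ⟩
          deg b U′ + cross U′ W + 4                            ≡⟨ mix (deg b U′) (cross U′ W) ⟩
          2 + 2 + cross U′ W + deg b U′                        ≡⟨ cong (λ k → 2 + k + cross U′ W + deg b U′) deg-b ⟨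
          2 + (deg b U′ + deg b W) + cross U′ W + deg b U′     ≡⟨ mix′ (deg b U′) (deg b W) (cross U′ W) ⟩
          2 + (deg b W + cross U′ W) + 2 * deg b U′            ≡⟨ cong (_+ 2 * deg b U′) (trans (cross-↭ˡ W U↭) (cong (_+ (deg b W + cross U′ W)) deg-a)) ⟨
          cross U W + 2 * deg b U′                             ∎
          where
          open ≡-Reasoning
          mix : ∀ d c → d + c + 4 ≡ 2 + 2 + c + d
          mix = solve-∀
          mix′ : ∀ d w c → 2 + (d + w) + c + d ≡ 2 + (w + c) + 2 * d
          mix′ = solve-∀

    -- The faces around two pentagons joined by a bridge.

    module Rings where

      open Cuts
      open ShortCycles
      open Matchings
      open Classification
      open Pieces
      open Steps
      open Patches
      open Trails

      -- The pentagon as a face traced from its root `r`. The numbering makes the edge off the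
      -- pentagon at the head of `e₄`, that is at `r`, the bridge.
      record Ring (r : V) (A : List V) : Set where
        field
          e₀ e₁ e₂ e₃ e₄ : Dart
          at  : src e₀ ≡ r
          f₀ : φ e₀ ≡ e₁
          f₁ : φ e₁ ≡ e₂
          f₂ : φ e₂ ≡ e₃
          f₃ : φ e₃ ≡ e₄
          f₄ : φ e₄ ≡ e₀
          A↭ : A ↭ tgt e₀ ∷ tgt e₁ ∷ tgt e₂ ∷ tgt e₃ ∷ []

      ring : ∀ {r A} → Pent r A → Unique (r ∷ A) → Ring r A
      ring {r} {A} (mkPent p s A↭ rp qs tr) uniq = orient (pentagon rp pq qs st tr r≢q p≢s q≢t s≢r t≢p)
        where
        q t : V
        q = μ p
        t = μ s
        pq : Adj p q
        pq = μ-adj p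
        st : Adj s t
        st = μ-adj s
        uniq′ : Unique (r ∷ p ∷ q ∷ s ∷ t ∷ [])
        uniq′ = unique-resp-↭ (prep r A↭) uniq
        r≢q : r ≢ q
        r≢q = unique-head uniq′ (there (here refl))
        s≢r : s ≢ r
        s≢r = ≢-sym (unique-head uniq′ (there (there (here refl))))
        p≢s : p ≢ s
        p≢s = unique-head (unique-tail uniq′) (there (here refl))
        t≢p : t ≢ p
        t≢p = ≢-sym (unique-head (unique-tail uniq′) (there (there (here refl))))
        q≢t : q ≢ t
        q≢t = unique-head (unique-tail (unique-tail uniq′)) (there (here refl))
        orient : Pentagon (dart rp) (dart pq) (dart qs) (dart st) (dart tr) ⊎
                 Pentagon (α (dart tr)) (α (dart st)) (α (dart qs)) (α (dart pq)) (α (dart rp)) → Ring r A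
        orient (inj₁ (f₀ , f₁ , f₂ , f₃ , f₄)) = record
          { at = refl ; f₀ = f₀ ; f₁ = f₁ ; f₂ = f₂ ; f₃ = f₃ ; f₄ = f₄
          ; A↭ = ↭-trans A↭ (↭-reflexive (sym (cong₂ _∷_ (dart-tgt rp) (cong₂ _∷_ (dart-tgt pq) (cong₂ _∷_ (dart-tgt qs) (cong (_∷ []) (dart-tgt st))))))) }
        orient (inj₂ (f₀ , f₁ , f₂ , f₃ , f₄)) = record
          { at = dart-tgt tr ; f₀ = f₀ ; f₁ = f₁ ; f₂ = f₂ ; f₃ = f₃ ; f₄ = f₄
          ; A↭ = ↭-trans A↭ (↭-trans (↭-sym (↭ₚ.↭-reverse (p ∷ q ∷ s ∷ t ∷ [])))
                   (↭-reflexive (sym (cong₂ _∷_ (tgt-α (dart tr)) (cong₂ _∷_ (tgt-α (dart st)) (cong₂ _∷_ (tgt-α (dart qs)) (cong (_∷ []) (tgt-α (dart pq))))))))) }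

      -- The dart leaving a pentagonal face at the head of e.
      spoke : Dart → Dart
      spoke e = ν (φ e)

      -- A spoke ending on the pentagon would be a loop, a pentagon edge, or a chord that completes
      -- a triangle.
      spoke-∉ : ∀ {e₀ e₁ e₂ e₃ e₄} → φ e₀ ≡ e₁ → φ e₁ ≡ e₂ → φ e₂ ≡ e₃ → φ e₃ ≡ e₄ → φ e₄ ≡ e₀ →
                tgt (spoke e₀) ∉ tgt e₀ ∷ tgt e₁ ∷ tgt e₂ ∷ tgt e₃ ∷ tgt e₄ ∷ []
      spoke-∉ {e₀} refl refl refl refl f₄ = λ
        { (here e) → loopless (src (spoke e₀)) (proj₂ (spoke e₀)) e
        ; (there (here e)) → ν-≢ (φ e₀) (dart-≡ refl e)
        ; (there (there (here e))) → no-chord (adj-tgt (φ e₀)) (adj-tgt (φ^ 2 e₀)) (subst (Adj (tgt e₀)) e (adj-tgt (spoke e₀)))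
        ; (there (there (there (here e)))) →
            no-chord (adj-sym (adj-tgt e₀)) (adj-sym (subst (Adj (tgt (φ^ 3 e₀))) back (adj-tgt (φ^ 4 e₀)))) (subst (Adj (tgt e₀)) e (adj-tgt (spoke e₀)))
        ; (there (there (there (there (here e))))) → ν²-≢ (α e₀) (dart-≡ refl (trans e (trans back (sym (tgt-α e₀))))) }
        where
        back : tgt (φ^ 4 e₀) ≡ src e₀
        back = cong src f₄

      -- The outer face along the edge `φ e` passes just the two ends of this edge: the entry 2 of
      -- `pentagonal`.
      inner-face : ∀ e → φ^ 2 (α (spoke (φ e))) ≡ spoke e
      inner-face e = trans (cong (φ ∘ ν) (α-involutive (spoke (φ e)))) (trans (cong φ (ν³ (α (φ e)))) (cong ν (α-involutive (φ e))))

      module TwoRings {U W r A s B d ds w} (part : Part U W) (whole : U ↭ (r ∷ A) ++ (s ∷ B)) (rs : Adj r s)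
                      (single : cross (r ∷ A) (s ∷ B) ≡ 1) (X : Ring r A) (Y : Ring s B)
                      (P : Patch W d ds w) (outside : ∀ {y z} → y ∉ W → z ∉ W → Reach (_∉ W) y z) where

        module X = Ring X
        module Y = Ring Y

        rAsB-unique : Unique ((r ∷ A) ++ (s ∷ B))
        rAsB-unique = unique-resp-↭ whole (split-uniqueˡ (Part.sp part))

        A-B : ∀ {v} → v ∈ r ∷ A → v ∉ s ∷ B
        A-B = unique-disjoint rAsB-unique

        in-W : ∀ {v} → v ∉ r ∷ A → v ∉ s ∷ B → v ∈ W
        in-W {v} v∉ v∉′ = case split-∈ (split-↭ whole ↭-refl (Part.sp part)) v of λ
          { (inj₁ v∈) → ⊥-elim ([ v∉ , v∉′ ]′ (∈ₚ.∈-++⁻ (r ∷ A) v∈)) ; (inj₂ v∈) → v∈ }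

        out-W : ∀ {v} → v ∈ (r ∷ A) ++ (s ∷ B) → v ∉ W
        out-W = split-disjoint (split-↭ whole ↭-refl (Part.sp part))

        no-crossˡ : cross A (s ∷ B) ≡ 0
        no-crossˡ = ℕₚ.m+n≡0⇒n≡0 (deg r B) (ℕₚ.suc-injective (trans (cong (λ k → k + deg r B + cross A (s ∷ B)) (sym (a-adj rs))) single))

        no-crossʳ : cross B (r ∷ A) ≡ 0
        no-crossʳ = ℕₚ.m+n≡0⇒n≡0 (deg s A) (ℕₚ.suc-injective (trans (cong (λ k → k + deg s A + cross B (r ∷ A)) (sym (a-adj (adj-sym rs))))
                      (trans (cross-sym (s ∷ B) (r ∷ A)) single)))

        legs-out : ∀ {r A s B} → (∀ {v} → v ∈ A → v ∉ W) → (∀ {v} → v ∉ r ∷ A → v ∉ s ∷ B → v ∈ W) →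
                   (∀ {u v} → u ∈ A → v ∈ s ∷ B → ¬ Adj u v) →
                   (Z : Ring r A) → let open Ring Z in
                   Out W (α (spoke e₀)) × Out W (α (spoke e₁)) × Out W (α (spoke e₂)) × Out W (α (spoke e₃))
        legs-out {r} {A} {s} {B} A∉W inW ¬cross Z =
          leg (mem (here refl)) (λ v∈ → spoke-∉ f₀ f₁ f₂ f₃ f₄ (five v∈)) ,
          leg (mem (there (here refl))) (λ v∈ → spoke-∉ f₁ f₂ f₃ f₄ f₀ (rot1 (five v∈))) ,
          leg (mem (there (there (here refl)))) (λ v∈ → spoke-∉ f₂ f₃ f₄ f₀ f₁ (rot1 (rot1 (five v∈)))) ,
          leg (mem (there (there (there (here refl))))) (λ v∈ → spoke-∉ f₃ f₄ f₀ f₁ f₂ (rot1 (rot1 (rot1 (five v∈)))))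
          where
          open Ring Z
          mem : ∀ {v} → v ∈ tgt e₀ ∷ tgt e₁ ∷ tgt e₂ ∷ tgt e₃ ∷ [] → v ∈ A
          mem = ↭ₚ.∈-resp-↭ (↭-sym A↭)
          rot1 : ∀ {v a : V} {bs} → v ∈ a ∷ bs → v ∈ bs ++ [ a ]
          rot1 {bs = bs} (here e)  = ∈ₚ.∈-++⁺ʳ bs (here e)
          rot1 (there v∈) = ∈ₚ.∈-++⁺ˡ v∈
          closing-end : tgt e₄ ≡ r
          closing-end = trans (cong src f₄) at
          five : ∀ {v} → v ∈ r ∷ A → v ∈ tgt e₀ ∷ tgt e₁ ∷ tgt e₂ ∷ tgt e₃ ∷ tgt e₄ ∷ []
          five (here e) = there (there (there (there (here (trans e (sym closing-end))))))
          five (there v∈) = ∈ₚ.∈-++⁺ˡ (↭ₚ.∈-resp-↭ A↭ v∈)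
          leg : ∀ {e} → tgt e ∈ A → tgt (spoke e) ∉ r ∷ A → Out W (α (spoke e))
          leg {e} e∈ ∉rA = inW ∉rA (λ v∈ → ¬cross e∈ v∈ (adj-tgt (spoke e))) , subst (_∉ W) (sym (tgt-α (spoke e))) (A∉W e∈)

        X-legs : Out W (α (spoke X.e₀)) × Out W (α (spoke X.e₁)) × Out W (α (spoke X.e₂)) × Out W (α (spoke X.e₃))
        X-legs = legs-out (λ v∈ → out-W (∈ₚ.∈-++⁺ˡ (there v∈))) in-W (apart-¬adj no-crossˡ) X

        Y-legs : Out W (α (spoke Y.e₀)) × Out W (α (spoke Y.e₁)) × Out W (α (spoke Y.e₂)) × Out W (α (spoke Y.e₃))
        Y-legs = legs-out (λ v∈ → out-W (∈ₚ.∈-++⁺ʳ (r ∷ A) (there v∈))) (λ p q → in-W q p) (apart-¬adj no-crossʳ) Y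

        leg-≢ : ∀ {e e′} → tgt e′ ≢ tgt e → α (spoke e′) ≢ α (spoke e)
        leg-≢ ne eq = ne (cong src (α-injective eq))

        adjacent-≢ : ∀ {e e′} → φ e ≡ e′ → tgt e′ ≢ tgt e
        adjacent-≢ {e} refl eq = loopless (tgt e) (proj₂ (φ e)) eq

        inner : ∀ {e e′} → φ e ≡ e′ → φ^ 2 (α (spoke e′)) ≡ α (α (spoke e))
        inner {e} refl = trans (inner-face e) (sym (α-involutive (spoke e)))

        tgt-spoke : ∀ {r A s B} → (∀ {v} → v ∈ r ∷ A → v ∉ s ∷ B) → Adj r s → (Z : Ring r A) → tgt (spoke (Ring.e₄ Z)) ≡ s
        tgt-spoke {r} {A} {s} {B} disj rs Z = go (three-darts (α e₄) (dart rs) (sym (trans (cong src f₄) at)))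
          where
          open Ring Z
          mem : ∀ {v} → v ∈ tgt e₀ ∷ tgt e₁ ∷ tgt e₂ ∷ tgt e₃ ∷ [] → v ∈ r ∷ A
          mem = there ∘ ↭ₚ.∈-resp-↭ (↭-sym A↭)
          s∉ : s ∉ r ∷ A
          s∉ s∈ = disj s∈ (here refl)
          go : (dart rs ≡ α e₄) ⊎ (dart rs ≡ φ e₄) ⊎ (dart rs ≡ spoke e₄) → tgt (spoke e₄) ≡ s
          go (inj₁ eq) = contradiction (subst (_∈ r ∷ A) (trans (trans (sym (trans (tgt-α e₄) (sym (cong src f₃)))) (cong tgt (sym eq))) (dart-tgt rs)) (mem (there (there (there (here refl)))))) s∉
          go (inj₂ (inj₁ eq)) = contradiction (subst (_∈ r ∷ A) (trans (cong tgt (trans (sym f₄) (sym eq))) (dart-tgt rs)) (mem (here refl))) s∉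
          go (inj₂ (inj₂ eq)) = trans (cong tgt (sym eq)) (dart-tgt rs)

        bridge-end : ∀ {r A} (Z : Ring r A) → src (spoke (Ring.e₄ Z)) ≡ r
        bridge-end Z = trans (cong src (Ring.f₄ Z)) (Ring.at Z)

        -- The face along the bridge passes the first vertex of one ring, both roots, and the last
        -- vertex of the other ring: the entry 4.
        bridge-face : ∀ {r A s B} (Z : Ring r A) (Z′ : Ring s B) → tgt (spoke (Ring.e₄ Z)) ≡ s → tgt (spoke (Ring.e₄ Z′)) ≡ r →
                      φ^ 4 (α (spoke (Ring.e₀ Z′))) ≡ α (α (spoke (Ring.e₃ Z)))
        bridge-face Z Z′ t t′ = begin
          φ^ 4 (α (spoke Z′.e₀))    ≡⟨ cong (φ^ 3) (trans (cong ν (α-involutive (spoke Z′.e₀))) (ν³ (α Z′.e₀))) ⟩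
          φ^ 3 (α Z′.e₀)            ≡⟨ cong (φ^ 2) (trans (cong ν (α-involutive Z′.e₀)) (cong ν (sym Z′.f₄))) ⟩
          φ^ 2 (spoke Z′.e₄)        ≡⟨ cong (φ ∘ ν) (dart-≡ (trans t′ (sym (bridge-end Z))) (trans (tgt-α (spoke Z′.e₄)) (trans (bridge-end Z′) (sym t)))) ⟩
          φ (ν (spoke Z.e₄))        ≡⟨ cong φ (ν³ (α Z.e₄)) ⟩
          φ (α Z.e₄)                ≡⟨ trans (cong ν (α-involutive Z.e₄)) (cong ν (sym Z.f₃)) ⟩
          spoke Z.e₃                ≡⟨ α-involutive (spoke Z.e₃) ⟨
          α (α (spoke Z.e₃))        ∎
          where
          open ≡-Reasoning
          module Z = Ring Z
          module Z′ = Ring Z′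

        toY : tgt (spoke X.e₄) ≡ s
        toY = tgt-spoke A-B rs X

        toX : tgt (spoke Y.e₄) ≡ r
        toX = tgt-spoke {B = A} (λ p q → A-B q p) (adj-sym rs) Y

        A∋ : ∀ {v} → v ∈ tgt X.e₀ ∷ tgt X.e₁ ∷ tgt X.e₂ ∷ tgt X.e₃ ∷ [] → v ∈ r ∷ A
        A∋ = there ∘ ↭ₚ.∈-resp-↭ (↭-sym X.A↭)

        B∋ : ∀ {v} → v ∈ tgt Y.e₀ ∷ tgt Y.e₁ ∷ tgt Y.e₂ ∷ tgt Y.e₃ ∷ [] → v ∈ s ∷ B
        B∋ = there ∘ ↭ₚ.∈-resp-↭ (↭-sym Y.A↭)

        A≢B : ∀ {u v} → u ∈ r ∷ A → v ∈ s ∷ B → u ≢ v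
        A≢B u∈ v∈ refl = A-B u∈ v∈

        2≤4 : 2 ≤ 4
        2≤4 = s≤s (s≤s z≤n)

        trail : Trail W (α (spoke X.e₀)) (2 ∷ 2 ∷ 2 ∷ 4 ∷ 2 ∷ 2 ∷ 2 ∷ 4 ∷ [])
        trail =
          turn 2 2≤4 (proj₁ (proj₂ X-legs)) (leg-≢ (adjacent-≢ X.f₀)) (inner X.f₀)
          (turn 2 2≤4 (proj₁ (proj₂ (proj₂ X-legs))) (leg-≢ (adjacent-≢ X.f₁)) (inner X.f₁)
          (turn 2 2≤4 (proj₂ (proj₂ (proj₂ X-legs))) (leg-≢ (adjacent-≢ X.f₂)) (inner X.f₂)
          (turn 4 ℕₚ.≤-refl (proj₁ Y-legs) (leg-≢ (≢-sym (A≢B (A∋ (there (there (there (here refl))))) (B∋ (here refl))))) (bridge-face X Y toY toX)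
          (turn 2 2≤4 (proj₁ (proj₂ Y-legs)) (leg-≢ (adjacent-≢ Y.f₀)) (inner Y.f₀)
          (turn 2 2≤4 (proj₁ (proj₂ (proj₂ Y-legs))) (leg-≢ (adjacent-≢ Y.f₁)) (inner Y.f₁)
          (turn 2 2≤4 (proj₂ (proj₂ (proj₂ Y-legs))) (leg-≢ (adjacent-≢ Y.f₂)) (inner Y.f₂)
          (turn 4 ℕₚ.≤-refl (proj₁ X-legs) (leg-≢ (A≢B (A∋ (here refl)) (B∋ (there (there (there (here refl))))))) (bridge-face Y X toX toY)
          stop)))))))

        word : ∃[ w′ ] Rotation w w′ × Follows (2 ∷ 2 ∷ 2 ∷ 4 ∷ 2 ∷ 2 ∷ 2 ∷ 4 ∷ []) w′
        word = let ds′ , w′ , ρ , Q = rotate-to P (Patch.complete P (proj₁ X-legs)) in w′ , ρ , follow Q outside trail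

    -- Removing leaves, guided by the search.

    module Game (n≢24 : n ≢ 24) where

      open Cuts renaming (a to adjacency)
      open ShortCycles
      open Matchings
      open Classification
      open Pieces
      open Steps
      open Patches
      open PatchMoves
      open Rings

      Outside : List V → Set
      Outside W = ∀ {y z} → y ∉ W → z ∉ W → Reach (_∉ W) y z

      outside : ∀ {U W} → Split U W → Connected U → Outside W
      outside {U} {W} S conn y∉ z∉ = reach-map (split-disjoint S) (conn (in-U y∉) (in-U z∉))
        where
        in-U : ∀ {y} → y ∉ W → y ∈ U
        in-U {y} y∉ = [ id , (λ y∈ → contradiction y∈ y∉) ]′ (split-∈ S y)

      connected-∷ : ∀ {U b u} → Connected U → u ∈ U → Adj b u → Connected (b ∷ U)
      connected-∷ {U} {b} {u} conn u∈ bu x∈ y∈ = reach-trans (to-u x∈) (reach-sym y∈ (to-u y∈))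
        where
        to-u : ∀ {x} → x ∈ b ∷ U → Reach (_∈ b ∷ U) x u
        to-u (here refl) = step bu (there u∈) here
        to-u (there x∈) = reach-map there (conn x∈ u∈)

      cut-off : ∀ {U C R c r} → Unique U → U ↭ C ++ R → cross C R ≡ 0 → c ∈ C → r ∈ R → ¬ Connected U
      cut-off {U} {C} {R} uniq p eq c∈ r∈ conn =
        go c∈ (conn (↭ₚ.∈-resp-↭ (↭-sym p) (∈ₚ.∈-++⁺ˡ c∈)) (↭ₚ.∈-resp-↭ (↭-sym p) (∈ₚ.∈-++⁺ʳ C r∈))) r∈
        where
        go : ∀ {c r} → c ∈ C → Reach (_∈ U) c r → r ∈ R → ⊥
        go c∈ here r∈ = unique-disjoint (unique-resp-↭ p uniq) c∈ r∈
        go {c} c∈ (step {w = w} cw w∈ way) r∈ with ∈ₚ.∈-++⁻ C (↭ₚ.∈-resp-↭ p w∈)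
        ... | inj₁ w∈C = go w∈C way r∈
        ... | inj₂ w∈R = apart-¬adj eq c∈ w∈R cw

      part-↭ : ∀ {U W W′} → W ↭ W′ → Part U W → Part U W′
      part-↭ p P = record { sp = split-↭ ↭-refl p (Part.sp P) ; upm = Part.upm P ; mpm = Part.mpm P ; w∈ = ↭ₚ.∈-resp-↭ p (Part.w∈ P) }

      record Leaf (U : List V) : Set where
        constructor mkLeaf
        field
          a   : V
          U′  : List V
          U↭  : U ↭ a ∷ μ a ∷ U′
          free : deg a U′ ≡ 0

      six-leaf : ∀ {U} → Unique U → Six U → Leaf U
      six-leaf {U} uniq (path p s U↭ qs) = mkLeaf p (s ∷ μ s ∷ []) U↭ (deg-none p (s ∷ μ s ∷ []) none-adj)
        where
        uniq′ : Unique (p ∷ μ p ∷ s ∷ μ s ∷ [])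
        uniq′ = unique-resp-↭ U↭ uniq
        none-adj : ∀ {y} → y ∈ s ∷ μ s ∷ [] → ¬ Adj p y
        none-adj (here refl) = no-chord (μ-adj p) qs
        none-adj (there (here refl)) pt = no-square (μ-adj p) qs (μ-adj s) (adj-sym pt)
          (λ eq → unique-disjoint {xs = p ∷ []} uniq′ (here refl) (there (here eq)))
          (λ eq → unique-disjoint {xs = p ∷ μ p ∷ []} uniq′ (there (here refl)) (there (here eq)))
      six-leaf {U} uniq (pendant a p s U↭ bp qs tb) = mkLeaf a (p ∷ μ p ∷ s ∷ μ s ∷ []) U↭ (deg-none a _ none-adj)
        where
        uniq′ : Unique (a ∷ μ a ∷ p ∷ μ p ∷ s ∷ μ s ∷ [])
        uniq′ = unique-resp-↭ U↭ uniq
        a≢ : ∀ {y} → y ∈ μ a ∷ p ∷ μ p ∷ s ∷ μ s ∷ [] → a ≢ y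
        a≢ y∈ refl = unique-disjoint {xs = a ∷ []} uniq′ (here refl) y∈
        b≢ : ∀ {y} → y ∈ p ∷ μ p ∷ s ∷ μ s ∷ [] → μ a ≢ y
        b≢ y∈ eq = unique-disjoint {xs = a ∷ μ a ∷ []} uniq′ (there (here (sym eq))) y∈
        none-adj : ∀ {y} → y ∈ p ∷ μ p ∷ s ∷ μ s ∷ [] → ¬ Adj a y
        none-adj (here refl) = no-chord (μ-adj a) bp
        none-adj (there (here refl)) aq = no-square (μ-adj a) bp (μ-adj p) (adj-sym aq) (a≢ (there (here refl))) (b≢ (there (here refl)))
        none-adj (there (there (here refl))) as = no-square (μ-adj a) (adj-sym tb) (adj-sym (μ-adj s)) (adj-sym as)
          (a≢ (there (there (there (there (here refl)))))) (b≢ (there (there (here refl))))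
        none-adj (there (there (there (here refl)))) = no-chord (μ-adj a) (adj-sym tb)

      leaf-closing : ∀ {U W d ds w} → Patch W d ds w → Part U W → Connected U → (ℓ : Leaf U) → Closing W (Leaf.a ℓ) w
      leaf-closing {U} {W} P part conn (mkLeaf a U′ U↭ free) =
        closing P (outside (Part.sp part) conn) (split-disjoint (Part.sp part) (↭ₚ.∈-resp-↭ (↭-sym U↭) (here refl)))
                (unique-++ʳ U (split-unique (Part.sp part))) (LeafStep.deg-a part U↭ free)

      -- With 6 cut edges `U` is connected and has a leaf by `six`, and this leaf closes a face at
      -- some rotation of the word.
      stuck-patch : ∀ {U W d ds w} → stuck w ≡ true → Patch W d ds w → Part U W → cross U W ≡ 6 → ⊥
      stuck-patch {U} {W} {w = w} st P part cut = absurd (trans (sym (closable-true C.size)) (trans (sym (Boolₚ.not-involutive _)) (cong not not-closable)))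
        where
        ℓ : Leaf U
        ℓ = six-leaf (split-uniqueˡ (Part.sp part)) (six (length U) ℕₚ.≤-refl part cut)
        module C = Closing (leaf-closing P part (connected-≤6 part (ℕₚ.≤-reflexive cut)) ℓ)
        not-closable : not (closable _) ≡ true
        not-closable = all-∈ (not ∘ closable) (⇒-true {isSmall w} st (small-word (word-≤5 P))) (rotation-∈ C.rotation)
        absurd : true ≡ false → ⊥
        absurd ()

      connected-mate : ∀ {U b} → Connected U → deg b U ≡ 1 → Connected (b ∷ U)
      connected-mate {U} {b} conn one = go (deg-suc {b} U one)
        where
        go : (∃₂ λ y L → U ↭ y ∷ L × Adj b y × deg b L ≡ 0) → Connected (b ∷ U)
        go (u , _ , p , bu , _) = connected-∷ conn (↭ₚ.∈-resp-↭ (↭-sym p) (here refl)) bu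

      mate-degree : ∀ {a U′ W} → deg (μ a) U′ + deg (μ a) W ≡ 2 → deg (μ a) U′ ≡ 1 → deg (μ a) (a ∷ W) ≡ 2
      mate-degree {a} {U′} {W} eq one = cong₂ _+_ (a-adj (adj-sym (μ-adj a))) (ℕₚ.suc-injective (trans (cong (_+ deg (μ a) W) (sym one)) eq))

      stuck-closing : ∀ {U W x w} → allᵇ settled (rotations w) ≡ true → Closing W x w → Part U (x ∷ W) → cross U (x ∷ W) ≡ 6 → ⊥
      stuck-closing {w = w} ok C part cut =
        stuck-patch (⇒-true {closable (g ∷ g′ ∷ gs)} (all-∈ settled ok (rotation-∈ rotation)) (closable-true size)) patch part cut
        where open Closing C

      -- After `a` has moved, its mate has two neighbours in the patch, `a` and one in `W`, so it
      -- closes a second face and the cut drops to 6.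
      second-closing : ∀ {U W d ds w a U′} → allᵇ settled (rotations w) ≡ true → Patch (a ∷ W) d ds w → Part U W →
                       U ↭ a ∷ μ a ∷ U′ → deg a U′ ≡ 0 → cross U W ≡ 8 → deg (μ a) U′ ≡ 1 → ⊥
      second-closing {U} {W} {w = w} {a} {U′} ok P part U↭ free cut one = stuck-closing ok C
          (part-↭ (swap a (μ a) ↭-refl) part′)
          (trans (cross-↭ʳ U′ {μ a ∷ a ∷ W} {a ∷ μ a ∷ W} (swap (μ a) a ↭-refl)) cut₆)
        where
        open LeafStep part U↭ free using (part′; cut′; split₁; deg-b)
        cut₆ : cross U′ (a ∷ μ a ∷ W) ≡ 6
        cut₆ = ℕₚ.+-cancelʳ-≡ 4 _ 6 (trans cut′ (cong₂ (λ c d → c + 2 * d) cut one))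
        split₂ : Split (μ a ∷ U′) (a ∷ W)
        split₂ = move-split split₁
        conn₂ : Connected (μ a ∷ U′)
        conn₂ = connected-mate (connected-≤6 part′ (ℕₚ.≤-reflexive cut₆)) one
        C : Closing (a ∷ W) (μ a) w
        C = closing P (outside split₂ conn₂) (split-disjoint split₂ (here refl)) (unique-++ʳ (μ a ∷ U′) (split-unique split₂))
              (mate-degree {a} {U′} {W} deg-b one)

      moves-ok : ℕ → ℕ → List ℕ → Set
      moves-ok k s w = ∀ {v} → v ∈ rotations w → closable v ≡ true → moves k s v ≡ true

      narrow : ∀ {U W d ds w} k s → moves-ok k s w → Patch W d ds w → Part U W → cross U W ≡ 8 → Connected U →
               (ℓ : Leaf U) → deg (μ (Leaf.a ℓ)) (Leaf.U′ ℓ) ≡ 1 → ⊥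
      narrow k s ok P part cut conn ℓ@(mkLeaf a U′ U↭ free) one =
        second-closing (proj₂ (∧-true {safe k (2 + s) _} (ok (rotation-∈ C.rotation) (closable-true C.size)))) C.patch part U↭ free cut one
        where
        module C = Closing (leaf-closing P part conn ℓ)

      -- Without triangles, `μ a` meets each of the two edges in one end. The far end of one of them
      -- is a leaf as well, and its mate keeps `μ a` as its only remaining neighbour.
      other-leaf : ∀ {U W} (part : Part U W) (ℓ : Leaf U) → deg (μ (Leaf.a ℓ)) (Leaf.U′ ℓ) ≡ 2 → TwoEdges (Leaf.U′ ℓ) →
                   Σ (Leaf U) λ ℓ′ → deg (μ (Leaf.a ℓ′)) (Leaf.U′ ℓ′) ≡ 1
      other-leaf {U} {W} part (mkLeaf a U′ U↭ free) two (mkTwo u v whole apart) = choose (adj? b u) (adj? b (μ u))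
        where
        b : V
        b = μ a
        free′ : ∀ {y} → y ∈ U′ → ¬ Adj a y
        free′ = deg-0 U′ free
        mem : ∀ {y} → y ∈ u ∷ μ u ∷ v ∷ μ v ∷ [] → y ∈ U′
        mem = ↭ₚ.∈-resp-↭ (↭-sym whole)
        count : deg b (u ∷ μ u ∷ []) + deg b (v ∷ μ v ∷ []) ≡ 2
        count = trans (sym (deg-++ b (u ∷ μ u ∷ []) (v ∷ μ v ∷ []))) (trans (deg-↭ b (↭-sym whole)) two)
        not-both : ∀ x → Adj b x → ¬ Adj b (μ x)
        not-both x bx = no-chord bx (μ-adj x)
        at-most : ∀ x → deg b (x ∷ μ x ∷ []) ≤ 1
        at-most x with adj? b x | adj? b (μ x)
        ... | yes p | yes q = contradiction q (not-both x p)
        ... | yes _ | no _  = ℕₚ.≤-refl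
        ... | no _  | yes _ = ℕₚ.≤-refl
        ... | no _  | no _  = z≤n
        leaf-at : ∀ x → U′ ↭ x ∷ μ x ∷ v ∷ μ v ∷ [] → Adj b (μ x) → cross (x ∷ μ x ∷ []) (v ∷ μ v ∷ []) ≡ 0 →
                  Σ (Leaf U) λ ℓ′ → deg (μ (Leaf.a ℓ′)) (Leaf.U′ ℓ′) ≡ 1
        leaf-at x p by cr = mkLeaf x (a ∷ b ∷ v ∷ μ v ∷ []) (↭-trans U↭ (↭-trans (prep a (prep b p))
              (solve 4 (λ ab x y vw → ab ⊕ (x ⊕ (y ⊕ vw)) ⊜ x ⊕ (y ⊕ (ab ⊕ vw))) ↭-refl (a ∷ b ∷ []) [ x ] [ μ x ] (v ∷ μ v ∷ []))))
            (deg-none x _ x-free) ,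
            trans (cong₂ _+_ (a-nonadj (λ ya → free′ (↭ₚ.∈-resp-↭ (↭-sym p) (there (here refl))) (adj-sym ya)))
              (cong₂ _+_ (a-adj (adj-sym by)) (deg-none (μ x) _ (apart-¬adj {x ∷ μ x ∷ []} {v ∷ μ v ∷ []} cr (there (here refl)))))) refl
          where
          x-free : ∀ {y} → y ∈ a ∷ b ∷ v ∷ μ v ∷ [] → ¬ Adj x y
          x-free (here refl) xa = free′ (↭ₚ.∈-resp-↭ (↭-sym p) (here refl)) (adj-sym xa)
          x-free (there (here refl)) xb = not-both x (adj-sym xb) by
          x-free (there (there y∈)) = apart-¬adj {x ∷ μ x ∷ []} {v ∷ μ v ∷ []} cr (here refl) y∈
        choose : Dec (Adj b u) → Dec (Adj b (μ u)) → Σ (Leaf U) λ ℓ′ → deg (μ (Leaf.a ℓ′)) (Leaf.U′ ℓ′) ≡ 1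
        choose _ (yes by) = leaf-at u whole by apart
        choose (yes bu) (no _) = leaf-at (μ u) (↭-trans whole (↭-trans (swap u (μ u) ↭-refl) (↭-reflexive (cong (λ z → μ u ∷ z ∷ v ∷ μ v ∷ []) (sym (μμ u))))))
            (subst (Adj b) (sym (μμ u)) bu) (trans (cross-↭ˡ (v ∷ μ v ∷ []) (↭-trans (prep (μ u) (↭-reflexive (cong [_] (μμ u)))) (swap (μ u) u ↭-refl))) apart)
        choose (no ¬bu) (no ¬by) = contradiction (subst (_≤ 1) (trans (cong (_+ deg b (v ∷ μ v ∷ []))
            (sym (deg-none b (u ∷ μ u ∷ []) λ { (here refl) → ¬bu ; (there (here refl)) → ¬by }))) count) (at-most v)) λ { (s≤s ()) }

      -- Soundness of `safe`. The invariant is a connected `U` with a unique perfect matching and 8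
      -- cut edges; the count `length W` is carried along for the case of two pentagons.
      play : ∀ k {U W d ds w} → safe k (length W) w ≡ true → Patch W d ds w → Part U W → cross U W ≡ 8 → Connected U → ⊥
      play (suc k) {U} {W} {d} {ds} {w} ok P part cut conn = go (eight part cut)
        where
        branch : ∀ {v} → v ∈ rotations w → (not (followsᵇ pentagonal v) ∨ (length W ≡ᵇ 14)) ∧ (not (closable v) ∨ moves k (length W) v) ≡ true
        branch = all-∈ _ (⇒-true {isSmall w} ok (small-word (word-≤5 P)))
        mv : moves-ok k (length W) w
        mv {v} v∈ = ⇒-true {closable v} (proj₂ (∧-true {not (followsᵇ pentagonal v) ∨ (length W ≡ᵇ 14)} (branch v∈)))

        -- The mate keeps two neighbours in `U′`, so `a` is its only neighbour in the enlarged patch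
        -- and the cut stays at 8. The leg that `closing` creates at `a` leads to the mate, along
        -- which the patch is extended.
        widen : (ℓ : Leaf U) → deg (μ (Leaf.a ℓ)) (Leaf.U′ ℓ) ≡ 2 → Connected (Leaf.U′ ℓ) → ⊥
        widen ℓ@(mkLeaf a U′ U↭ free) two conn′ =
          play k {U′} {tgt C.leg ∷ a ∷ W} (proj₁ (∧-true {safe k (2 + length W) _} (mv (rotation-∈ C.rotation) (closable-true C.size))))
               (proj₂ (proj₂ (grown C.patch))) (part-↭ (↭-trans (swap a (μ a) ↭-refl) (prep-≡ (sym leg-end))) L.part′)
               (trans (cross-↭ʳ U′ {tgt C.leg ∷ a ∷ W} {a ∷ μ a ∷ W} (↭-trans (prep-≡ leg-end) (swap (μ a) a ↭-refl)))
                 (ℕₚ.+-cancelʳ-≡ 4 _ 8 (trans L.cut′ (cong₂ (λ c d → c + 2 * d) cut two)))) conn′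
          where
          module L = LeafStep part U↭ free
          module C = Closing (leaf-closing P part conn ℓ)
          prep-≡ : ∀ {x y : V} {L} → x ≡ y → x ∷ L ↭ y ∷ L
          prep-≡ refl = ↭-refl
          leg-end : tgt C.leg ≡ μ a
          leg-end = locate (split-∈ L.split₁ (tgt C.leg))
            where
            o : Out (a ∷ W) C.leg
            o = Patch.out C.patch (here refl)
            locate : tgt C.leg ∈ a ∷ μ a ∷ U′ ⊎ tgt C.leg ∈ W → tgt C.leg ≡ μ a
            locate (inj₁ (here e)) = contradiction (here e) (proj₂ o)
            locate (inj₁ (there (here e))) = e
            locate (inj₁ (there (there t∈))) = contradiction (subst (λ z → Adj z (tgt C.leg)) C.at (adj-tgt C.leg)) (deg-0 U′ free t∈)
            locate (inj₂ t∈) = contradiction (there t∈) (proj₂ o)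
          lonely : deg (tgt C.leg) (a ∷ W) ≡ 1
          lonely = trans (cong (λ z → deg z (a ∷ W)) leg-end) (cong₂ _+_ (a-adj (adj-sym (μ-adj a)))
                     (ℕₚ.+-cancelˡ-≡ 2 _ 0 (trans (cong (_+ deg (μ a) W) (sym two)) L.deg-b)))
          grown : ∀ {v} → Patch (a ∷ W) C.leg C.legs v → ∃₂ λ e es → Patch (tgt C.leg ∷ a ∷ W) e es (extendWord v)
          grown {[]} Q = case Patch.gaps Q of λ ()
          grown {g ∷ gs} Q = _ , _ , extend Q lonely
        go : Eight U → ⊥
        go (leaf a U′ U↭ free) = by-degree (deg (μ a) U′) refl (ℕₚ.m+n≤o⇒m≤o (deg (μ a) U′) (ℕₚ.≤-reflexive L.deg-b))
          where
          ℓ : Leaf U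
          ℓ = mkLeaf a U′ U↭ free
          module L = LeafStep part U↭ free
          by-degree : ∀ d → deg (μ a) U′ ≡ d → d ≤ 2 → ⊥
          -- `a` and its mate would be a component of `U` of their own, beside a nonempty `U′`.
          by-degree 0 e _ = let u , u∈ = inhabited {3} U′ {a ∷ μ a ∷ W} (ℕₚ.+-cancelʳ-≡ 4 _ 4 (trans L.cut′ (cong₂ (λ c d → c + 2 * d) cut e)))
            in cut-off {C = a ∷ μ a ∷ []} {R = U′} (split-uniqueˡ (Part.sp part)) U↭ (cong₂ _+_ free (trans (ℕₚ.+-identityʳ _) e)) (here refl) u∈ conn
          by-degree 1 e _ = narrow k (length W) mv P part cut conn ℓ e
          -- If `U′` falls apart, it consists of two edges; then another leaf is removed instead.
          by-degree 2 e _ = [ widen ℓ e , (λ T → let ℓ′ , e′ = other-leaf part ℓ e T in narrow k (length W) mv P part cut conn ℓ′ e′) ]′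
            (connected-8 L.part′ (ℕₚ.+-cancelʳ-≡ 4 _ 8 (trans L.cut′ (cong₂ (λ c d → c + 2 * d) cut e))))
          by-degree (suc (suc (suc _))) _ (s≤s (s≤s ()))
        -- The gaps around the patch complement `pentagonal`, which `safe` accepts only for 14
        -- vertices; with the ten of the pentagons this makes 24.
        go (pentagons r A s B whole rs single X Y) =
          n≢24 (trans (sym (split-length (Part.sp part))) (cong₂ _+_ ten fourteen))
          where
          uniq : Unique ((r ∷ A) ++ (s ∷ B))
          uniq = unique-resp-↭ whole (split-uniqueˡ (Part.sp part))
          found : ∃[ w′ ] Rotation w w′ × Follows pentagonal w′
          found = TwoRings.word part whole (subst (Adj r) rs (μ-adj r)) single (ring X (unique-++ˡ uniq)) (ring Y (unique-++ʳ (r ∷ A) uniq))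
                    P (outside (Part.sp part) conn)
          ≡ᵇ-sound : ∀ {k} → (k ≡ᵇ 14) ≡ true → k ≡ 14
          ≡ᵇ-sound {k} e = ℕₚ.≡ᵇ⇒≡ k 14 (subst T (sym e) tt)
          ten : length U ≡ 10
          ten = trans (↭ₚ.↭-length whole) (trans (Listₚ.length-++ (r ∷ A)) (cong₂ (λ p q → suc p + suc q) (↭ₚ.↭-length (Pent.A↭ X)) (↭ₚ.↭-length (Pent.A↭ Y))))
          fourteen : length W ≡ 14
          fourteen = let w′ , ρ , f = found in
            ≡ᵇ-sound (⇒-true {followsᵇ pentagonal w′} (proj₁ (∧-true {not (followsᵇ pentagonal w′) ∨ (length W ≡ᵇ 14)} (branch {w′} (rotation-∈ ρ)))) (follows-true pentagonal w′ f))

    -- The first step, from two matching edges to the tree.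

    module TwoEdgeComplement (n≢24 : n ≢ 24) where

      open Faces using (20≤n)
      open Cuts renaming (a to adjacency)
      open ShortCycles
      open Matchings
      open Classification
      open Pieces
      open Steps
      open Spider
      open Game n≢24

      μ-≢ : ∀ {v} → μ v ≢ v
      μ-≢ {v} eq = adj-irrefl (μ-adj v) (sym eq)

      pair-∉ : ∀ {y L} → Closed L → y ∉ L → μ y ∉ L
      pair-∉ {y} {L} cl y∉ μy∈ = y∉ (subst (_∈ L) (μμ y) (cl μy∈))

      edge-closed : ∀ {u L} → Closed L → Closed (u ∷ μ u ∷ L)
      edge-closed {u} cl (here refl)         = there (here refl)
      edge-closed {u} cl (there (here refl)) = here (μμ u)
      edge-closed     cl (there (there x∈))  = there (there (cl x∈))

      edge-unique : ∀ {u L} → Closed L → u ∉ L → Unique L → Unique (u ∷ μ u ∷ L)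
      edge-unique {u} {L} cl u∉ uniq =
        ((λ e → μ-≢ (sym e)) ∷ All.tabulate (λ y∈ e → u∉ (subst (_∈ L) (sym e) y∈))) ∷ All.tabulate (λ y∈ e → pair-∉ cl u∉ (subst (_∈ L) (sym e) y∈)) ∷ uniq

      []-closed : Closed []
      []-closed ()

      module Excluded {s₁ s₂ U₀} (part₀ : Part U₀ (s₁ ∷ μ s₁ ∷ s₂ ∷ μ s₂ ∷ [])) where

        W₀ : List V
        W₀ = s₁ ∷ μ s₁ ∷ s₂ ∷ μ s₂ ∷ []

        W₀-closed : Closed W₀
        W₀-closed = edge-closed (edge-closed []-closed)

        split₀ : Split U₀ W₀
        split₀ = Part.sp part₀

        -- `W₀` has 4 vertices and the fullerene at least 20.
        big-U₀ : ∀ {k} → length U₀ ≡ k → k ≤ 15 → ⊥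
        big-U₀ e le = ℕₚ.<⇒≱ (ℕₚ.≤-trans (s≤s (ℕₚ.≤-reflexive (sym (split-length split₀)))) (s≤s (ℕₚ.+-monoˡ-≤ 4 (ℕₚ.≤-trans (ℕₚ.≤-reflexive e) le)))) 20≤n

        six-size : ∀ {U} → Six U → length U ≡ 4 ⊎ length U ≡ 6
        six-size (path _ _ p _) = inj₁ (↭ₚ.↭-length p)
        six-size (pendant _ _ _ p _ _ _) = inj₂ (↭ₚ.↭-length p)

        E₁ E₂ : List V
        E₁ = s₁ ∷ μ s₁ ∷ []
        E₂ = s₂ ∷ μ s₂ ∷ []

        t : ℕ
        t = cross E₁ E₂

        edge-self-cross : ∀ u → cross (u ∷ μ u ∷ []) (u ∷ μ u ∷ []) ≡ 2
        edge-self-cross u = cong₂ (λ p q → p + q) (cong₂ _+_ (a-irrefl u) (cong (_+ 0) (a-adj (μ-adj u))))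
          (cong (_+ 0) (cong₂ _+_ (a-adj (adj-sym (μ-adj u))) (cong (_+ 0) (a-irrefl (μ u)))))

        two-edges-cross : ∀ u v → let E = u ∷ μ u ∷ [] ; E′ = v ∷ μ v ∷ [] in
                          cross (E ++ E′) (E ++ E′) ≡ (2 + cross E E′) + (cross E E′ + 2)
        two-edges-cross u v = trans (cross-++ˡ E E′ (E ++ E′)) (cong₂ _+_ (trans (cross-++ʳ E E E′) (cong (_+ cross E E′) (edge-self-cross u)))
          (trans (cross-++ʳ E′ E E′) (cong₂ _+_ (cross-sym E′ E) (edge-self-cross v))))
          where
          E E′ : List V
          E = u ∷ μ u ∷ []
          E′ = v ∷ μ v ∷ []

        -- Of the 12 edge ends at `W₀`, the two matching edges use 4 and the edges between them use
        -- 2 t.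
        cut₀ : cross U₀ W₀ + 2 * t ≡ 8
        cut₀ = ℕₚ.+-cancelˡ-≡ 4 _ 8 (begin
          4 + (cross U₀ W₀ + 2 * t)                                 ≡⟨ mix (cross U₀ W₀) t ⟩
          ((2 + t) + (t + 2)) + cross U₀ W₀                          ≡⟨ cong₂ _+_ (sym (two-edges-cross s₁ s₂)) (cross-sym U₀ W₀) ⟩
          cross W₀ W₀ + cross W₀ U₀                                  ≡⟨ split-count (split-sym split₀) ⟩
          12                                                         ∎)
          where
          open ≡-Reasoning
          mix : ∀ c t → 4 + (c + 2 * t) ≡ ((2 + t) + (t + 2)) + c
          mix = solve-∀

        -- The leaf `a` has both other neighbours in `W₀`, on different matching edges, as it would
        -- otherwise form a triangle. With no edge between these two edges and none from the mate of
        -- `a` to `W₀`, the six vertices form the tree of `spider`.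
        module SpiderCase {a U′} (U↭ : U₀ ↭ a ∷ μ a ∷ U′) (free : deg a U′ ≡ 0) (cut : cross U₀ W₀ ≡ 8)
                          (two : deg (μ a) U′ ≡ 2) (conn : Connected U′) where
          open LeafStep part₀ U↭ free using (part′; cut′; split₁; deg-b)

          d : Dart
          d = dart (μ-adj a)

          b x y : V
          b = tgt d
          x = tgt (ν d)
          y = tgt (ν (ν d))

          b≡ : b ≡ μ a
          b≡ = dart-tgt (μ-adj a)

          a∈U : a ∈ U₀
          a∈U = ↭ₚ.∈-resp-↭ (↭-sym U↭) (here refl)

          b∈U : b ∈ U₀
          b∈U = ↭ₚ.∈-resp-↭ (↭-sym U↭) (there (here b≡))

          U-W : ∀ {u w} → u ∈ U₀ → w ∈ W₀ → u ≢ w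
          U-W u∈ w∈ refl = split-disjoint split₀ u∈ w∈

          outward : ∀ {e} → src e ≡ a → e ≢ d → tgt e ∈ W₀
          outward {e} s ne = go (split-∈ split₁ (tgt e))
            where
            ae : Adj a (tgt e)
            ae = subst (λ v → Adj v (tgt e)) s (adj-tgt e)
            go : tgt e ∈ a ∷ μ a ∷ U′ ⊎ tgt e ∈ W₀ → tgt e ∈ W₀
            go (inj₁ (here q))            = contradiction (sym q) (adj-irrefl ae)
            go (inj₁ (there (here q)))    = contradiction (dart-≡ s (trans q (sym b≡))) ne
            go (inj₁ (there (there q)))   = contradiction ae (deg-0 U′ free q)
            go (inj₂ q)                   = q

          x∈ : x ∈ W₀
          x∈ = outward refl (ν-≢ d)

          y∈ : y ∈ W₀
          y∈ = outward refl (ν²-≢ d)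

          ax : Adj a x
          ax = adj-tgt (ν d)

          ay : Adj a y
          ay = adj-tgt (ν (ν d))

          ab : Adj a b
          ab = adj-tgt d

          x≢y : x ≢ y
          x≢y e = ν-≢ (ν d) (sym (dart-≡ refl e))

          y≢μx : y ≢ μ x
          y≢μx e = no-chord ax (μ-adj x) (subst (Adj a) e ay)

          Eˣ Eʸ : List V
          Eˣ = x ∷ μ x ∷ []
          Eʸ = y ∷ μ y ∷ []

          y∉ : x ∉ Eʸ
          y∉ (here e) = x≢y e
          y∉ (there (here e)) = y≢μx (trans (sym (μμ y)) (cong μ (sym e)))

          W₀↭ : W₀ ↭ Eˣ ++ Eʸ
          W₀↭ = go (extract (Eˣ ++ Eʸ) (edge-unique (edge-closed []-closed) y∉ (edge-unique []-closed (λ ()) [])) (x∈ ∷ W₀-closed x∈ ∷ y∈ ∷ W₀-closed y∈ ∷ []))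
            where
            go : ∃[ R ] W₀ ↭ (Eˣ ++ Eʸ) ++ R → W₀ ↭ Eˣ ++ Eʸ
            go ([] , p) = p
            go (_ ∷ _ , p) = case ↭ₚ.↭-length p of λ ()

          apart : cross Eˣ Eʸ ≡ 0
          apart = ℕₚ.*-cancelˡ-≡ _ 0 2 (ℕₚ.+-cancelˡ-≡ 12 _ 0 (begin
            12 + 2 * cross Eˣ Eʸ                                               ≡⟨ mix (cross Eˣ Eʸ) ⟩
            ((2 + cross Eˣ Eʸ) + (cross Eˣ Eʸ + 2)) + 8                         ≡⟨ cong₂ _+_ (sym (two-edges-cross x y)) (trans (sym cut) (cross-sym U₀ W₀)) ⟩
            cross (Eˣ ++ Eʸ) (Eˣ ++ Eʸ) + cross W₀ U₀                          ≡⟨ cong (_+ cross W₀ U₀) (trans (cross-↭ˡ (Eˣ ++ Eʸ) (↭-sym W₀↭)) (cross-↭ʳ W₀ (↭-sym W₀↭))) ⟩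
            cross W₀ W₀ + cross W₀ U₀                                          ≡⟨ split-count (split-sym split₀) ⟩
            12                                                                 ∎))
            where
            open ≡-Reasoning
            mix : ∀ c → 12 + 2 * c ≡ ((2 + c) + (c + 2)) + 8
            mix = solve-∀

          ¬b : ∀ {w} → w ∈ W₀ → ¬ Adj w b
          ¬b w∈ wb = deg-0 W₀ (ℕₚ.+-cancelˡ-≡ 2 _ 0 (trans (cong (_+ deg (μ a) W₀) (sym two)) deg-b)) w∈ (subst (λ v → Adj v _) b≡ (adj-sym wb))

          ¬xy : ∀ {u v} → u ∈ Eˣ → v ∈ Eʸ → ¬ Adj u v
          ¬xy = apart-¬adj apart

          ¬yx : ∀ {u v} → u ∈ Eʸ → v ∈ Eˣ → ¬ Adj u v
          ¬yx u∈ v∈ = ¬xy v∈ u∈ ∘ adj-sym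

          ¬μa : ∀ {w} → Adj a w → ¬ Adj (μ w) a
          ¬μa aw = no-chord (adj-sym (μ-adj _)) (adj-sym aw)

          patch : SafePatch (μ y ∷ μ x ∷ y ∷ x ∷ b ∷ a ∷ [])
          patch = spider d (μ-adj x) (μ-adj y)
            (hit (adj-sym ab) [])
            (miss (¬b x∈) (hit (adj-sym ax) []))
            (miss (¬yx (here refl) (here refl)) (miss (¬b y∈) (hit (adj-sym ay) [])))
            (miss (¬xy (there (here refl)) (here refl)) (hit (adj-sym (μ-adj x)) (¬b (W₀-closed x∈) ∷ ¬μa ax ∷ [])))
            (miss (¬yx (there (here refl)) (there (here refl))) (hit (adj-sym (μ-adj y)) (¬yx (there (here refl)) (here refl)
              ∷ ¬b (W₀-closed y∈) ∷ ¬μa ay ∷ [])))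
            (λ { (here e) → y≢μx (sym e) ; (there (here e)) → μ-≢ e
               ; (there (there (here e))) → U-W b∈U (W₀-closed x∈) (sym e) ; (there (there (there (here e)))) → U-W a∈U (W₀-closed x∈) (sym e) })
            (λ { (here e) → x≢y (sym (trans (sym (μμ y)) (trans (cong μ e) (μμ x)))) ; (there (here e)) → μ-≢ e
               ; (there (there (here e))) → y∉ (there (here (sym e)))
               ; (there (there (there (here e)))) → U-W b∈U (W₀-closed y∈) (sym e) ; (there (there (there (there (here e))))) → U-W a∈U (W₀-closed y∈) (sym e) })
            x≢y (U-W b∈U x∈) (U-W b∈U y∈)

          around : a ∷ μ a ∷ W₀ ↭ μ y ∷ μ x ∷ y ∷ x ∷ b ∷ a ∷ []
          around = ↭-trans (prep a (prep (μ a) W₀↭)) (↭-trans (↭-reflexive (cong (λ v → a ∷ v ∷ Eˣ ++ Eʸ) (sym b≡)))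
            (solve 6 (λ a b x x′ y y′ → a ⊕ (b ⊕ (x ⊕ (x′ ⊕ (y ⊕ y′)))) ⊜ y′ ⊕ (x′ ⊕ (y ⊕ (x ⊕ (b ⊕ a))))) ↭-refl [ a ] [ b ] [ x ] [ μ x ] [ y ] [ μ y ]))

          impossible : ⊥
          impossible = play 6 (SafePatch.safe₆ patch) (SafePatch.patch patch) (part-↭ around part′)
            (trans (cross-↭ʳ U′ (↭-sym around)) (ℕₚ.+-cancelʳ-≡ 4 _ 8 (trans cut′ (cong₂ (λ c d → c + 2 * d) cut two)))) conn

        -- Outside `SpiderCase` either the cut is too small for its bound, or `U₀` is classified and
        -- has at most 10 vertices.
        contradictory : ⊥
        contradictory = by-cross t refl cut₀
          where
          some : ∃[ x ] x ∈ U₀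
          some = go U₀ refl
            where
            go : ∀ U → U₀ ≡ U → ∃[ x ] x ∈ U
            go [] e = ⊥-elim (big-U₀ (cong length e) z≤n)
            go (x ∷ U) _ = x , here refl
          far-apart : cross U₀ W₀ ≡ 8 → ⊥
          far-apart cut = go (eight part₀ cut)
            where
            go : Eight U₀ → ⊥
            go (pentagons r A s B whole _ _ X Y) = big-U₀ (trans (↭ₚ.↭-length whole) (trans (Listₚ.length-++ (r ∷ A))
              (cong₂ (λ p q → suc p + suc q) (↭ₚ.↭-length (Pent.A↭ X)) (↭ₚ.↭-length (Pent.A↭ Y))))) (ℕₚ.m≤m+n 10 5)
            go (leaf a U′ U↭ free) = by-degree (deg (μ a) U′) refl (ℕₚ.m+n≤o⇒m≤o (deg (μ a) U′) (ℕₚ.≤-reflexive deg-b))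
              where
              open LeafStep part₀ U↭ free using (part′; cut′; split₁; deg-b)
              cut-at : ∀ k → deg (μ a) U′ ≡ k → cross U′ (a ∷ μ a ∷ W₀) + 4 ≡ 8 + 2 * k
              cut-at k e = trans cut′ (cong₂ (λ c d → c + 2 * d) cut e)
              size : ∀ {k} → length U′ ≡ k → length U₀ ≡ 2 + k
              size e = trans (↭ₚ.↭-length U↭) (cong (2 +_) e)
              by-degree : ∀ k → deg (μ a) U′ ≡ k → k ≤ 2 → ⊥
              by-degree 0 e _ = big-U₀ (size (↭ₚ.↭-length (proj₂ (cut₄ (length U′) ℕₚ.≤-refl part′ (ℕₚ.+-cancelʳ-≡ 4 _ 4 (cut-at 0 e)))))) (ℕₚ.m≤m+n 4 11)
              by-degree 1 e _ = [ (λ l → big-U₀ (size l) (ℕₚ.m≤m+n 6 9)) , (λ l → big-U₀ (size l) (ℕₚ.m≤m+n 8 7)) ]′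
                (six-size (six (length U′) ℕₚ.≤-refl part′ (ℕₚ.+-cancelʳ-≡ 4 _ 6 (cut-at 1 e))))
              by-degree 2 e _ = [ SpiderCase.impossible U↭ free cut e
                                , (λ T → big-U₀ (size (↭ₚ.↭-length (TwoEdges.whole T))) (ℕₚ.m≤m+n 6 9)) ]′
                (connected-8 part′ (ℕₚ.+-cancelʳ-≡ 4 _ 8 (cut-at 2 e)))
              by-degree (suc (suc (suc _))) _ (s≤s (s≤s ()))
          by-cross : ∀ k → t ≡ k → cross U₀ W₀ + 2 * k ≡ 8 → ⊥
          by-cross 0 e eq = far-apart (trans (sym (ℕₚ.+-identityʳ _)) eq)
          by-cross 1 e eq = [ (λ l → big-U₀ l (ℕₚ.m≤m+n 4 11)) , (λ l → big-U₀ l (ℕₚ.m≤m+n 6 9)) ]′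
            (six-size (six (length U₀) ℕₚ.≤-refl part₀ (ℕₚ.+-cancelʳ-≡ 2 _ 6 eq)))
          by-cross 2 e eq = big-U₀ (↭ₚ.↭-length (proj₂ (cut₄ (length U₀) ℕₚ.≤-refl part₀ (ℕₚ.+-cancelʳ-≡ 4 _ 4 eq)))) (ℕₚ.m≤m+n 2 13)
          by-cross (suc (suc (suc k))) e eq = ℕₚ.<⇒≱ (ℕₚ.≤-trans (ℕₚ.m≤m+n 9 1)
            (ℕₚ.+-mono-≤ (part-bound part₀ (proj₂ some)) (ℕₚ.*-monoʳ-≤ 2 (s≤s (s≤s (s≤s (z≤n {k}))))))) (ℕₚ.≤-reflexive eq)

    -- From a forcing set to a set with a unique perfect matching.

    module Final (n≢24 : n ≢ 24) (S : Subset n) (forcing : IsForcingSet M S) (few : ¬ 6 ≤ ∣ S ∣) where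

      open Faces using (20≤n)
      open Cuts renaming (a to adjacency)
      open Matchings
      open Classification
      open TwoEdgeComplement n≢24

      record Pairing (L : List V) : Set where
        field
          f       : V → V
          f-∈     : ∀ {x} → x ∈ L → f x ∈ L
          f-adj   : ∀ {x} → x ∈ L → Adj x (f x)
          f-inv   : ∀ {x} → x ∈ L → f (f x) ≡ x

      pair-up : ∀ {L u v R} → Adj u v → L ↭ u ∷ v ∷ R → Unique L → Pairing R → Σ (Pairing L) λ P → Pairing.f P u ≡ v
      pair-up {L} {u} {v} {R} uv p uniq Q = record { f = f ; f-∈ = λ x∈ → back (∈-f (to x∈)) ; f-adj = λ x∈ → adj-f (to x∈) ; f-inv = λ x∈ → inv-f (to x∈) } , f-u
        where
        module Q = Pairing Q
        uniq′ : Unique (u ∷ v ∷ R)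
        uniq′ = unique-resp-↭ p uniq
        to : ∀ {x} → x ∈ L → x ∈ u ∷ v ∷ R
        to = ↭ₚ.∈-resp-↭ p
        back : ∀ {x} → x ∈ u ∷ v ∷ R → x ∈ L
        back = ↭ₚ.∈-resp-↭ (↭-sym p)
        u≢v : u ≢ v
        u≢v eq = adj-irrefl uv eq
        g f : V → V
        g x = if ⌊ x ≟ᵥ v ⌋ then u else Q.f x
        f x = if ⌊ x ≟ᵥ u ⌋ then v else g x
        f-u : f u ≡ v
        f-u = cong (if_then v else g u) (⌊yes⌋ (u ≟ᵥ u) refl)
        f-v : f v ≡ u
        f-v = trans (cong (if_then v else g v) (⌊no⌋ (v ≟ᵥ u) (≢-sym u≢v))) (cong (if_then u else Q.f v) (⌊yes⌋ (v ≟ᵥ v) refl))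
        f-R : ∀ {x} → x ∈ R → f x ≡ Q.f x
        f-R {x} x∈ = trans (cong (if_then v else g x) (⌊no⌋ (x ≟ᵥ u) (λ { refl → unique-disjoint {xs = u ∷ v ∷ []} uniq′ (here refl) x∈ })))
                       (cong (if_then u else Q.f x) (⌊no⌋ (x ≟ᵥ v) (λ { refl → unique-disjoint {xs = u ∷ v ∷ []} uniq′ (there (here refl)) x∈ })))
        ∈-f : ∀ {x} → x ∈ u ∷ v ∷ R → f x ∈ u ∷ v ∷ R
        ∈-f (here refl) = there (here f-u)
        ∈-f (there (here refl)) = here f-v
        ∈-f (there (there x∈)) = there (there (subst (_∈ R) (sym (f-R x∈)) (Q.f-∈ x∈)))
        adj-f : ∀ {x} → x ∈ u ∷ v ∷ R → Adj x (f x)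
        adj-f (here refl) = subst (Adj u) (sym f-u) uv
        adj-f (there (here refl)) = subst (Adj v) (sym f-v) (adj-sym uv)
        adj-f {x} (there (there x∈)) = subst (Adj x) (sym (f-R x∈)) (Q.f-adj x∈)
        inv-f : ∀ {x} → x ∈ u ∷ v ∷ R → f (f x) ≡ x
        inv-f (here refl) = trans (cong f f-u) f-v
        inv-f (there (here refl)) = trans (cong f f-v) f-u
        inv-f (there (there x∈)) = trans (cong f (f-R x∈)) (trans (f-R (Q.f-∈ x∈)) (Q.f-inv x∈))

      pairing : ∀ {L} → PM L → Unique L → Pairing L
      pairing none _ = record { f = id ; f-∈ = λ () ; f-adj = λ () ; f-inv = λ () }
      pairing (pair {u = u} {v} uv m p) uniq = proj₁ (pair-up uv p uniq (pairing m (unique-++ʳ (u ∷ v ∷ []) (unique-resp-↭ p uniq))))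

      -- A perfect matching of `U`, glued to `M` on `W`, agrees with `M` on `S` and hence
      -- everywhere.
      forced-unique : ∀ {U W} → Split U W → Closed W → (∀ {x} → x ∈ₛ S → x ∈ W) → UPM U
      forced-unique {U} {W} sp clW S⊆W {u} {v} {R} uv p m = trans (sym-agree u) (trans (on-U (↭ₚ.∈-resp-↭ (↭-sym p) (here refl))) (proj₂ P₂))
        where
        uniq : Unique U
        uniq = split-uniqueˡ sp
        P₂ : Σ (Pairing U) λ P → Pairing.f P u ≡ v
        P₂ = pair-up uv p uniq (pairing m (unique-++ʳ (u ∷ v ∷ []) (unique-resp-↭ p uniq)))
        open Pairing (proj₁ P₂)
        U? : ∀ x → Dec (x ∈ U)
        U? x = Any.any? (x ≟ᵥ_) U
        g : V → V
        g x = if ⌊ U? x ⌋ then f x else μ x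
        on-U : ∀ {x} → x ∈ U → g x ≡ f x
        on-U {x} x∈ = cong (if_then f x else μ x) (⌊yes⌋ (U? x) x∈)
        on-W : ∀ {x} → x ∈ W → g x ≡ μ x
        on-W {x} x∈ = cong (if_then f x else μ x) (⌊no⌋ (U? x) (λ x∈U → split-disjoint sp x∈U x∈))
        M′ : PerfectMatching F
        M′ = record
          { partner = g
          ; adj = λ x → [ (λ x∈ → subst (Adj x) (sym (on-U x∈)) (f-adj x∈)) , (λ x∈ → subst (Adj x) (sym (on-W x∈)) (μ-adj x)) ]′ (split-∈ sp x)
          ; involutive = λ x → [ (λ x∈ → trans (cong g (on-U x∈)) (trans (on-U (f-∈ x∈)) (f-inv x∈)))
                               , (λ x∈ → trans (cong g (on-W x∈)) (trans (on-W (clW x∈)) (μμ x))) ]′ (split-∈ sp x) }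
        sym-agree : ∀ x → μ x ≡ g x
        sym-agree = proj₂ forcing M′ (λ x x∈ → on-W (S⊆W x∈))

      forced-part : ∀ {U W w} → Split U W → Closed W → (∀ {x} → x ∈ₛ S → x ∈ W) → w ∈ W → Part U W
      forced-part {U} {W} sp clW S⊆W w∈ = record
        { sp = sp ; upm = forced-unique sp clW S⊆W ; mpm = closed⇒mpm (length U) ℕₚ.≤-refl (split-uniqueˡ sp) clU ; w∈ = w∈ }
        where
        clU : Closed U
        clU {x} x∈ = [ id , (λ μx∈ → contradiction (subst (_∈ W) (μμ x) (clW μx∈)) (split-disjoint sp x∈)) ]′ (split-∈ sp (μ x))

      opaque
        -- Prefers an element of `S` and falls back on any fresh vertex, so that two edges can be
        -- chosen even when `S` has fewer.
        pick : ∀ L → length L < n → ∃[ x ] x ∉ L × (∀ {y} → y ∈ₛ S → y ∉ L → x ∈ₛ S)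
        pick L short = go (Finₚ.any? (λ x → (x Subsetₚ.∈? S) ×-dec ¬? (Any.any? (x Finₚ.≟_) L)))
          where
          go : Dec (∃[ x ] x ∈ₛ S × x ∉ L) → ∃[ x ] x ∉ L × (∀ {y} → y ∈ₛ S → y ∉ L → x ∈ₛ S)
          go (yes (x , x∈ , x∉)) = x , x∉ , λ _ _ → x∈
          go (no ¬found) = let x , x∉ = fresh L short in x , x∉ , λ y∈ y∉ → contradiction (_ , y∈ , y∉) ¬found

      small : ∀ {k} → suc k ≤ 20 → k < n
      small le = ℕₚ.≤-trans le 20≤n

      first : ∃[ x ] x ∉ [] × (∀ {y} → y ∈ₛ S → y ∉ [] → x ∈ₛ S)
      first = pick [] (small (s≤s z≤n))

      s₁ : V
      s₁ = proj₁ first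

      second : ∃[ x ] x ∉ s₁ ∷ μ s₁ ∷ [] × (∀ {y} → y ∈ₛ S → y ∉ s₁ ∷ μ s₁ ∷ [] → x ∈ₛ S)
      second = pick (s₁ ∷ μ s₁ ∷ []) (small (s≤s (s≤s (s≤s z≤n))))

      s₂ : V
      s₂ = proj₁ second

      W₀ : List V
      W₀ = s₁ ∷ μ s₁ ∷ s₂ ∷ μ s₂ ∷ []

      W₀-closed : Closed W₀
      W₀-closed = edge-closed (edge-closed []-closed)

      rev-∉ : s₁ ∉ s₂ ∷ μ s₂ ∷ []
      rev-∉ (here e) = proj₁ (proj₂ second) (here (sym e))
      rev-∉ (there (here e)) = proj₁ (proj₂ second) (there (here (trans (sym (μμ s₂)) (cong μ (sym e)))))

      W₀-unique : Unique W₀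
      W₀-unique = edge-unique (edge-closed []-closed) rev-∉ (edge-unique []-closed (λ ()) [])

      -- If some `y` in `S` were missed, both choices were made inside `S`, and together with `y`
      -- and all mates they give six vertices of `S`.
      S⊆W₀ : ∀ {x} → x ∈ₛ S → x ∈ W₀
      S⊆W₀ {y} y∈ = decidable-stable (Any.any? (y ≟ᵥ_) W₀) λ y∉ → few (subset-count (y ∷ μ y ∷ W₀) S (edge-unique W₀-closed y∉ W₀-unique) (all-in y∉))
        where
        closedS : ∀ {x} → x ∈ₛ S → μ x ∈ₛ S
        closedS {x} = proj₁ forcing x
        module _ (y∉ : y ∉ W₀) where
          s₁∈ : s₁ ∈ₛ S
          s₁∈ = proj₂ (proj₂ first) y∈ λ ()
          s₂∈ : s₂ ∈ₛ S
          s₂∈ = proj₂ (proj₂ second) y∈ λ { (here e) → y∉ (here e) ; (there (here e)) → y∉ (there (here e)) }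
          all-in : ∀ {x} → x ∈ y ∷ μ y ∷ W₀ → x ∈ₛ S
          all-in (here refl) = y∈
          all-in (there (here refl)) = closedS y∈
          all-in (there (there (here refl))) = s₁∈
          all-in (there (there (there (here refl)))) = closedS s₁∈
          all-in (there (there (there (there (here refl))))) = s₂∈
          all-in (there (there (there (there (there (here refl)))))) = closedS s₂∈

      opaque
        complement : ∃[ U ] allFin n ↭ W₀ ++ U
        complement = extract W₀ W₀-unique (All.tabulate (λ _ → ∈ₚ.∈-allFin _))

      U₀ : List V
      U₀ = proj₁ complement

      split₀ : Split U₀ W₀
      split₀ = split-sym (mkSplit (↭-sym (proj₂ complement)))

      part₀ : Part U₀ W₀
      part₀ = forced-part split₀ W₀-closed S⊆W₀ (here refl)

      contradictory : ⊥
      contradictory = Excluded.contradictory part₀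

theorem1p1 : ∀ (n : ℕ) (F : Fullerene n) →
    (∀ (F24 : Fullerene 24) → ¬ Isomorphic F F24) →
    ∀ (M : PerfectMatching F) (S : Subset n) → IsForcingSet M S → 6 ≤ ∣ S ∣
theorem1p1 n F no-F24 M S forcing = decidable-stable (6 ≤? ∣ S ∣) (Maps.WithMatching.Final.contradictory F M n≢24 S forcing)
  where
  -- A fullerene on 24 vertices would be an admissible `F24` for itself, by the identity.
  n≢24 : n ≢ 24
  n≢24 refl = no-F24 F (↔-id _ , λ u v → mk⇔ id id)
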